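{- Let $n$ be a positive integer and write $2n+3=5^{\beta}n_1$ with $n_1$ a positive integer and $5\nmid n_1$. Then $$t(1,1,5,5;n)=\frac 43(5^{\beta+1}-3)\sigma(n_1)-\frac 83c(2n+3).$$
   Context: $\sigma(n)=\sum_{d\mid n,\,d\ge1}d$. The integers $c(n)$ ($n\ge1$) are defined by $q\prod_{k=1}^{\infty}(1-q^{2k})^2(1-q^{10k})^2=\sum_{n=1}^{\infty}c(n)q^n$ for $|q|<1$. For positive integers $a,b,c,d$ and a nonnegative integer $n$, $t(a,b,c,d;n)$ denotes the number of $(x,y,z,w)\in\mathbb Z^4$ with $n=a\frac{x(x-1)}2+b\frac{y(y-1)}2+c\frac{z(z-1)}2+d\frac{w(w-1)}2$. -}

module Defs where

open import Data.Nat as ℕ using (ℕ; zero; suc)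
open import Data.Nat.Divisibility using (_∣?_)
open import Data.Integer as ℤ using (ℤ; +_)
open import Data.Nat.ListAction using (sum)
open import Data.List using (List; []; _∷_; filter; upTo; map; replicate; length)
open import Data.Product using (_×_; _,_)
open import Relation.Binary.PropositionalEquality using (_≡_)

-- σ(n) = sum of the positive divisors of n (σ(0) = 0, never used)
σ : ℕ → ℕ
σ n = sum (filter (λ d → d ∣? n) (map suc (upTo n)))

-- Power series truncated: a polynomial is a list of integer coefficients,
-- the i-th entry being the coefficient of q^i.
Poly : Set
Poly = List ℤ

_⊕_ : Poly → Poly → Poly
[] ⊕ q = q
p ⊕ [] = p
(a ∷ p) ⊕ (b ∷ q) = (a ℤ.+ b) ∷ (p ⊕ q)

scale : ℤ → Poly → Poly
scale a = map (a ℤ.*_)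

_⊗_ : Poly → Poly → Poly
[] ⊗ q = []
(a ∷ p) ⊗ q = scale a q ⊕ (+ 0 ∷ (p ⊗ q))

coeff : Poly → ℕ → ℤ
coeff [] i = + 0
coeff (a ∷ p) zero = a
coeff (a ∷ p) (suc i) = coeff p i

oneMinusQ^ : ℕ → Poly
oneMinusQ^ m = (+ 1 ∷ replicate (ℕ.pred m) (+ 0)) ⊕ (replicate m (+ 0) Data.List.++ (ℤ.- + 1 ∷ []))
  where import Data.List

prodUpTo : ℕ → Poly
prodUpTo zero = + 1 ∷ []
prodUpTo (suc k) =
  prodUpTo k ⊗ (f (2 ℕ.* suc k) ⊗ (f (2 ℕ.* suc k) ⊗ (f (10 ℕ.* suc k) ⊗ f (10 ℕ.* suc k))))
  where f = oneMinusQ^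

-- c(m) = coefficient of q^m in q ∏_{k≥1}(1-q^{2k})^2(1-q^{10k})^2,
-- i.e. coefficient of q^(m-1) in the product; factors with k ≥ m do not
-- affect that coefficient, so truncating at k = m is exact.
c : ℕ → ℤ
c zero = + 0
c (suc m) = coeff (prodUpTo (suc m)) m

-- 2 * (a x(x-1)/2 + b y(y-1)/2 + c z(z-1)/2 + d w(w-1)/2)
twiceQuad : ℕ → ℕ → ℕ → ℕ → ℤ × ℤ × ℤ × ℤ → ℤ
twiceQuad a b c' d (x , y , z , w) =
  + a ℤ.* (x ℤ.* (x ℤ.- + 1)) ℤ.+ + b ℤ.* (y ℤ.* (y ℤ.- + 1))
  ℤ.+ + c' ℤ.* (z ℤ.* (z ℤ.- + 1)) ℤ.+ + d ℤ.* (w ℤ.* (w ℤ.- + 1))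

-- (x,y,z,w) is a representation of n by a T_x + b T_y + c T_z + d T_w
IsRep : ℕ → ℕ → ℕ → ℕ → ℕ → ℤ × ℤ × ℤ × ℤ → Set
IsRep a b c' d n v = twiceQuad a b c' d v ≡ + (2 ℕ.* n)

{-# OPTIONS --safe #-}
-- Put ψ = Σ_{k ≥ 0} q^(k(k+1)/2), ψ₅ = ψ(q⁵), Eₘ = ∏_{k ≥ 1} (1 - q^(mk)).  The number t(1,1,5,5;n) is the coefficient
-- of qⁿ in 16 ψ²ψ₅².  Multiplication by 2 + i splits the Gaussian integers into five cosets, which gives
--   ψ² - qψ₅² = f(q,q⁴) f(q²,q³)   and   φ(-q)² - φ(-q⁵)² = -4q f(-q,-q⁹) f(-q³,-q⁷);
-- after evaluating every theta function by Jacobi's triple product these combine to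
--   (ψ² - qψ₅²)(ψ² - 5qψ₅²) = E₁²E₅².
-- So 6qψ²ψ₅² + E₁²E₅² = ψ⁴ + 5q²ψ₅⁴, and Legendre's theorem ψ⁴ = Σ σ(2k+1) q^k turns the right-hand side into
-- divisor sums.  Legendre's theorem is the evaluation of φ′(q)φ(-q) - φ(q)φ(-q)′ in two ways: from the product
-- formula, as a Lambert series, and as a double sum that is the square of Jacobi's series for E³.
--
-- All of this takes place in commutative rings in which q is nilpotent, so that every sum and product is finite;
-- differentiation is done by passing to dual numbers, and at the end the ring is ℤ[t]/(t^P) with q = t².
module Submission where

open import Algebra.Bundles using (CommutativeMonoid; CommutativeRing)
import Algebra.Solver.Ring
open import Algebra.Solver.Ring.AlmostCommutativeRing using (fromCommutativeRing; _-Raw-AlmostCommutative⟶_)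
open import Data.Empty using (⊥; ⊥-elim)
open import Data.Fin as Fin using (Fin; toℕ; fromℕ<; #_) renaming (zero to fzero; suc to fsuc)
import Data.Fin.Properties as Fin
open import Data.Integer as ℤ using (ℤ; +_; -[1+_])
import Data.Integer.DivMod as ℤ
import Data.Integer.Properties as ℤ
import Data.Integer.Solver
import Data.Integer.Tactic.RingSolver as ℤ-Solver
open import Data.List using (List; []; _∷_; _++_; length; map; filter; upTo; concatMap; allFin; replicate)
import Data.List.Membership.DecPropositional as DecMembership
open import Data.List.Membership.Propositional using (_∈_; _∉_)
open import Data.List.Membership.Propositional.Properties using (∈-++⁻; ∈-++⁺ˡ; ∈-++⁺ʳ; ∈-∃++; ∈-map⁺; ∈-map⁻; ∈-filter⁺; ∈-filter⁻; ∈-upTo⁺; ∈-allFin)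
import Data.List.Properties as List
open import Data.List.Relation.Unary.All as All using ([]; _∷_)
open import Data.List.Relation.Unary.AllPairs using ([]; _∷_)
open import Data.List.Relation.Unary.Any using (here; there)
open import Data.List.Relation.Unary.Unique.Propositional using (Unique)
import Data.List.Relation.Unary.Unique.Propositional.Properties as Unique
open import Data.Maybe using (Maybe; just; nothing)
open import Data.Nat as ℕ using (ℕ; zero; suc)
open import Data.Nat.Divisibility using (_∣_; _∣?_; divides; ∣⇒≤; 0∣⇒≡0; ∣1⇒≡1; ∣-trans; m∣m*n; n∣m*n; *-monoʳ-∣; *-cancelˡ-∣; ∣m+n∣m⇒∣n)
import Data.Nat.DivMod as ℕ
open import Data.Nat.ListAction using (sum)
open import Data.Nat.Primality using (Prime; prime?; euclidsLemma)
import Data.Nat.Properties as ℕ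
import Data.Nat.Tactic.RingSolver as ℕ-Solver
open import Data.Product using (_×_; Σ; _,_; proj₁; proj₂)
import Data.Product.Properties as ×
open import Data.Sum using (_⊎_; inj₁; inj₂; [_,_])
open import Function using (_∘_)
open import Function.Bundles using (_⇔_; mk⇔)
open import Level using (0ℓ)
open import Relation.Binary.Definitions using (DecidableEquality)
open import Relation.Binary.PropositionalEquality as ≡ using (_≡_)
open import Relation.Nullary using (¬_; Dec; yes; no)
open import Relation.Nullary.Decidable using (from-yes; ¬?)

-- Put U = f(q,q⁴) f(q²,q³), so that ψ² = qψ₅² + U, and the triple product gives U = E₂E₅³/(E₁E₁₀).
-- The factor ψ² - 5qψ₅² = U - 4qψ₅² is a difference of two eta quotients. With denominators cleared
-- it is the second coset identity, so it is the single quotient E₁³E₁₀/(E₂E₅), and the product with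
-- U collapses to E₁²E₅². The obstacle is division. Products of factors 1 - x with x nilpotent are
-- inverted by terminating geometric series, but integers are not, since the ring is arbitrary.
-- Hence quotients appear as cross-multiplied equations, the theta series run over all of ℤ (which
-- doubles every ψ), and the resulting powers of two are carried along until a coefficient has been
-- taken in ℤ. The substitution q = t² makes the exponents odd: tψ(t²)⁴ is the sum of σ(m)t^m over
-- odd m, and both t³ψ²ψ₅² and tE₁²E₅² are then read at t^(2n+3).

-- Finitely supported sums in a commutative monoid.

module FinSum (M : CommutativeMonoid 0ℓ 0ℓ) where
  open CommutativeMonoid M
  open import Relation.Binary.Reasoning.Setoid setoid
  open import Algebra.Properties.CommutativeSemigroup commutativeSemigroup using (x∙yz≈y∙xz; interchange)

  Σl : {I : Set} → (I → Carrier) → List I → Carrier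
  Σl F [] = ε
  Σl F (i ∷ is) = F i ∙ Σl F is

  Σl-cong : {I : Set} {F G : I → Carrier} (L : List I) → (∀ i → i ∈ L → F i ≈ G i) → Σl F L ≈ Σl G L
  Σl-cong [] F≈G = refl
  Σl-cong (i ∷ L) F≈G = ∙-cong (F≈G i (here ≡.refl)) (Σl-cong L (λ j j∈ → F≈G j (there j∈)))

  Σl-ε : {I : Set} {F : I → Carrier} (L : List I) → (∀ i → i ∈ L → F i ≈ ε) → Σl F L ≈ ε
  Σl-ε [] F≈ε = refl
  Σl-ε (i ∷ L) F≈ε = trans (∙-cong (F≈ε i (here ≡.refl)) (Σl-ε L (λ j j∈ → F≈ε j (there j∈)))) (identityˡ ε)

  Σl-∙ : {I : Set} (F G : I → Carrier) (L : List I) → Σl (λ i → F i ∙ G i) L ≈ Σl F L ∙ Σl G L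
  Σl-∙ F G [] = sym (identityˡ ε)
  Σl-∙ F G (i ∷ L) = trans (∙-congˡ (Σl-∙ F G L)) (interchange (F i) (G i) (Σl F L) (Σl G L))

  Σl-++ : {I : Set} (F : I → Carrier) (L L′ : List I) → Σl F (L ++ L′) ≈ Σl F L ∙ Σl F L′
  Σl-++ F [] L′ = sym (identityˡ _)
  Σl-++ F (i ∷ L) L′ = trans (∙-congˡ (Σl-++ F L L′)) (sym (assoc _ _ _))

  Σl-map : {I J : Set} (F : J → Carrier) (f : I → J) (L : List I) → Σl F (map f L) ≡ Σl (F ∘ f) L
  Σl-map F f [] = ≡.refl
  Σl-map F f (i ∷ L) = ≡.cong (F (f i) ∙_) (Σl-map F f L)

  Σl-concatMap : {I J : Set} (F : J → Carrier) (f : I → List J) (L : List I) →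
    Σl F (concatMap f L) ≈ Σl (λ i → Σl F (f i)) L
  Σl-concatMap F f [] = refl
  Σl-concatMap F f (i ∷ L) = trans (Σl-++ F (f i) (concatMap f L)) (∙-congˡ (Σl-concatMap F f L))

  -- Induction on `L`: its head either is absent from `L′` and contributes `ε`, or is cut out of
  -- `L′` at the place where it occurs. This is what makes the value of a finitely supported sum
  -- independent of the list used to compute it.
  Σl-support : {I : Set} (F : I → Carrier) (L L′ : List I) → Unique L → Unique L′ →
    (∀ i → i ∈ L → i ∉ L′ → F i ≈ ε) → (∀ i → i ∈ L′ → i ∉ L → F i ≈ ε) →
    (∀ i → Dec (i ∈ L′)) → Σl F L ≈ Σl F L′
  Σl-support F [] L′ _ _ _ out′ _ = sym (Σl-ε L′ (λ i i∈ → out′ i i∈ (λ ())))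
  Σl-support F (i ∷ L) L′ (i# ∷ u) u′ out out′ dec with dec i
  ... | no i∉ = begin
    F i ∙ Σl F L ≈⟨ ∙-congʳ (out i (here ≡.refl) i∉) ⟩
    ε ∙ Σl F L ≈⟨ identityˡ _ ⟩
    Σl F L ≈⟨ Σl-support F L L′ u u′ (λ j j∈ → out j (there j∈))
                (λ j j∈ j∉ → out′ j j∈ λ { (here ≡.refl) → i∉ j∈ ; (there j∈L) → j∉ j∈L }) dec ⟩
    Σl F L′ ∎
  ... | yes i∈ with ∈-∃++ i∈
  ...   | (A , B , ≡.refl) = begin
    F i ∙ Σl F L ≈⟨ ∙-congˡ (Σl-support F L (A ++ B) u uAB
        (λ j j∈ j∉ → out j (there j∈) λ j∈′ → [ (λ e → All.lookup i# j∈ (≡.sym e)) , j∉ ] (split j∈′))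
        (λ j j∈ j∉ → out′ j (unsplit j∈) λ { (here ≡.refl) → i∉AB j∈ ; (there j∈L) → j∉ j∈L })
        dec′) ⟩
    F i ∙ Σl F (A ++ B) ≈⟨ ∙-congˡ (Σl-++ F A B) ⟩
    F i ∙ (Σl F A ∙ Σl F B) ≈⟨ x∙yz≈y∙xz (F i) (Σl F A) (Σl F B) ⟩
    Σl F A ∙ (F i ∙ Σl F B) ≈⟨ Σl-++ F A (i ∷ B) ⟨
    Σl F (A ++ i ∷ B) ∎
    where
    split : ∀ {j} → j ∈ A ++ i ∷ B → (j ≡ i) ⊎ (j ∈ A ++ B)
    split j∈ with ∈-++⁻ A j∈
    ... | inj₁ j∈A = inj₂ (∈-++⁺ˡ j∈A)
    ... | inj₂ (here e) = inj₁ e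
    ... | inj₂ (there j∈B) = inj₂ (∈-++⁺ʳ A j∈B)
    unsplit : ∀ {j} → j ∈ A ++ B → j ∈ A ++ i ∷ B
    unsplit j∈ with ∈-++⁻ A j∈
    ... | inj₁ j∈A = ∈-++⁺ˡ j∈A
    ... | inj₂ j∈B = ∈-++⁺ʳ A (there j∈B)
    remove : ∀ A′ → Unique (A′ ++ i ∷ B) → (i ∉ A′ ++ B) × Unique (A′ ++ B)
    remove [] (i#B ∷ uB) = (λ i∈B → All.lookup i#B i∈B ≡.refl) , uB
    remove (a ∷ A′) (a# ∷ uA) with remove A′ uA
    ... | i∉ , uAB′ = (λ { (here ≡.refl) → All.lookup a# (∈-++⁺ʳ A′ (here ≡.refl)) ≡.refl
                       ; (there i∈′) → i∉ i∈′ })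
                   , All.tabulate (λ {j} j∈ e → All.lookup a# (un A′ j∈) e) ∷ uAB′
      where
      un : ∀ A″ {j} → j ∈ A″ ++ B → j ∈ A″ ++ i ∷ B
      un A″ j∈ with ∈-++⁻ A″ j∈
      ... | inj₁ j∈A = ∈-++⁺ˡ j∈A
      ... | inj₂ j∈B = ∈-++⁺ʳ A″ (there j∈B)
    i∉AB = proj₁ (remove A u′)
    uAB = proj₂ (remove A u′)
    dec′ : ∀ j → Dec (j ∈ A ++ B)
    dec′ j with dec j
    ... | no j∉ = no (λ j∈ → j∉ (unsplit j∈))
    ... | yes j∈ with split j∈
    ...   | inj₂ j∈′ = yes j∈′
    ...   | inj₁ ≡.refl = no i∉AB

  -- An infinite sum without convergence: the list is a witness that contains the support but may be
  -- larger. By `hs-unique` the value does not depend on it, so two evaluations of one family give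
  -- an identity.
  record HasSum {I : Set} (F : I → Carrier) (s : Carrier) : Set where
    constructor hasSum
    field
      list : List I
      unique : Unique list
      outside : ∀ i → i ∉ list → F i ≈ ε
      value : Σl F list ≈ s
  open HasSum

  hs-unique : {I : Set} → DecidableEquality I → {F : I → Carrier} {s s′ : Carrier} →
    HasSum F s → HasSum F s′ → s ≈ s′
  hs-unique _≟_ {F} {s} {s′} h h′ = begin
    s ≈⟨ value h ⟨
    Σl F (list h) ≈⟨ Σl-support F _ _ (unique h) (unique h′) (λ i _ → outside h′ i) (λ i _ → outside h i)
                      (_∈? list h′) ⟩
    Σl F (list h′) ≈⟨ value h′ ⟩
    s′ ∎
    where open DecMembership _≟_ using (_∈?_)

  hs-cong : {I : Set} {F G : I → Carrier} {s s′ : Carrier} →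
    (∀ i → F i ≈ G i) → s ≈ s′ → HasSum F s → HasSum G s′
  hs-cong F≈G s≈s′ (hasSum L u o v) =
    hasSum L u (λ i i∉ → trans (sym (F≈G i)) (o i i∉)) (trans (Σl-cong L (λ i _ → sym (F≈G i))) (trans v s≈s′))

  hs-reindex : {I J : Set} (f : I → J) (g : J → I) → (∀ j → f (g j) ≡ j) → (∀ i → g (f i) ≡ i) →
    {F : J → Carrier} {s : Carrier} → HasSum (F ∘ f) s → HasSum F s
  hs-reindex f g fg gf {F} (hasSum L u o v) = hasSum (map f L)
    (Unique.map⁺ (λ {i} {i′} e → ≡.trans (≡.sym (gf i)) (≡.trans (≡.cong g e) (gf i′))) u)
    (λ j j∉ → trans (reflexive (≡.cong F (≡.sym (fg j))))
       (o (g j) (λ gj∈ → j∉ (≡.subst (_∈ map f L) (fg j) (∈-map⁺ f gj∈)))))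
    (trans (reflexive (Σl-map F f L)) v)

  hs-∙ : {I : Set} → DecidableEquality I → {F G : I → Carrier} {s s′ : Carrier} →
    HasSum F s → HasSum G s′ → HasSum (λ i → F i ∙ G i) (s ∙ s′)
  hs-∙ _≟_ {F} {G} {s} {s′} h h′ = hasSum L u out
    (trans (Σl-∙ F G L) (∙-cong
      (trans (Σl-support F _ _ u (unique h) (λ i _ → outside h i) (λ i i∈ i∉ → ⊥-elim (i∉ (∈-++⁺ˡ i∈))) (_∈? list h)) (value h))
      (trans (Σl-support G _ _ u (unique h′) (λ i _ → outside h′ i) (λ i i∈ i∉ → outG i (λ i∈′ → i∉ i∈′)) (_∈? list h′)) (value h′))))
    where
    open DecMembership _≟_ using (_∈?_)
    R = filter (λ i → ¬? (i ∈? list h)) (list h′)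
    L = list h ++ R
    u : Unique L
    u = Unique.++⁺ (unique h) (Unique.filter⁺ _ (unique h′))
          (λ (i∈ , i∈R) → proj₂ (∈-filter⁻ (λ i → ¬? (i ∈? list h)) {xs = list h′} i∈R) i∈)
    outG : ∀ i → i ∉ L → G i ≈ ε
    outG i i∉ = outside h′ i (λ i∈′ → i∉ (∈-++⁺ʳ (list h)
      (∈-filter⁺ (λ i → ¬? (i ∈? list h)) i∈′ (λ i∈ → i∉ (∈-++⁺ˡ i∈)))))
    out : ∀ i → i ∉ L → F i ∙ G i ≈ ε
    out i i∉ = trans (∙-cong (outside h i (λ i∈ → i∉ (∈-++⁺ˡ i∈))) (outG i i∉)) (identityˡ ε)

  -- Summation by rows. Every row brings a list of its own, and rows outside `L` must vanish
  -- identically, because a row whose sum is `ε` may still have nonzero terms.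
  hs-Σ : {I J : Set} → DecidableEquality I → (F : I × J → Carrier) (g : I → Carrier) (L : List I) → Unique L →
    (∀ i → i ∉ L → ∀ j → F (i , j) ≈ ε) → (∀ i → HasSum (λ j → F (i , j)) (g i)) →
    HasSum F (Σl g L)
  hs-Σ {I} {J} _≟_ F g L u o h = hasSum (pairs L) (uniq L u) out val
    where
    open DecMembership _≟_ using (_∈?_)
    row : I → List (I × J)
    row i = map (i ,_) (list (h i))
    pairs : List I → List (I × J)
    pairs = concatMap row
    in-pairs : ∀ L′ {i j} → i ∈ L′ → j ∈ list (h i) → (i , j) ∈ pairs L′
    in-pairs (i ∷ L′) (here ≡.refl) j∈ = ∈-++⁺ˡ (∈-map⁺ (i ,_) j∈)
    in-pairs (i′ ∷ L′) (there i∈) j∈ = ∈-++⁺ʳ (row i′) (in-pairs L′ i∈ j∈)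
    fst-in : ∀ L′ {p} → p ∈ pairs L′ → proj₁ p ∈ L′
    fst-in (i ∷ L′) p∈ with ∈-++⁻ (row i) p∈
    ... | inj₁ p∈r with ∈-map⁻ (i ,_) p∈r
    ...   | (j , _ , ≡.refl) = here ≡.refl
    fst-in (i ∷ L′) p∈ | inj₂ p∈′ = there (fst-in L′ p∈′)
    uniq : ∀ L′ → Unique L′ → Unique (pairs L′)
    uniq [] _ = []
    uniq (i ∷ L′) (i# ∷ u′) = Unique.++⁺ (Unique.map⁺ (λ { ≡.refl → ≡.refl }) (unique (h i))) (uniq L′ u′) disj
      where
      disj : ∀ {p} → ¬ ((p ∈ row i) × (p ∈ pairs L′))
      disj (p∈ , p∈′) with ∈-map⁻ (i ,_) p∈
      ... | (j , _ , ≡.refl) = All.lookup i# (fst-in L′ p∈′) ≡.refl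
    out : ∀ p → p ∉ pairs L → F p ≈ ε
    out (i , j) p∉ with i ∈? L
    ... | no i∉ = o i i∉ j
    ... | yes i∈ = outside (h i) j (λ j∈ → p∉ (in-pairs L i∈ j∈))
    val : Σl F (pairs L) ≈ Σl g L
    val = trans (Σl-concatMap F row L) (Σl-cong L (λ i _ → trans (reflexive (Σl-map F (i ,_) (list (h i)))) (value (h i))))

module _ (M M′ : CommutativeMonoid 0ℓ 0ℓ) where
  private
    module M = CommutativeMonoid M
    module M′ = CommutativeMonoid M′
    module S = FinSum M
    module S′ = FinSum M′

  -- Used for multiplication by a constant, for negation, for the two projections of dual numbers
  -- and for taking a coefficient of a power series.
  hs-hom : (f : M.Carrier → M′.Carrier) → (∀ {x y} → x M.≈ y → f x M′.≈ f y) →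
    (∀ x y → f (x M.∙ y) M′.≈ f x M′.∙ f y) → f M.ε M′.≈ M′.ε →
    {I : Set} {F : I → M.Carrier} {s : M.Carrier} → S.HasSum F s → S′.HasSum (f ∘ F) (f s)
  hs-hom f f-cong f-∙ f-ε {I} {F} (S.hasSum L u o v) =
    S′.hasSum L u (λ i i∉ → M′.trans (f-cong (o i i∉)) f-ε) (M′.trans (go L) (f-cong v))
    where
    go : ∀ L → S′.Σl (f ∘ F) L M′.≈ f (S.Σl F L)
    go [] = M′.sym f-ε
    go (i ∷ L) = M′.trans (M′.∙-congˡ (go L)) (M′.sym (f-∙ _ _))

-- Infinite products, units and nilpotents in a ring with a map from ℤ.

ℤ⟶_ : CommutativeRing 0ℓ 0ℓ → Set
ℤ⟶ R = ℤ.+-*-rawRing -Raw-AlmostCommutative⟶ fromCommutativeRing R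

-- The value is k(k-1)/2, so `tri (suc k)` is the k-th triangular number.
tri : ℕ → ℕ
tri zero = 0
tri (suc k) = k ℕ.+ tri k

k≤tri : ∀ k → k ℕ.≤ tri (suc k)
k≤tri k = ℕ.m≤m+n k (tri k)

module NilpotentRing (R : CommutativeRing 0ℓ 0ℓ) (ι : ℤ⟶ R) where
  open CommutativeRing R public
  private module ι = _-Raw-AlmostCommutative⟶_ ι
  open import Algebra.Properties.Semiring.Exp semiring public
  open import Algebra.Properties.CommutativeSemiring.Exp commutativeSemiring public using (^-distrib-*)
  open import Algebra.Properties.Ring ring public using (-‿distribˡ-*)
  open import Relation.Binary.Reasoning.Setoid setoid public
  open FinSum +-commutativeMonoid public

  -- ι adjusted so that the ring solver's constants 0 and 1 compute to 0# and 1#.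
  ⟦_⟧ : ℤ → Carrier
  ⟦ + 0 ⟧ = 0#
  ⟦ + 1 ⟧ = 1#
  ⟦ z@(+ suc (suc _)) ⟧ = ι.⟦ z ⟧
  ⟦ z@(-[1+ _ ]) ⟧ = ι.⟦ z ⟧

  ⟦⟧≈ι : ∀ z → ⟦ z ⟧ ≈ ι.⟦ z ⟧
  ⟦⟧≈ι (+ 0) = sym ι.0-homo
  ⟦⟧≈ι (+ 1) = sym ι.1-homo
  ⟦⟧≈ι (+ suc (suc n)) = refl
  ⟦⟧≈ι (-[1+ n ]) = refl

  ι′ : ℤ⟶ R
  ι′ = record
    { ⟦_⟧ = ⟦_⟧
    ; +-homo = λ a b → trans (⟦⟧≈ι (a ℤ.+ b)) (trans (ι.+-homo a b) (sym (+-cong (⟦⟧≈ι a) (⟦⟧≈ι b))))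
    ; *-homo = λ a b → trans (⟦⟧≈ι (a ℤ.* b)) (trans (ι.*-homo a b) (sym (*-cong (⟦⟧≈ι a) (⟦⟧≈ι b))))
    ; -‿homo = λ a → trans (⟦⟧≈ι (ℤ.- a)) (trans (ι.-‿homo a) (sym (-‿cong (⟦⟧≈ι a))))
    ; 0-homo = refl
    ; 1-homo = refl
    }
  open _-Raw-AlmostCommutative⟶_ ι′ public hiding (⟦_⟧)

  _ι≟_ : (a b : ℤ) → Maybe (⟦ a ⟧ ≈ ⟦ b ⟧)
  a ι≟ b with a ℤ.≟ b
  ... | yes ≡.refl = just refl
  ... | no _ = nothing

  module Solver = Algebra.Solver.Ring ℤ.+-*-rawRing (fromCommutativeRing R) ι′ _ι≟_
  open Solver public using (solve; _:=_; _:+_; _:*_; _:-_; :-_; con; _:^_)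

  Σl-*ˡ : {I : Set} (c : Carrier) (F : I → Carrier) (L : List I) → Σl (λ i → c * F i) L ≈ c * Σl F L
  Σl-*ˡ c F [] = sym (zeroʳ c)
  Σl-*ˡ c F (i ∷ L) = trans (+-congˡ (Σl-*ˡ c F L)) (sym (distribˡ c _ _))

  hs-*ˡ : {I : Set} (c : Carrier) {F : I → Carrier} {s : Carrier} → HasSum F s → HasSum (λ i → c * F i) (c * s)
  hs-*ˡ c = hs-hom +-commutativeMonoid +-commutativeMonoid (c *_) *-congˡ (distribˡ c) (zeroʳ c)

  hs-neg : {I : Set} {F : I → Carrier} {s : Carrier} → HasSum F s → HasSum (λ i → - F i) (- s)
  hs-neg = hs-hom +-commutativeMonoid +-commutativeMonoid -_ -‿cong
    (λ x y → solve 2 (λ x y → :- (x :+ y) := :- x :+ :- y) refl x y)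
    (solve 0 (:- con (+ 0) := con (+ 0)) refl)

  hs-× : {I J : Set} → DecidableEquality I → {F : I → Carrier} {G : J → Carrier} {s t : Carrier} →
    HasSum F s → HasSum G t → HasSum (λ (i , j) → F i * G j) (s * t)
  hs-× _≟_ {F} {G} {s} {t} h h′ = hs-cong (λ _ → refl)
    (begin
      Σl (λ i → F i * t) (HasSum.list h) ≈⟨ Σl-cong (HasSum.list h) (λ i _ → *-comm (F i) t) ⟩
      Σl (λ i → t * F i) (HasSum.list h) ≈⟨ Σl-*ˡ t F (HasSum.list h) ⟩
      t * Σl F (HasSum.list h) ≈⟨ *-congˡ (HasSum.value h) ⟩
      t * s ≈⟨ *-comm t s ⟩
      s * t ∎)
    (hs-Σ _≟_ _ (λ i → F i * t) (HasSum.list h) (HasSum.unique h)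
      (λ i i∉ j → trans (*-congʳ (HasSum.outside h i i∉)) (zeroˡ (G j)))
      (λ i → hs-*ˡ (F i) h′))

  rng : (ℕ → Carrier) → ℕ → Carrier
  rng F zero = 1#
  rng F (suc n) = rng F n * F n

  record HasProd (F : ℕ → Carrier) (p : Carrier) : Set where
    constructor hasProd
    field
      bound : ℕ
      beyond : ∀ k → bound ℕ.≤ k → F k ≈ 1#
      value : rng F bound ≈ p

  rng-cong : ∀ {F G} n → (∀ k → F k ≈ G k) → rng F n ≈ rng G n
  rng-cong zero F≈G = refl
  rng-cong (suc n) F≈G = *-cong (rng-cong n F≈G) (F≈G n)

  rng-* : ∀ F G n → rng (λ k → F k * G k) n ≈ rng F n * rng G n
  rng-* F G zero = sym (*-identityˡ 1#)
  rng-* F G (suc n) = trans (*-congʳ (rng-* F G n))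
    (solve 4 (λ a b c d → (a :* b) :* (c :* d) := (a :* c) :* (b :* d)) refl _ _ _ _)

  rng-1 : ∀ {F} n → (∀ k → F k ≈ 1#) → rng F n ≈ 1#
  rng-1 zero F≈1 = refl
  rng-1 (suc n) F≈1 = trans (*-cong (rng-1 n F≈1) (F≈1 n)) (*-identityˡ 1#)

  rng-+ : ∀ F m n → rng F (n ℕ.+ m) ≈ rng F m * rng (λ k → F (k ℕ.+ m)) n
  rng-+ F m zero = sym (*-identityʳ _)
  rng-+ F m (suc n) = trans (*-congʳ (rng-+ F m n)) (*-assoc _ _ _)

  rng-suc : ∀ F n → rng F (suc n) ≈ F 0 * rng (F ∘ suc) n
  rng-suc F zero = *-comm _ _
  rng-suc F (suc n) = trans (*-congʳ (rng-suc F n)) (*-assoc _ _ _)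

  rng-block : ∀ F b n → rng F (n ℕ.* b) ≈ rng (λ k → rng (λ i → F (i ℕ.+ k ℕ.* b)) b) n
  rng-block F b zero = refl
  rng-block F b (suc n) = trans (rng-+ F (n ℕ.* b) b) (*-congʳ (rng-block F b n))

  module _ {F : ℕ → Carrier} {p : Carrier} (h : HasProd F p) where
    open HasProd h

    hp-range : ∀ n → bound ℕ.≤ n → rng F n ≈ p
    hp-range n b≤n = begin
      rng F n ≡⟨ ≡.cong (rng F) (ℕ.m∸n+n≡m b≤n) ⟨
      rng F (n ℕ.∸ bound ℕ.+ bound) ≈⟨ rng-+ F bound (n ℕ.∸ bound) ⟩
      rng F bound * rng (λ k → F (k ℕ.+ bound)) (n ℕ.∸ bound)
        ≈⟨ *-cong value (rng-1 (n ℕ.∸ bound) (λ k → beyond _ (ℕ.m≤n+m bound k))) ⟩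
      p * 1# ≈⟨ *-identityʳ p ⟩
      p ∎

  hp-unique : ∀ {F p p′} → HasProd F p → HasProd F p′ → p ≈ p′
  hp-unique {F} h h′ = trans (sym (hp-range h (HasProd.bound h ℕ.⊔ HasProd.bound h′) (ℕ.m≤m⊔n _ _)))
                     (hp-range h′ _ (ℕ.m≤n⊔m (HasProd.bound h) _))

  hp-cong : ∀ {F G p p′} → (∀ k → F k ≈ G k) → p ≈ p′ → HasProd F p → HasProd G p′
  hp-cong F≈G p≈p′ (hasProd b o v) = hasProd b (λ k b≤ → trans (sym (F≈G k)) (o k b≤))
    (trans (rng-cong b (λ k → sym (F≈G k))) (trans v p≈p′))

  hp-* : ∀ {F G p p′} → HasProd F p → HasProd G p′ → HasProd (λ k → F k * G k) (p * p′)
  hp-* {F} {G} h h′ = hasProd (HasProd.bound h ℕ.⊔ HasProd.bound h′)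
    (λ k b≤ → trans (*-cong (HasProd.beyond h k (ℕ.≤-trans (ℕ.m≤m⊔n _ _) b≤))
                            (HasProd.beyond h′ k (ℕ.≤-trans (ℕ.m≤n⊔m (HasProd.bound h) _) b≤))) (*-identityˡ 1#))
    (trans (rng-* F G (HasProd.bound h ℕ.⊔ HasProd.bound h′)) (*-cong (hp-range h _ (ℕ.m≤m⊔n _ _)) (hp-range h′ _ (ℕ.m≤n⊔m (HasProd.bound h) _))))

  hp-suc : ∀ {F p} → HasProd (F ∘ suc) p → HasProd F (F 0 * p)
  hp-suc {F} (hasProd b o v) = hasProd (suc b) (λ { (suc k) (ℕ.s≤s b≤) → o k b≤ }) (trans (rng-suc F b) (*-congˡ v))

  -- Regrouping into blocks of b consecutive factors; with b = 2 and b = 5 it separates the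
  -- exponents by residue class. The old bound still works because block k starts at index k·b ≥ k.
  hp-block : ∀ {F p} b → .{{ℕ.NonZero b}} → HasProd F p → HasProd (λ k → rng (λ i → F (i ℕ.+ k ℕ.* b)) b) p
  hp-block {F} {p} b h = hasProd (HasProd.bound h)
    (λ k b≤ → rng-1 b (λ i → HasProd.beyond h _ (ℕ.≤-trans b≤ (ℕ.≤-trans (ℕ.m≤m*n k b) (ℕ.m≤n+m _ i)))))
    (trans (sym (rng-block F b (HasProd.bound h))) (hp-range h _ (ℕ.m≤m*n _ b)))

  Nil : Carrier → Set
  Nil x = Σ ℕ λ K → x ^ K ≈ 0#

  Unit : Carrier → Set
  Unit x = Σ Carrier λ y → x * y ≈ 1#

  unit-* : ∀ {x y} → Unit x → Unit y → Unit (x * y)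
  unit-* {x} {y} (u , xu) (v , yv) = u * v ,
    trans (solve 4 (λ x y u v → (x :* y) :* (u :* v) := (x :* u) :* (y :* v)) refl x y u v)
      (trans (*-cong xu yv) (*-identityˡ 1#))

  unit-cong : ∀ {x y} → x ≈ y → Unit x → Unit y
  unit-cong x≈y (u , xu) = u , trans (*-congʳ (sym x≈y)) xu

  unit-cancel : ∀ {x} → Unit x → ∀ {y z} → x * y ≈ x * z → y ≈ z
  unit-cancel {x} (u , xu) {y} {z} e = begin
    y ≈⟨ lem y ⟩
    u * (x * y) ≈⟨ *-congˡ e ⟩
    u * (x * z) ≈⟨ lem z ⟨
    z ∎
    where
    lem : ∀ y → y ≈ u * (x * y)
    lem y = trans (sym (*-identityˡ y)) (trans (*-congʳ (sym xu)) (solve 3 (λ x u y → (x :* u) :* y := u :* (x :* y)) refl x u y))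

  unit-rng : ∀ {F} n → (∀ k → Unit (F k)) → Unit (rng F n)
  unit-rng zero uF = 1# , *-identityˡ 1#
  unit-rng (suc n) uF = unit-* (unit-rng n uF) (uF n)

  unit-HasProd : ∀ {F p} → (∀ k → Unit (F k)) → HasProd F p → Unit p
  unit-HasProd uF h = unit-cong (HasProd.value h) (unit-rng (HasProd.bound h) uF)

  sum< : (ℕ → Carrier) → ℕ → Carrier
  sum< F zero = 0#
  sum< F (suc n) = sum< F n + F n

  sum<-Σl : ∀ F n → sum< F n ≈ Σl F (upTo n)
  sum<-Σl F zero = refl
  sum<-Σl F (suc n) = begin
    sum< F n + F n ≈⟨ +-cong (sum<-Σl F n) (sym (+-identityʳ (F n))) ⟩
    Σl F (upTo n) + (F n + 0#) ≈⟨ Σl-++ F (upTo n) (n ∷ []) ⟨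
    Σl F (upTo n ++ n ∷ []) ≡⟨ ≡.cong (Σl F) (List.upTo-∷ʳ n) ⟩
    Σl F (upTo (suc n)) ∎

  geo : Carrier → ℕ → Carrier
  geo x = sum< (x ^_)

  geo-* : ∀ x K → (1# - x) * geo x K ≈ 1# - x ^ K
  geo-* x zero = solve 1 (λ x → (con (+ 1) :- x) :* con (+ 0) := con (+ 1) :- con (+ 1)) refl x
  geo-* x (suc K) = begin
    (1# - x) * (geo x K + x ^ K) ≈⟨ distribˡ _ _ _ ⟩
    (1# - x) * geo x K + (1# - x) * x ^ K ≈⟨ +-congʳ (geo-* x K) ⟩
    1# - x ^ K + (1# - x) * x ^ K
      ≈⟨ solve 2 (λ x y → con (+ 1) :- y :+ (con (+ 1) :- x) :* y := con (+ 1) :- x :* y) refl x (x ^ K) ⟩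
    1# - x ^ suc K ∎

  nil-cong : ∀ {x y} → x ≈ y → Nil x → Nil y
  nil-cong x≈y (K , e) = K , trans (sym (^-congˡ K x≈y)) e

  nil-* : ∀ y {x} → Nil x → Nil (y * x)
  nil-* y {x} (K , e) = K , trans (^-distrib-* y x K) (trans (*-congˡ e) (zeroʳ _))

  nil-suc : ∀ {x} k → Nil x → Nil (x ^ suc k)
  nil-suc {x} k n = nil-cong (*-comm (x ^ k) x) (nil-* (x ^ k) n)

  nil-≤ : ∀ {x} ((K , _) : Nil x) {n} → K ℕ.≤ n → x ^ n ≈ 0#
  nil-≤ {x} (K , e) {n} K≤n = begin
    x ^ n ≡⟨ ≡.cong (x ^_) (ℕ.m+[n∸m]≡n K≤n) ⟨
    x ^ (K ℕ.+ (n ℕ.∸ K)) ≈⟨ ^-homo-* x K (n ℕ.∸ K) ⟩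
    x ^ K * x ^ (n ℕ.∸ K) ≈⟨ *-congʳ e ⟩
    0# * x ^ (n ℕ.∸ K) ≈⟨ zeroˡ _ ⟩
    0# ∎

  1-0 : ∀ {x} → x ≈ 0# → 1# - x ≈ 1#
  1-0 x≈0 = trans (+-congˡ (-‿cong x≈0)) (solve 0 (con (+ 1) :- con (+ 0) := con (+ 1)) refl)

  -- The geometric series stops at the nilpotency exponent. All invertibility in the proof goes back
  -- to this.
  unit-1-nil : ∀ {x} → Nil x → Unit (1# - x)
  unit-1-nil {x} (K , e) = geo x K , trans (geo-* x K) (1-0 e)

  -- Sums over the antidiagonal i + l = n, and Jacobi's triple product.

  AD : ℕ → (ℕ → ℕ → Carrier) → Carrier
  AD zero h = h 0 0
  AD (suc n) h = h 0 (suc n) + AD n (λ i l → h (suc i) l)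

  AD-cong : ∀ n {h h′} → (∀ i l → i ℕ.+ l ≡ n → h i l ≈ h′ i l) → AD n h ≈ AD n h′
  AD-cong zero e = e 0 0 ≡.refl
  AD-cong (suc n) e = +-cong (e 0 (suc n) ≡.refl) (AD-cong n (λ i l p → e (suc i) l (≡.cong suc p)))

  AD-last : ∀ n h → AD (suc n) h ≈ AD n (λ i l → h i (suc l)) + h (suc n) 0
  AD-last zero h = refl
  AD-last (suc n) h = trans (+-congˡ (AD-last n (λ i l → h (suc i) l))) (sym (+-assoc _ _ _))

  AD-swap : ∀ n h → AD n h ≈ AD n (λ i l → h l i)
  AD-swap zero h = refl
  AD-swap (suc n) h = begin
    h 0 (suc n) + AD n (λ i l → h (suc i) l) ≈⟨ +-comm _ _ ⟩
    AD n (λ i l → h (suc i) l) + h 0 (suc n) ≈⟨ +-congʳ (AD-swap n _) ⟩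
    AD n (λ i l → h (suc l) i) + h 0 (suc n) ≈⟨ AD-last n (λ i l → h l i) ⟨
    AD (suc n) (λ i l → h l i) ∎

  AD-+ : ∀ n h h′ → AD n (λ i l → h i l + h′ i l) ≈ AD n h + AD n h′
  AD-+ zero h h′ = refl
  AD-+ (suc n) h h′ = trans (+-congˡ (AD-+ n _ _))
    (solve 4 (λ a b c d → (a :+ b) :+ (c :+ d) := (a :+ c) :+ (b :+ d)) refl _ _ _ _)

  AD-* : ∀ n c h → AD n (λ i l → c * h i l) ≈ c * AD n h
  AD-* zero c h = refl
  AD-* (suc n) c h = trans (+-congˡ (AD-* n c _)) (sym (distribˡ c _ _))

  AD-Σl : ∀ n F → AD n (λ i _ → F i) ≈ Σl F (upTo (suc n))
  AD-Σl zero F = sym (+-identityʳ _)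
  AD-Σl (suc n) F = +-congˡ (trans (AD-Σl n (F ∘ suc))
    (reflexive (≡.trans (≡.sym (Σl-map F suc (upTo (suc n)))) (≡.cong (Σl F) (List.map-upTo suc (suc n))))))

  -- One half of the bilateral series: with N = αβ this is α^(k(k+1)/2) β^(k(k-1)/2), and the
  -- negative indices give the same expression with α and β exchanged.
  tri⁺ : Carrier → Carrier → ℕ → Carrier
  tri⁺ N α k = N ^ tri k * α ^ k

  -- The general term α^(n(n+1)/2) β^(n(n-1)/2) of Ramanujan's theta function f(α, β).
  theta : Carrier → Carrier → ℤ → Carrier
  theta α β (+ k) = tri⁺ (α * β) α k
  theta α β -[1+ k ] = tri⁺ (α * β) β (suc k)

  -- With (N)ᵢ = poch i and uᵢ = 1/(N)ᵢ, the sum (N)_M w M s is Σ_i [M choose i] sᵢ with Gaussian binomials; w-step is Pascal's rule.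
  module FiniteTripleProduct (N : Carrier) (N-nil : Nil N) where
    poch : ℕ → Carrier
    poch = rng (λ k → 1# - N ^ suc k)

    poch-unit : ∀ i → Unit (poch i)
    poch-unit i = unit-rng i (λ k → unit-1-nil (nil-suc k N-nil))

    u : ℕ → Carrier
    u i = proj₁ (poch-unit i)

    u-suc : ∀ i → u (suc i) * (1# - N ^ suc i) ≈ u i
    u-suc i = unit-cancel (poch-unit i) (begin
      poch i * (u (suc i) * (1# - N ^ suc i)) ≈⟨ solve 3 (λ p u x → p :* (u :* x) := (p :* x) :* u) refl _ _ _ ⟩
      poch (suc i) * u (suc i) ≈⟨ proj₂ (poch-unit (suc i)) ⟩
      1# ≈⟨ proj₂ (poch-unit i) ⟨
      poch i * u i ∎)

    w : ℕ → (ℕ → Carrier) → Carrier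
    w M s = AD M (λ i l → u i * u l * s i)

    w-step : ∀ M (s : ℕ → Carrier) x → (∀ i l → i ℕ.+ l ≡ M → x * s i ≈ N ^ l * s (suc i)) →
      (1# - N ^ suc M) * w (suc M) s ≈ (1# + x) * w M s
    w-step M s x xs = begin
      (1# - N ^ suc M) * w (suc M) s ≈⟨ AD-* (suc M) (1# - N ^ suc M) (λ i l → u i * u l * s i) ⟨
      AD (suc M) (λ i l → (1# - N ^ suc M) * (u i * u l * s i)) ≈⟨ AD-cong (suc M) split ⟩
      AD (suc M) (λ i l → A i l + B i l) ≈⟨ AD-+ (suc M) A B ⟩
      AD (suc M) A + AD (suc M) B ≈⟨ +-cong (AD-last M A) refl ⟩
      (AD M (λ i l → A i (suc l)) + A (suc M) 0) + (B 0 (suc M) + AD M (λ i l → B (suc i) l))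
        ≈⟨ +-cong (+-cong (AD-cong M A-suc) (A0 (u (suc M)) (u 0) (s (suc M))))
                  (+-cong (B0 (u 0) (u (suc M)) (s 0) (N ^ suc M)) (AD-cong M B-suc)) ⟩
      (w M s + 0#) + (0# + AD M (λ i l → x * (u i * u l * s i)))
        ≈⟨ +-cong (+-identityʳ _) (trans (+-identityˡ _) (AD-* M x (λ i l → u i * u l * s i))) ⟩
      w M s + x * w M s ≈⟨ solve 2 (λ w x → w :+ x :* w := (con (+ 1) :+ x) :* w) refl (w M s) x ⟩
      (1# + x) * w M s ∎
      where
      A B : ℕ → ℕ → Carrier
      A i l = u i * (u l * (1# - N ^ l)) * s i
      B i l = (u i * (1# - N ^ i)) * u l * (N ^ l * s i)
      -- Pascal's rule in the form 1 - N^(i+l) = (1 - N^l) + N^l (1 - N^i): each summand cancels the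
      -- last factor of one of the two denominators.
      split : ∀ i l → i ℕ.+ l ≡ suc M → (1# - N ^ suc M) * (u i * u l * s i) ≈ A i l + B i l
      split i l e = trans (*-congʳ (+-congˡ (-‿cong (trans (^-congʳ N (≡.sym e)) (^-homo-* N i l)))))
        (solve 5 (λ ui ul s ni nl → (con (+ 1) :- ni :* nl) :* (ui :* ul :* s)
           := ui :* (ul :* (con (+ 1) :- nl)) :* s :+ (ui :* (con (+ 1) :- ni)) :* ul :* (nl :* s))
           refl (u i) (u l) (s i) (N ^ i) (N ^ l))
      A-suc : ∀ i l → i ℕ.+ l ≡ M → A i (suc l) ≈ u i * u l * s i
      A-suc i l _ = *-congʳ (*-congˡ (u-suc l))
      B-suc : ∀ i l → i ℕ.+ l ≡ M → B (suc i) l ≈ x * (u i * u l * s i)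
      B-suc i l e = begin
        (u (suc i) * (1# - N ^ suc i)) * u l * (N ^ l * s (suc i)) ≈⟨ *-cong (*-congʳ (u-suc i)) (sym (xs i l e)) ⟩
        u i * u l * (x * s i) ≈⟨ solve 3 (λ a x s → a :* (x :* s) := x :* (a :* s)) refl _ _ _ ⟩
        x * (u i * u l * s i) ∎
      A0 : ∀ a b c → a * (b * (1# - 1#)) * c ≈ 0#
      A0 = solve 3 (λ a b c → a :* (b :* (con (+ 1) :- con (+ 1))) :* c := con (+ 0)) refl
      B0 : ∀ a b c d → (a * (1# - 1#)) * b * (d * c) ≈ 0#
      B0 = solve 4 (λ a b c d → (a :* (con (+ 1) :- con (+ 1))) :* b :* (d :* c) := con (+ 0)) refl

    w-rng : ∀ M₀ (s : ℕ → Carrier) (x : ℕ → Carrier) →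
      (∀ m i l → i ℕ.+ l ≡ m ℕ.+ M₀ → x m * s i ≈ N ^ l * s (suc i)) →
      ∀ m → poch (m ℕ.+ M₀) * w (m ℕ.+ M₀) s ≈ rng (λ k → 1# + x k) m * (poch M₀ * w M₀ s)
    w-rng M₀ s x xs zero = sym (*-identityˡ _)
    w-rng M₀ s x xs (suc m) = begin
      poch M * (1# - N ^ suc M) * w (suc M) s ≈⟨ *-assoc _ _ _ ⟩
      poch M * ((1# - N ^ suc M) * w (suc M) s) ≈⟨ *-congˡ (w-step M s (x m) (xs m)) ⟩
      poch M * ((1# + x m) * w M s) ≈⟨ solve 3 (λ a b c → a :* (b :* c) := (a :* c) :* b) refl _ _ _ ⟩
      (poch M * w M s) * (1# + x m) ≈⟨ *-congʳ (w-rng M₀ s x xs m) ⟩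
      (rng (λ k → 1# + x k) m * (poch M₀ * w M₀ s)) * (1# + x m)
        ≈⟨ solve 3 (λ a b c → (a :* b) :* c := (a :* c) :* b) refl _ _ _ ⟩
      rng (λ k → 1# + x k) (suc m) * (poch M₀ * w M₀ s) ∎
      where M = m ℕ.+ M₀

  module JacobiTripleProduct (α β : Carrier) (N-nil : Nil (α * β)) where
    N = α * β
    open FiniteTripleProduct N N-nil

    t-neg : ∀ k → theta α β (ℤ.- + k) ≈ tri⁺ N β k
    t-neg zero = refl
    t-neg (suc k) = refl

    tri⁺-suc : ∀ γ k → γ * N ^ k * tri⁺ N γ k ≈ tri⁺ N γ (suc k)
    tri⁺-suc γ k = begin
      γ * N ^ k * (N ^ tri k * γ ^ k) ≈⟨ solve 4 (λ g a b c → g :* a :* (b :* c) := (a :* b) :* (g :* c)) refl _ _ _ _ ⟩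
      (N ^ k * N ^ tri k) * (γ * γ ^ k) ≈⟨ *-congʳ (^-homo-* N k (tri k)) ⟨
      tri⁺ N γ (suc k) ∎

    -- Consecutive terms satisfy θ(j+1) = α N^j θ(j). The condition i + l = m + n says j = i - n = m
    -- - l, so multiplication by N^l avoids negative exponents. For j < 0 the ratio is read
    -- backwards in the β half, where α meets a β and supplies one more N.
    α-step : ∀ n m i l → i ℕ.+ l ≡ m ℕ.+ n →
      (α * N ^ m) * theta α β (i ℤ.⊖ n) ≈ N ^ l * theta α β (suc i ℤ.⊖ n)
    α-step n m i l e with n ℕ.≤? i
    ... | yes n≤i with ℕ.m≤n⇒∃[o]m+o≡n n≤i
    ...   | (j , ≡.refl) = begin
      (α * N ^ m) * theta α β ((n ℕ.+ j) ℤ.⊖ n)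
        ≡⟨ ≡.cong₂ (λ a b → (α * N ^ a) * theta α β b) m≡ (⊖-+ n j) ⟩
      (α * N ^ (l ℕ.+ j)) * tri⁺ N α j ≈⟨ *-congʳ (*-congˡ (^-homo-* N l j)) ⟩
      (α * (N ^ l * N ^ j)) * tri⁺ N α j
        ≈⟨ solve 4 (λ a b c d → (a :* (b :* c)) :* d := b :* (a :* c :* d)) refl α (N ^ l) (N ^ j) (tri⁺ N α j) ⟩
      N ^ l * (α * N ^ j * tri⁺ N α j) ≈⟨ *-congˡ (tri⁺-suc α j) ⟩
      N ^ l * theta α β (+ suc j)
        ≡⟨ ≡.cong (λ b → N ^ l * theta α β b) (≡.trans (≡.cong (ℤ._⊖ n) (≡.sym (ℕ.+-suc n j))) (⊖-+ n (suc j))) ⟨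
      N ^ l * theta α β (suc (n ℕ.+ j) ℤ.⊖ n) ∎
      where
      ⊖-+ : ∀ n j → (n ℕ.+ j) ℤ.⊖ n ≡ + j
      ⊖-+ n j = ≡.trans (ℤ.⊖-≥ (ℕ.m≤m+n n j)) (≡.cong +_ (ℕ.m+n∸m≡n n j))
      m≡ : m ≡ l ℕ.+ j
      m≡ = ℕ.+-cancelʳ-≡ n m (l ℕ.+ j) (≡.trans (≡.sym e)
        (≡.trans (ℕ.+-comm (n ℕ.+ j) l) (≡.trans (≡.cong (l ℕ.+_) (ℕ.+-comm n j)) (≡.sym (ℕ.+-assoc l j n)))))
    α-step n m i l e | no n≰i with ℕ.m≤n⇒∃[o]m+o≡n (ℕ.≰⇒> n≰i)
    ... | (j , ≡.refl) = begin
      (α * N ^ m) * theta α β (i ℤ.⊖ (suc i ℕ.+ j)) ≡⟨ ≡.cong (λ b → (α * N ^ m) * theta α β b) i⊖ ⟩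
      (α * N ^ m) * tri⁺ N β (suc j) ≈⟨ *-congˡ (tri⁺-suc β j) ⟨
      (α * N ^ m) * (β * N ^ j * tri⁺ N β j)
        ≈⟨ solve 5 (λ a b c d e → (a :* c) :* (b :* d :* e) := ((a :* b) :* (c :* d)) :* e) refl α β (N ^ m) (N ^ j) _ ⟩
      (N * (N ^ m * N ^ j)) * tri⁺ N β j ≈⟨ *-congʳ (*-congˡ (^-homo-* N m j)) ⟨
      N ^ suc (m ℕ.+ j) * tri⁺ N β j ≡⟨ ≡.cong (λ a → N ^ a * tri⁺ N β j) l≡ ⟨
      N ^ l * tri⁺ N β j ≈⟨ *-congˡ (t-neg j) ⟨
      N ^ l * theta α β (ℤ.- + j)
        ≡⟨ ≡.cong (λ b → N ^ l * theta α β b) suci⊖ ⟨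
      N ^ l * theta α β (suc i ℤ.⊖ (suc i ℕ.+ j)) ∎
      where
      i⊖ : i ℤ.⊖ (suc i ℕ.+ j) ≡ -[1+ j ]
      i⊖ = ≡.trans (≡.cong (i ℤ.⊖_) (≡.sym (ℕ.+-suc i j)))
        (≡.trans (ℤ.⊖-≤ (ℕ.m≤m+n i (suc j))) (≡.cong (λ a → ℤ.- + a) (ℕ.m+n∸m≡n i (suc j))))
      suci⊖ : suc i ℤ.⊖ (suc i ℕ.+ j) ≡ ℤ.- + j
      suci⊖ = ≡.trans (ℤ.⊖-≤ (ℕ.m≤m+n (suc i) j)) (≡.cong (λ a → ℤ.- + a) (ℕ.m+n∸m≡n (suc i) j))
      l≡ : l ≡ suc (m ℕ.+ j)
      l≡ = ℕ.+-cancelˡ-≡ i l _ (≡.trans e (rearrange m i j))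
        where
        rearrange : ∀ m i j → m ℕ.+ (suc i ℕ.+ j) ≡ i ℕ.+ suc (m ℕ.+ j)
        rearrange = ℕ-Solver.solve-∀

    β-step : ∀ m i l → i ℕ.+ l ≡ m ℕ.+ 0 → (β * N ^ m) * tri⁺ N β i ≈ N ^ l * tri⁺ N β (suc i)
    β-step m i l e = begin
      (β * N ^ m) * tri⁺ N β i ≡⟨ ≡.cong (λ a → (β * N ^ a) * tri⁺ N β i) (≡.trans e (ℕ.+-identityʳ m)) ⟨
      (β * N ^ (i ℕ.+ l)) * tri⁺ N β i ≈⟨ *-congʳ (*-congˡ (^-homo-* N i l)) ⟩
      (β * (N ^ i * N ^ l)) * tri⁺ N β i ≈⟨ solve 4 (λ a b c d → (a :* (b :* c)) :* d := c :* (a :* b :* d)) refl _ _ _ _ ⟩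
      N ^ l * (β * N ^ i * tri⁺ N β i) ≈⟨ *-congˡ (tri⁺-suc β i) ⟩
      N ^ l * tri⁺ N β (suc i) ∎

    -- Built in two stages, which is why `w-rng` has a free starting size. At size n the index i ⊖ n
    -- equals -l, so only the β half of the series occurs, and `β-step` grows it from size 0;
    -- `α-step` then adds the m factors with α.
    finite : ∀ m n → poch (m ℕ.+ n) * w (m ℕ.+ n) (λ i → theta α β (i ℤ.⊖ n)) ≈
      rng (λ k → 1# + α * N ^ k) m * rng (λ k → 1# + β * N ^ k) n
    finite m n = trans (w-rng n _ _ (α-step n) m) (*-congˡ (begin
      poch n * w n (λ i → theta α β (i ℤ.⊖ n)) ≈⟨ *-congˡ (AD-cong n reflected) ⟩
      poch n * AD n (λ i l → u l * u i * tri⁺ N β l) ≈⟨ *-congˡ (AD-swap n _) ⟩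
      poch n * w n (tri⁺ N β) ≡⟨ ≡.cong (λ n → poch n * w n (tri⁺ N β)) (ℕ.+-identityʳ n) ⟨
      poch (n ℕ.+ 0) * w (n ℕ.+ 0) (tri⁺ N β) ≈⟨ w-rng 0 (tri⁺ N β) (λ k → β * N ^ k) β-step n ⟩
      rng (λ k → 1# + β * N ^ k) n * (1# * (u 0 * u 0 * (1# * 1#)))
        ≈⟨ *-congˡ (trans (solve 1 (λ u → con (+ 1) :* (u :* u :* (con (+ 1) :* con (+ 1))) := (con (+ 1) :* u) :* (con (+ 1) :* u)) refl (u 0))
             (trans (*-cong (proj₂ (poch-unit 0)) (proj₂ (poch-unit 0))) (*-identityˡ 1#))) ⟩
      rng (λ k → 1# + β * N ^ k) n * 1# ≈⟨ *-identityʳ _ ⟩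
      rng (λ k → 1# + β * N ^ k) n ∎))
      where
      reflected : ∀ i l → i ℕ.+ l ≡ n → u i * u l * theta α β (i ℤ.⊖ n) ≈ u l * u i * tri⁺ N β l
      reflected i l ≡.refl = *-cong (*-comm (u i) (u l)) (trans
        (reflexive (≡.cong (theta α β) (≡.trans (ℤ.⊖-≤ (ℕ.m≤m+n i l)) (≡.cong (λ a → ℤ.- + a) (ℕ.m+n∸m≡n i l))))) (t-neg l))

    private K = proj₁ N-nil

    tri⁺-0 : ∀ γ k → K ℕ.< k → tri⁺ N γ k ≈ 0#
    tri⁺-0 γ (suc k) (ℕ.s≤s K≤k) = trans (*-congʳ (nil-≤ N-nil (ℕ.≤-trans K≤k (k≤tri k)))) (zeroˡ _)

    theta-0 : ∀ j → K ℕ.< ℤ.∣ j ∣ → theta α β j ≈ 0#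
    theta-0 (+ k) = tri⁺-0 α k
    theta-0 -[1+ k ] = tri⁺-0 β (suc k)

    poch-stable : ∀ {i} → K ℕ.≤ i → poch i ≈ poch K
    poch-stable = hp-range {p = poch K} (hasProd K (λ k K≤k → 1-0 (nil-≤ N-nil (ℕ.m≤n⇒m≤1+n K≤k))) refl) _

    -- The finite form is already exact at n = 2K + bound, where N^K = 0. If i or l is below K, then
    -- |i - n| > K and the theta term vanishes. Otherwise the Pochhammer products of index i, l, n
    -- and 2n all equal `poch K`, so the weight in front of the theta term is 1.
    tripleProduct : ∀ {p} → HasProd (λ k → (1# + α * N ^ k) * (1# + β * N ^ k) * (1# - N ^ suc k)) p → HasSum (theta α β) p
    tripleProduct {p} hp = hasSum (map (ℤ._⊖ n) (upTo (suc (n ℕ.+ n))))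
      (Unique.map⁺ (λ {i} {j} → ⊖-injective i j) (Unique.upTo⁺ _)) outside′ (begin
        Σl (theta α β) (map (ℤ._⊖ n) (upTo (suc (n ℕ.+ n)))) ≡⟨ Σl-map (theta α β) (ℤ._⊖ n) (upTo (suc (n ℕ.+ n))) ⟩
        Σl (λ i → theta α β (i ℤ.⊖ n)) (upTo (suc (n ℕ.+ n))) ≈⟨ AD-Σl (n ℕ.+ n) _ ⟨
        AD (n ℕ.+ n) (λ i _ → theta α β (i ℤ.⊖ n)) ≈⟨ AD-cong (n ℕ.+ n) termwise ⟨
        AD (n ℕ.+ n) (λ i l → (poch K * poch K) * (u i * u l * theta α β (i ℤ.⊖ n))) ≈⟨ AD-* (n ℕ.+ n) (poch K * poch K) _ ⟩
        (poch K * poch K) * w (n ℕ.+ n) (λ i → theta α β (i ℤ.⊖ n)) ≈⟨ *-congʳ (*-cong (poch-stable K≤n+n) (poch-stable K≤n)) ⟨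
        (poch (n ℕ.+ n) * poch n) * w (n ℕ.+ n) (λ i → theta α β (i ℤ.⊖ n)) ≈⟨ solve 3 (λ a b c → (a :* b) :* c := (a :* c) :* b) refl _ _ _ ⟩
        (poch (n ℕ.+ n) * w (n ℕ.+ n) (λ i → theta α β (i ℤ.⊖ n))) * poch n ≈⟨ *-congʳ (finite n n) ⟩
        (rng (λ k → 1# + α * N ^ k) n * rng (λ k → 1# + β * N ^ k) n) * poch n
          ≈⟨ trans (rng-* _ _ n) (*-congʳ (rng-* _ _ n)) ⟨
        rng (λ k → (1# + α * N ^ k) * (1# + β * N ^ k) * (1# - N ^ suc k)) n ≈⟨ value′ ⟩
        p ∎)
      where
      open HasProd hp
      n = (K ℕ.+ K) ℕ.+ bound
      value′ = hp-range hp n (ℕ.m≤n+m bound _)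
      K+K≤n : K ℕ.+ K ℕ.≤ n
      K+K≤n = ℕ.m≤m+n _ bound
      K≤n : K ℕ.≤ n
      K≤n = ℕ.≤-trans (ℕ.m≤m+n K K) K+K≤n
      K≤n+n = ℕ.≤-trans K≤n (ℕ.m≤m+n n n)
      ⊖-injective : ∀ i j → i ℤ.⊖ n ≡ j ℤ.⊖ n → i ≡ j
      ⊖-injective i j e = ℤ.+-injective (∙-cancelʳ (ℤ.- + n) (+ i) (+ j)
        (≡.trans (ℤ.m-n≡m⊖n i n) (≡.trans e (≡.sym (ℤ.m-n≡m⊖n j n)))))
        where open import Algebra.Properties.AbelianGroup ℤ.+-0-abelianGroup using (∙-cancelʳ)
      unit-u : ∀ {i} → K ℕ.≤ i → poch K * u i ≈ 1#
      unit-u {i} K≤i = trans (*-congʳ (sym (poch-stable K≤i))) (proj₂ (poch-unit i))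
      indices = map (ℤ._⊖ n) (upTo (suc (n ℕ.+ n)))
      outside′ : ∀ j → j ∉ indices → theta α β j ≈ 0#
      outside′ j j∉ with ℤ.∣ j ∣ ℕ.≤? n
      ... | no j≰n = theta-0 j (ℕ.≤-<-trans K≤n (ℕ.≰⇒> j≰n))
      outside′ (+ k) j∉ | yes k≤n = ⊥-elim (j∉ (≡.subst (_∈ indices) n+k⊖n≡k
        (∈-map⁺ (ℤ._⊖ n) (∈-upTo⁺ (ℕ.s≤s (ℕ.+-monoʳ-≤ n k≤n))))))
        where
        n+k⊖n≡k : (n ℕ.+ k) ℤ.⊖ n ≡ + k
        n+k⊖n≡k = ≡.trans (ℤ.⊖-≥ (ℕ.m≤m+n n k)) (≡.cong +_ (ℕ.m+n∸m≡n n k))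
      outside′ -[1+ k ] j∉ | yes k≤n = ⊥-elim (j∉ (≡.subst (_∈ indices) n∸k⊖n≡-k
        (∈-map⁺ (ℤ._⊖ n) (∈-upTo⁺ (ℕ.s≤s (ℕ.≤-trans (ℕ.m∸n≤m n (suc k)) (ℕ.m≤m+n n n)))))))
        where
        n∸k⊖n≡-k : (n ℕ.∸ suc k) ℤ.⊖ n ≡ -[1+ k ]
        n∸k⊖n≡-k = ≡.trans (ℤ.⊖-≤ (ℕ.m∸n≤m n (suc k))) (≡.cong (λ a → ℤ.- + a) (ℕ.m∸[m∸n]≡n k≤n))
      termwise : ∀ i l → i ℕ.+ l ≡ n ℕ.+ n →
        (poch K * poch K) * (u i * u l * theta α β (i ℤ.⊖ n)) ≈ theta α β (i ℤ.⊖ n)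
      termwise i l e with K ℕ.≤? i | K ℕ.≤? l
      ... | yes K≤i | yes K≤l = trans
        (solve 4 (λ p a b t → (p :* p) :* (a :* b :* t) := (p :* a) :* (p :* b) :* t) refl (poch K) (u i) (u l) _)
        (trans (*-congʳ (trans (*-cong (unit-u K≤i) (unit-u K≤l)) (*-identityˡ 1#))) (*-identityˡ _))
      ... | no K≰i | _ = trans (*-congˡ (*-congˡ θ≈0)) (trans (*-congˡ (zeroʳ _)) (trans (zeroʳ _) (sym θ≈0)))
        where
        i<K = ℕ.≰⇒> K≰i
        θ≈0 = theta-0 (i ℤ.⊖ n) (≡.subst (K ℕ.<_)
          (≡.sym (ℤ.∣⊖∣-≤ (ℕ.≤-trans (ℕ.<⇒≤ i<K) K≤n)))
          (ℕ.m+n≤o⇒m≤o∸n (suc K) (ℕ.≤-trans (ℕ.+-monoʳ-< K i<K) K+K≤n)))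
      ... | yes K≤i | no K≰l = trans (*-congˡ (*-congˡ θ≈0)) (trans (*-congˡ (zeroʳ _)) (trans (zeroʳ _) (sym θ≈0)))
        where
        l<K = ℕ.≰⇒> K≰l
        K+n<i : K ℕ.+ n ℕ.< i
        K+n<i = ℕ.+-cancelʳ-< l _ _ (≡.subst₂ ℕ._<_
          (ℕ.+-comm n (K ℕ.+ l) ⟨≡⟩ (≡.trans (ℕ.+-assoc K l n) (≡.trans (≡.cong (K ℕ.+_) (ℕ.+-comm l n)) (≡.sym (ℕ.+-assoc K n l)))))
          (≡.sym e) (ℕ.+-monoʳ-< n (ℕ.<-≤-trans (ℕ.+-monoʳ-< K l<K) K+K≤n)))
          where _⟨≡⟩_ = ≡.trans
        θ≈0 = theta-0 (i ℤ.⊖ n) (≡.subst (K ℕ.<_)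
          (≡.sym (≡.trans (ℤ.∣m⊖n∣≡∣n⊖m∣ i n) (ℤ.∣⊖∣-≤ (ℕ.≤-trans (ℕ.m≤n+m n K) (ℕ.<⇒≤ K+n<i)))))
          (ℕ.m+n≤o⇒m≤o∸n (suc K) K+n<i))

-- Division with remainder, and exponents of theta series.

residue-unique : ∀ p .{{_ : ℕ.NonZero p}} {r r′} k k′ → r ℕ.< p → r′ ℕ.< p →
  + r ℤ.+ + p ℤ.* k ≡ + r′ ℤ.+ + p ℤ.* k′ → r ≡ r′ × k ≡ k′
residue-unique p {r} {r′} k k′ r<p r′<p e = r≡r′ , k≡k′
  where
  diff : + p ℤ.* (k ℤ.- k′) ≡ + r′ ℤ.- + r
  diff = ≡.trans (lem₁ (+ p) k k′ (+ r)) (≡.trans (≡.cong (λ z → z ℤ.- (+ r ℤ.+ + p ℤ.* k′)) e) (lem₂ (+ p) k′ (+ r) (+ r′)))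
    where
    lem₁ : ∀ p k k′ r → p ℤ.* (k ℤ.- k′) ≡ (r ℤ.+ p ℤ.* k) ℤ.- (r ℤ.+ p ℤ.* k′)
    lem₁ = ℤ-Solver.solve-∀
    lem₂ : ∀ p k′ r r′ → (r′ ℤ.+ p ℤ.* k′) ℤ.- (r ℤ.+ p ℤ.* k′) ≡ r′ ℤ.- r
    lem₂ = ℤ-Solver.solve-∀
  bound : ∀ {a b} → a ℕ.< p → b ℕ.< p → ℤ.∣ + a ℤ.- + b ∣ ℕ.< p
  bound {a} {b} a<p b<p rewrite ℤ.m-n≡m⊖n a b = ℕ.≤-<-trans (ℤ.∣m⊝n∣≤m⊔n a b) (ℕ.⊔-lub a<p b<p)
  ∣k-k′∣≡0 : ℤ.∣ k ℤ.- k′ ∣ ≡ 0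
  ∣k-k′∣≡0 with ℤ.∣ k ℤ.- k′ ∣ in eq
  ... | zero = ≡.refl
  ... | suc m = ⊥-elim (ℕ.<⇒≱ (bound r′<p r<p) (≡.subst (p ℕ.≤_)
        (≡.trans (≡.cong (p ℕ.*_) (≡.sym eq)) (≡.trans (≡.sym (ℤ.abs-* (+ p) (k ℤ.- k′))) (≡.cong ℤ.∣_∣ diff)))
        (ℕ.m≤m*n p (suc m))))
  k≡k′ : k ≡ k′
  k≡k′ = ℤ.i-j≡0⇒i≡j k k′ (ℤ.∣i∣≡0⇒i≡0 ∣k-k′∣≡0)
  r≡r′ : r ≡ r′
  r≡r′ = ℤ.+-injective (≡.sym (ℤ.i-j≡0⇒i≡j (+ r′) (+ r) (≡.trans (≡.sym diff)
    (≡.trans (≡.cong (+ p ℤ.*_) (ℤ.∣i∣≡0⇒i≡0 ∣k-k′∣≡0)) (ℤ.*-zeroʳ (+ p))))))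

-- The exponent in the general term of f(x^a, x^b).
e : ℕ → ℕ → ℤ → ℕ
e a b (+ k) = (a ℕ.+ b) ℕ.* tri k ℕ.+ a ℕ.* k
e a b -[1+ k ] = (a ℕ.+ b) ℕ.* tri (suc k) ℕ.+ b ℕ.* suc k

2*tri : ∀ k → + 2 ℤ.* + tri k ≡ + k ℤ.* (+ k ℤ.- + 1)
2*tri zero = ≡.refl
2*tri (suc k) = begin
  + 2 ℤ.* + (k ℕ.+ tri k) ≡⟨ ≡.cong (+ 2 ℤ.*_) (ℤ.pos-+ k (tri k)) ⟩
  + 2 ℤ.* (+ k ℤ.+ + tri k) ≡⟨ ℤ.*-distribˡ-+ (+ 2) (+ k) (+ tri k) ⟩
  + 2 ℤ.* + k ℤ.+ + 2 ℤ.* + tri k ≡⟨ ≡.cong (λ z → + 2 ℤ.* + k ℤ.+ z) (2*tri k) ⟩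
  + 2 ℤ.* + k ℤ.+ + k ℤ.* (+ k ℤ.- + 1) ≡⟨ lem (+ k) ⟩
  (+ 1 ℤ.+ + k) ℤ.* ((+ 1 ℤ.+ + k) ℤ.- + 1) ≡⟨⟩
  + suc k ℤ.* (+ suc k ℤ.- + 1) ∎
  where
  open ≡.≡-Reasoning
  lem : ∀ k → + 2 ℤ.* k ℤ.+ k ℤ.* (k ℤ.- + 1) ≡ (+ 1 ℤ.+ k) ℤ.* ((+ 1 ℤ.+ k) ℤ.- + 1)
  lem = ℤ-Solver.solve-∀

-- Doubling turns a natural number defined by cases on the sign of n into a polynomial over ℤ.
-- Equalities of exponents are therefore proved by the ring solver and brought back by `halve-≡`.
2*e : ∀ a b n → + 2 ℤ.* + e a b n ≡ + a ℤ.* (n ℤ.* (n ℤ.+ + 1)) ℤ.+ + b ℤ.* (n ℤ.* (n ℤ.- + 1))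
2*e a b n = half n
  where
  open ≡.≡-Reasoning
  pos : ∀ k c → + 2 ℤ.* + ((a ℕ.+ b) ℕ.* tri k ℕ.+ c ℕ.* k) ≡
    (+ a ℤ.+ + b) ℤ.* (+ k ℤ.* (+ k ℤ.- + 1)) ℤ.+ + 2 ℤ.* (+ c ℤ.* + k)
  pos k c = begin
    + 2 ℤ.* + ((a ℕ.+ b) ℕ.* tri k ℕ.+ c ℕ.* k)
      ≡⟨ ≡.cong (+ 2 ℤ.*_) (≡.trans (ℤ.pos-+ ((a ℕ.+ b) ℕ.* tri k) (c ℕ.* k)) (≡.cong₂ ℤ._+_ (≡.trans (ℤ.pos-* (a ℕ.+ b) (tri k)) (≡.cong (ℤ._* + tri k) (ℤ.pos-+ a b))) (ℤ.pos-* c k))) ⟩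
    + 2 ℤ.* ((+ a ℤ.+ + b) ℤ.* + tri k ℤ.+ + c ℤ.* + k) ≡⟨ lem (+ a ℤ.+ + b) (+ tri k) (+ c ℤ.* + k) ⟩
    (+ a ℤ.+ + b) ℤ.* (+ 2 ℤ.* + tri k) ℤ.+ + 2 ℤ.* (+ c ℤ.* + k)
      ≡⟨ ≡.cong (λ z → (+ a ℤ.+ + b) ℤ.* z ℤ.+ + 2 ℤ.* (+ c ℤ.* + k)) (2*tri k) ⟩
    (+ a ℤ.+ + b) ℤ.* (+ k ℤ.* (+ k ℤ.- + 1)) ℤ.+ + 2 ℤ.* (+ c ℤ.* + k) ∎
    where
    lem : ∀ s t c → + 2 ℤ.* (s ℤ.* t ℤ.+ c) ≡ s ℤ.* (+ 2 ℤ.* t) ℤ.+ + 2 ℤ.* c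
    lem = ℤ-Solver.solve-∀
  half : ∀ n → + 2 ℤ.* + e a b n ≡ + a ℤ.* (n ℤ.* (n ℤ.+ + 1)) ℤ.+ + b ℤ.* (n ℤ.* (n ℤ.- + 1))
  half (+ k) = ≡.trans (pos k a) (lem (+ a) (+ b) (+ k))
    where
    lem : ∀ a b k → (a ℤ.+ b) ℤ.* (k ℤ.* (k ℤ.- + 1)) ℤ.+ + 2 ℤ.* (a ℤ.* k) ≡
      a ℤ.* (k ℤ.* (k ℤ.+ + 1)) ℤ.+ b ℤ.* (k ℤ.* (k ℤ.- + 1))
    lem = ℤ-Solver.solve-∀
  half -[1+ k ] = ≡.trans (pos (suc k) b) (lem (+ a) (+ b) (+ suc k))
    where
    lem : ∀ a b k → (a ℤ.+ b) ℤ.* (k ℤ.* (k ℤ.- + 1)) ℤ.+ + 2 ℤ.* (b ℤ.* k) ≡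
      a ℤ.* ((ℤ.- k) ℤ.* ((ℤ.- k) ℤ.+ + 1)) ℤ.+ b ℤ.* ((ℤ.- k) ℤ.* ((ℤ.- k) ℤ.- + 1))
    lem = ℤ-Solver.solve-∀

halve-≡ : ∀ {i j A B} → + 2 ℤ.* + i ≡ A → + 2 ℤ.* + j ≡ B → A ≡ B → i ≡ j
halve-≡ {i} {j} p q r = ℤ.+-injective (ℤ.*-cancelˡ-≡ (+ 2) (+ i) (+ j) (≡.trans p (≡.trans r (≡.sym q))))

2*-+ : ∀ {i j A B} → + 2 ℤ.* + i ≡ A → + 2 ℤ.* + j ≡ B → + 2 ℤ.* + (i ℕ.+ j) ≡ A ℤ.+ B
2*-+ {i} {j} p q = ≡.trans (≡.cong (+ 2 ℤ.*_) (ℤ.pos-+ i j)) (≡.trans (ℤ.*-distribˡ-+ (+ 2) (+ i) (+ j)) (≡.cong₂ ℤ._+_ p q))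

2*-* : ∀ c {i A} → + 2 ℤ.* + i ≡ A → + 2 ℤ.* + (c ℕ.* i) ≡ + c ℤ.* A
2*-* c {i} p = ≡.trans (≡.cong (+ 2 ℤ.*_) (ℤ.pos-* c i)) (≡.trans (swap (+ c) (+ i)) (≡.cong (+ c ℤ.*_) p))
  where
  swap : ∀ c i → + 2 ℤ.* (c ℤ.* i) ≡ c ℤ.* (+ 2 ℤ.* i)
  swap = ℤ-Solver.solve-∀

-- Coset decompositions of ℤ² and theta series in powers of one variable.

module ThetaIdentities (R : CommutativeRing 0ℓ 0ℓ) (ι : ℤ⟶ R) where
  open NilpotentRing R ι

  _≟²_ : DecidableEquality (ℤ × ℤ)
  _≟²_ = ×.≡-dec ℤ._≟_ ℤ._≟_

  -- The class of (a, b) is the residue of a - c·b modulo p. For p = 5 and c = 2 the zero class is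
  -- the ideal generated by 2 + i in the Gaussian integers; for p = 2 and c = 1 the classes separate
  -- a ≡ b from a ≢ b.
  hs-cosets : ∀ p .{{_ : ℕ.NonZero p}} (c : ℤ) {F : ℤ × ℤ → Carrier} (s : Fin p → Carrier) →
    (∀ r → HasSum (λ (k , b) → F (+ toℕ r ℤ.+ + p ℤ.* k ℤ.+ c ℤ.* b , b)) (s r)) → HasSum F (Σl s (allFin p))
  hs-cosets p c {F} s h = hs-reindex to from to-from from-to
    (hs-Σ Fin._≟_ (F ∘ to) s (allFin p) (Unique.allFin⁺ p) (λ r r∉ → ⊥-elim (r∉ (∈-allFin r))) h)
    where
    to : Fin p × (ℤ × ℤ) → ℤ × ℤ
    to (r , (k , b)) = + toℕ r ℤ.+ + p ℤ.* k ℤ.+ c ℤ.* b , b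
    from : ℤ × ℤ → Fin p × (ℤ × ℤ)
    from (a , b) = fromℕ< (ℤ.n%ℕd<d (a ℤ.- c ℤ.* b) p) , ((a ℤ.- c ℤ.* b) ℤ./ℕ p , b)
    to-from : ∀ j → to (from j) ≡ j
    to-from (a , b) = ≡.cong (_, b) (≡.trans (≡.cong (ℤ._+ c ℤ.* b) (≡.trans
      (≡.cong₂ ℤ._+_ (≡.cong +_ (Fin.toℕ-fromℕ< (ℤ.n%ℕd<d (a ℤ.- c ℤ.* b) p))) (ℤ.*-comm (+ p) _))
      (≡.sym (ℤ.a≡a%ℕn+[a/ℕn]*n (a ℤ.- c ℤ.* b) p)))) (cancel a (c ℤ.* b)))
      where
      cancel : ∀ a z → a ℤ.- z ℤ.+ z ≡ a
      cancel = ℤ-Solver.solve-∀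
    from-to : ∀ i → from (to i) ≡ i
    from-to (r , (k , b)) = ≡.cong₂ (λ r k → r , (k , b))
      (Fin.toℕ-injective (≡.trans (Fin.toℕ-fromℕ< (ℤ.n%ℕd<d z p)) (proj₁ same))) (proj₂ same)
      where
      z = (+ toℕ r ℤ.+ + p ℤ.* k ℤ.+ c ℤ.* b) ℤ.- c ℤ.* b
      cancel : ∀ a z → a ℤ.+ z ℤ.- z ≡ a
      cancel = ℤ-Solver.solve-∀
      same = residue-unique p (z ℤ./ℕ p) k (ℤ.n%ℕd<d z p) (Fin.toℕ<n r)
        (≡.trans (≡.cong (λ y → + (z ℤ.%ℕ p) ℤ.+ y) (ℤ.*-comm (+ p) (z ℤ./ℕ p)))
          (≡.trans (≡.sym (ℤ.a≡a%ℕn+[a/ℕn]*n z p)) (cancel (+ toℕ r ℤ.+ + p ℤ.* k) (c ℤ.* b))))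

  theta-^ : ∀ x a b n → theta (x ^ a) (x ^ b) n ≈ x ^ e a b n
  theta-^ x a b n = half n
    where
    tri⁺-^ : ∀ k c → tri⁺ (x ^ a * x ^ b) (x ^ c) k ≈ x ^ ((a ℕ.+ b) ℕ.* tri k ℕ.+ c ℕ.* k)
    tri⁺-^ k c = trans (*-cong (trans (^-congˡ (tri k) (sym (^-homo-* x a b))) (^-assocʳ x (a ℕ.+ b) (tri k))) (^-assocʳ x c k))
      (sym (^-homo-* x ((a ℕ.+ b) ℕ.* tri k) (c ℕ.* k)))
    half : ∀ n → theta (x ^ a) (x ^ b) n ≈ x ^ e a b n
    half (+ k) = tri⁺-^ k a
    half -[1+ k ] = tri⁺-^ (suc k) b

  ^^-block : ∀ x m k → (x ^ m) ^ k ≈ x ^ (k ℕ.* m)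
  ^^-block x m k = trans (^-assocʳ x m k) (^-congʳ x (ℕ.*-comm m k))

  theta-product : ∀ x a b → Nil (x ^ (a ℕ.+ b)) → ∀ {p} →
    HasProd (λ k → (1# + x ^ (a ℕ.+ k ℕ.* (a ℕ.+ b))) * (1# + x ^ (b ℕ.+ k ℕ.* (a ℕ.+ b))) * (1# - x ^ (suc k ℕ.* (a ℕ.+ b)))) p →
    HasSum (λ n → x ^ e a b n) p
  theta-product x a b nil hp = hs-cong (theta-^ x a b) refl
    (JacobiTripleProduct.tripleProduct (x ^ a) (x ^ b) (nil-cong (^-homo-* x a b) nil)
      (hp-cong (λ k → *-cong (*-cong (+-congˡ (lem a k)) (+-congˡ (lem b k))) (+-congˡ (-‿cong (sym (N^ (suc k)))))) refl hp))
    where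
    N^ : ∀ k → (x ^ a * x ^ b) ^ k ≈ x ^ (k ℕ.* (a ℕ.+ b))
    N^ k = trans (^-congˡ k (sym (^-homo-* x a b))) (^^-block x (a ℕ.+ b) k)
    lem : ∀ c k → x ^ (c ℕ.+ k ℕ.* (a ℕ.+ b)) ≈ x ^ c * (x ^ a * x ^ b) ^ k
    lem c k = trans (^-homo-* x c _) (*-congˡ (sym (N^ k)))

-- Theta functions as quotients of Euler products.

module EulerProducts (R : CommutativeRing 0ℓ 0ℓ) (ι : ℤ⟶ R) where
  open NilpotentRing R ι
  open ThetaIdentities R ι

  Euler : Carrier → Carrier → Set
  Euler x = HasProd (λ k → 1# - x ^ suc k)

  1+0 : ∀ {x} → x ≈ 0# → 1# + x ≈ 1#
  1+0 x≈0 = trans (+-congˡ x≈0) (+-identityʳ 1#)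

  module _ {x : Carrier} (nil : Nil x) where
    private K = proj₁ nil

    nil-power-product : (f : Carrier → Carrier) → (∀ {y} → y ≈ 0# → f y ≈ 1#) → (d : ℕ → ℕ) → (∀ k → k ℕ.≤ d k) →
      HasProd (λ k → f (x ^ d k)) (rng (λ k → f (x ^ d k)) K)
    nil-power-product f f0 d k≤d = hasProd K (λ k K≤k → f0 (nil-≤ nil (ℕ.≤-trans K≤k (k≤d k)))) refl

    euler : Σ Carrier (Euler x)
    euler = _ , nil-power-product (λ y → 1# - y) 1-0 suc ℕ.n≤1+n

    Euler-unit : ∀ {p} → Euler x p → Unit p
    Euler-unit = unit-HasProd (λ k → unit-1-nil (nil-suc k nil))

  nil-neg : ∀ {x} → Nil x → Nil (- x)
  nil-neg {x} nil = nil-cong (solve 1 (λ x → (:- con (+ 1)) :* x := :- x) refl x) (nil-* (- 1#) nil)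

  nil-^ : ∀ {x} m .{{_ : ℕ.NonZero m}} → Nil x → Nil (x ^ m)
  nil-^ (suc m) = nil-suc m

  theta-exists : ∀ y a b .{{_ : ℕ.NonZero (a ℕ.+ b)}} → Nil y → Σ Carrier (HasSum (λ n → y ^ e a b n))
  theta-exists y a b nil@(K , _) = _ , theta-product y a b (nil-^ (a ℕ.+ b) nil) (hasProd K beyond refl)
    where
    vanish : ∀ c k → K ℕ.≤ k → y ^ (c ℕ.+ k ℕ.* (a ℕ.+ b)) ≈ 0#
    vanish c k K≤k = nil-≤ nil (ℕ.≤-trans K≤k (ℕ.≤-trans (ℕ.m≤m*n k (a ℕ.+ b)) (ℕ.m≤n+m _ c)))
    beyond : ∀ k → K ℕ.≤ k → (1# + y ^ (a ℕ.+ k ℕ.* (a ℕ.+ b))) * (1# + y ^ (b ℕ.+ k ℕ.* (a ℕ.+ b))) * (1# - y ^ (suc k ℕ.* (a ℕ.+ b))) ≈ 1#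
    beyond k K≤k = trans (*-cong (trans (*-cong (1+0 (vanish a k K≤k)) (1+0 (vanish b k K≤k))) (*-identityˡ 1#)) (1-0 (vanish (a ℕ.+ b) k K≤k))) (*-identityˡ 1#)

  Euler-block : ∀ x m {p} → Euler (x ^ m) p → HasProd (λ k → 1# - x ^ (suc k ℕ.* m)) p
  Euler-block x m = hp-cong (λ k → +-congˡ (-‿cong (^^-block x m (suc k)))) refl

  Euler-cong : ∀ {x y p} → x ≈ y → Euler x p → Euler y p
  Euler-cong x≈y = hp-cong (λ k → +-congˡ (-‿cong (^-congˡ (suc k) x≈y))) refl

  -- From (1 + y)(1 - y) = 1 - y². The quotient e₂/e₁ is delivered as a witness together with its
  -- cross-multiplied equation.
  plus-part : ∀ {x} → Nil x → ∀ {e₁ e₂} → Euler x e₁ → Euler (x ^ 2) e₂ →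
    Σ Carrier λ h → HasProd (λ k → 1# + x ^ suc k) h × h * e₁ ≈ e₂
  plus-part {x} nil E₁ E₂ = _ , plus , hp-unique (hp-* plus E₁) (hp-cong factor refl (Euler-block x 2 E₂))
    where
    plus = nil-power-product nil (λ y → 1# + y) 1+0 suc ℕ.n≤1+n
    factor : ∀ k → 1# - x ^ (suc k ℕ.* 2) ≈ (1# + x ^ suc k) * (1# - x ^ suc k)
    factor k = begin
      1# - x ^ (suc k ℕ.* 2) ≈⟨ +-congˡ (-‿cong (^-assocʳ x (suc k) 2)) ⟨
      1# - (x ^ suc k) ^ 2 ≈⟨ solve 1 (λ y → con (+ 1) :- y :* (y :* con (+ 1)) := (con (+ 1) :+ y) :* (con (+ 1) :- y)) refl (x ^ suc k) ⟩
      (1# + x ^ suc k) * (1# - x ^ suc k) ∎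

  -- The factors of `e₁` are taken in pairs: those with odd exponent form the witness, those with
  -- even exponent are the factors of `e₂`.
  odd-part : ∀ {x} → Nil x → ∀ {e₁ e₂} → Euler x e₁ → Euler (x ^ 2) e₂ →
    Σ Carrier λ o → HasProd (λ k → 1# - x ^ suc (k ℕ.* 2)) o × o * e₂ ≈ e₁
  odd-part {x} nil E₁ E₂ = _ , odd , hp-unique (hp-* odd (Euler-block x 2 E₂)) (hp-cong factor refl (hp-block 2 E₁))
    where
    odd = nil-power-product nil (λ y → 1# - y) 1-0 (λ k → suc (k ℕ.* 2)) (λ k → ℕ.≤-trans (ℕ.m≤m*n k 2) (ℕ.n≤1+n _))
    factor : ∀ k → rng (λ i → 1# - x ^ suc (i ℕ.+ k ℕ.* 2)) 2 ≈ (1# - x ^ suc (k ℕ.* 2)) * (1# - x ^ (suc k ℕ.* 2))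
    factor k = *-congʳ (*-identityˡ _)

  -- Gauss's ψ = E₂²/E₁. Here θ is f(1, x) = 2ψ(x), because n and 1 - n have the same exponent; in
  -- the product the doubling is the factor 1 + x^0.
  theta-tri : ∀ {x} → Nil x → ∀ {e₁ e₂ θ} → Euler x e₁ → Euler (x ^ 2) e₂ →
    HasSum (λ n → x ^ e 0 1 n) θ → θ * e₁ ≈ ⟦ + 2 ⟧ * (e₂ * e₂)
  theta-tri {x} nil {e₁} {e₂} {θ} E₁ E₂ H = begin
    θ * e₁ ≈⟨ *-congʳ (hs-unique ℤ._≟_ H (theta-product x 0 1 (nil-suc 0 nil) family)) ⟩
    ((1# + 1#) * h * h * e₁) * e₁ ≈⟨ solve 2 (λ h e → ((con (+ 1) :+ con (+ 1)) :* h :* h :* e) :* e := con (+ 2) :* ((h :* e) :* (h :* e))) refl h e₁ ⟩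
    ⟦ + 2 ⟧ * ((h * e₁) * (h * e₁)) ≈⟨ *-congˡ (*-cong h*e₁ h*e₁) ⟩
    ⟦ + 2 ⟧ * (e₂ * e₂) ∎
    where
    P = plus-part nil E₁ E₂
    h = proj₁ P
    plus = proj₁ (proj₂ P)
    h*e₁ = proj₂ (proj₂ P)
    k*1 : ∀ k → x ^ k ≈ x ^ (k ℕ.* 1)
    k*1 k = ^-congʳ x (≡.sym (ℕ.*-identityʳ k))
    family : HasProd (λ k → (1# + x ^ (0 ℕ.+ k ℕ.* 1)) * (1# + x ^ (1 ℕ.+ k ℕ.* 1)) * (1# - x ^ (suc k ℕ.* 1))) ((1# + 1#) * h * h * e₁)
    family = hp-cong (λ k → *-cong (*-cong (+-congˡ (k*1 k)) (+-congˡ (k*1 (suc k)))) (+-congˡ (-‿cong (k*1 (suc k))))) refl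
      (hp-* (hp-* (hp-suc {λ k → 1# + x ^ k} plus) plus) E₁)

  neg-even : ∀ x m → (- x) ^ (m ℕ.* 2) ≈ x ^ (m ℕ.* 2)
  neg-even x m = begin
    (- x) ^ (m ℕ.* 2) ≈⟨ ^^-block (- x) 2 m ⟨
    ((- x) ^ 2) ^ m ≈⟨ ^-congˡ m (solve 1 (λ x → (:- x) :* ((:- x) :* con (+ 1)) := x :* (x :* con (+ 1))) refl x) ⟩
    (x ^ 2) ^ m ≈⟨ ^^-block x 2 m ⟩
    x ^ (m ℕ.* 2) ∎

  neg-odd : ∀ x m → (- x) ^ suc (m ℕ.* 2) ≈ - x ^ suc (m ℕ.* 2)
  neg-odd x m = trans (*-congˡ (neg-even x m)) (sym (-‿distribˡ-* x _))

  -- Gauss's φ(-x) = E₁²/E₂: in the product for f(-x, -x) each factor with odd exponent occurs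
  -- twice, and these factors multiply to E₁/E₂.
  theta-square : ∀ {x} → Nil x → ∀ {e₁ e₂ φ} → Euler x e₁ → Euler (x ^ 2) e₂ →
    HasSum (λ n → (- x) ^ e 1 1 n) φ → φ * e₂ ≈ e₁ * e₁
  theta-square {x} nil {e₁} {e₂} {φ} E₁ E₂ H = begin
    φ * e₂ ≈⟨ *-congʳ (hs-unique ℤ._≟_ H (theta-product (- x) 1 1 (nil-cong (sym (neg-even x 1)) (nil-suc 1 nil)) family)) ⟩
    (o * o * e₂) * e₂ ≈⟨ solve 2 (λ o e → (o :* o :* e) :* e := (o :* e) :* (o :* e)) refl o e₂ ⟩
    (o * e₂) * (o * e₂) ≈⟨ *-cong o*e₂ o*e₂ ⟩
    e₁ * e₁ ∎
    where
    P = odd-part nil E₁ E₂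
    o = proj₁ P
    odd = proj₁ (proj₂ P)
    o*e₂ = proj₂ (proj₂ P)
    family : HasProd (λ k → (1# + (- x) ^ suc (k ℕ.* 2)) * (1# + (- x) ^ suc (k ℕ.* 2)) * (1# - (- x) ^ (suc k ℕ.* 2))) (o * o * e₂)
    family = hp-cong (λ k → *-cong (*-cong (+-congˡ (sym (neg-odd x k))) (+-congˡ (sym (neg-odd x k)))) (+-congˡ (-‿cong (sym (neg-even x (suc k))))))
      refl (hp-* (hp-* odd odd) (Euler-block x 2 E₂))

  -- The two triple products share out the factors 1 + x^k with 5 ∤ k. Their product is therefore
  -- `h` over `g`, the product over all k over the one over multiples of 5, times E₅².
  theta-41-32 : ∀ {x} → Nil x → ∀ {e₁ e₂ e₅ e₁₀ u₁ u₂} → Euler x e₁ → Euler (x ^ 2) e₂ → Euler (x ^ 5) e₅ → Euler ((x ^ 5) ^ 2) e₁₀ →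
    HasSum (λ n → x ^ e 4 1 n) u₁ → HasSum (λ n → x ^ e 3 2 n) u₂ → u₁ * u₂ * (e₁ * e₁₀) ≈ e₂ * (e₅ * e₅ * e₅)
  theta-41-32 {x} nil {e₁} {e₂} {e₅} {e₁₀} {u₁} {u₂} E₁ E₂ E₅ E₁₀ H₁ H₂ = begin
    u₁ * u₂ * (e₁ * e₁₀) ≈⟨ *-cong (*-cong (hs-unique ℤ._≟_ H₁ (theta-product x 4 1 (nil-suc 4 nil) f₁)) (hs-unique ℤ._≟_ H₂ (theta-product x 3 2 (nil-suc 4 nil) f₂))) (*-congˡ (sym g*e₅)) ⟩
    (p₄ * p₁ * e₅) * (p₃ * p₂ * e₅) * (e₁ * (g * e₅))
      ≈⟨ solve 7 (λ p₁ p₂ p₃ p₄ g e₁ e₅ → (p₄ :* p₁ :* e₅) :* (p₃ :* p₂ :* e₅) :* (e₁ :* (g :* e₅)) :=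
           (((((con (+ 1) :* p₁) :* p₂) :* p₃) :* p₄) :* g) :* e₁ :* (e₅ :* e₅ :* e₅)) refl p₁ p₂ p₃ p₄ g e₁ e₅ ⟩
    (((((1# * p₁) * p₂) * p₃) * p₄) * g) * e₁ * (e₅ * e₅ * e₅) ≈⟨ *-congʳ (*-congʳ whole) ⟩
    h * e₁ * (e₅ * e₅ * e₅) ≈⟨ *-congʳ h*e₁ ⟩
    e₂ * (e₅ * e₅ * e₅) ∎
    where
    P = plus-part nil E₁ E₂
    h = proj₁ P
    plus = proj₁ (proj₂ P)
    h*e₁ = proj₂ (proj₂ P)
    G = plus-part (nil-suc 4 nil) E₅ E₁₀
    g = proj₁ G
    g*e₅ = proj₂ (proj₂ G)
    plus₅ : HasProd (λ k → 1# + x ^ (suc k ℕ.* 5)) g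
    plus₅ = hp-cong (λ k → +-congˡ (^^-block x 5 (suc k))) refl (proj₁ (proj₂ G))
    part : ∀ i → HasProd (λ k → 1# + x ^ (suc i ℕ.+ k ℕ.* 5)) _
    part i = nil-power-product nil (λ y → 1# + y) 1+0 (λ k → suc i ℕ.+ k ℕ.* 5) (λ k → ℕ.≤-trans (ℕ.m≤m*n k 5) (ℕ.m≤n+m _ (suc i)))
    p₁ = _
    p₂ = _
    p₃ = _
    p₄ = _
    P₁ : HasProd (λ k → 1# + x ^ (1 ℕ.+ k ℕ.* 5)) p₁
    P₁ = part 0
    P₂ : HasProd (λ k → 1# + x ^ (2 ℕ.+ k ℕ.* 5)) p₂
    P₂ = part 1
    P₃ : HasProd (λ k → 1# + x ^ (3 ℕ.+ k ℕ.* 5)) p₃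
    P₃ = part 2
    P₄ : HasProd (λ k → 1# + x ^ (4 ℕ.+ k ℕ.* 5)) p₄
    P₄ = part 3
    f₁ = hp-* (hp-* P₄ P₁) (Euler-block x 5 E₅)
    f₂ = hp-* (hp-* P₃ P₂) (Euler-block x 5 E₅)
    one : HasProd (λ _ → 1#) 1#
    one = hasProd 0 (λ _ _ → refl) refl
    whole : ((((1# * p₁) * p₂) * p₃) * p₄) * g ≈ h
    whole = hp-unique (hp-* (hp-* (hp-* (hp-* (hp-* one P₁) P₂) P₃) P₄) plus₅) (hp-block 5 plus)

  -- The same for the factors 1 - x^k with k odd and 5 ∤ k: `o` collects all odd k and `o₅` the odd
  -- multiples of 5. The minus signs arise from odd powers of -x.
  theta-91-73 : ∀ {x} → Nil x → ∀ {e₁ e₂ e₅ e₁₀ v₁ v₂} → Euler x e₁ → Euler (x ^ 2) e₂ → Euler (x ^ 5) e₅ → Euler ((x ^ 5) ^ 2) e₁₀ →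
    HasSum (λ n → (- x) ^ e 9 1 n) v₁ → HasSum (λ n → (- x) ^ e 7 3 n) v₂ → v₁ * v₂ * (e₂ * e₅) ≈ e₁ * (e₁₀ * e₁₀ * e₁₀)
  theta-91-73 {x} nil {e₁} {e₂} {e₅} {e₁₀} {v₁} {v₂} E₁ E₂ E₅ E₁₀ H₁ H₂ = begin
    v₁ * v₂ * (e₂ * e₅) ≈⟨ *-cong (*-cong (hs-unique ℤ._≟_ H₁ (theta-product (- x) 9 1 nil₁₀ f₁)) (hs-unique ℤ._≟_ H₂ (theta-product (- x) 7 3 nil₁₀ f₂))) (*-congˡ (sym o₅*e₁₀)) ⟩
    (p₉ * p₁ * e₁₀) * (p₇ * p₃ * e₁₀) * (e₂ * (o₅ * e₁₀))
      ≈⟨ solve 7 (λ p₁ p₃ p₇ p₉ o₅ e₂ e₁₀ → (p₉ :* p₁ :* e₁₀) :* (p₇ :* p₃ :* e₁₀) :* (e₂ :* (o₅ :* e₁₀)) :=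
           (((((con (+ 1) :* p₁) :* p₃) :* o₅) :* p₇) :* p₉) :* e₂ :* (e₁₀ :* e₁₀ :* e₁₀)) refl p₁ p₃ p₇ p₉ o₅ e₂ e₁₀ ⟩
    (((((1# * p₁) * p₃) * o₅) * p₇) * p₉) * e₂ * (e₁₀ * e₁₀ * e₁₀) ≈⟨ *-congʳ (*-congʳ whole) ⟩
    o * e₂ * (e₁₀ * e₁₀ * e₁₀) ≈⟨ *-congʳ o*e₂ ⟩
    e₁ * (e₁₀ * e₁₀ * e₁₀) ∎
    where
    nil₁₀ = nil-cong (sym (neg-even x 5)) (nil-suc 9 nil)
    O = odd-part nil E₁ E₂
    o = proj₁ O
    odd = proj₁ (proj₂ O)
    o*e₂ = proj₂ (proj₂ O)
    O₅ = odd-part (nil-suc 4 nil) E₅ E₁₀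
    o₅ = proj₁ O₅
    o₅*e₁₀ = proj₂ (proj₂ O₅)
    index : ∀ i k → suc (i ℕ.* 2) ℕ.+ k ℕ.* 10 ≡ suc ((i ℕ.+ k ℕ.* 5) ℕ.* 2)
    index = ℕ-Solver.solve-∀
    part : ∀ i → HasProd (λ k → 1# - x ^ suc ((i ℕ.+ k ℕ.* 5) ℕ.* 2)) _
    part i = nil-power-product nil (λ y → 1# - y) 1-0 (λ k → suc ((i ℕ.+ k ℕ.* 5) ℕ.* 2))
      (λ k → ℕ.≤-trans (ℕ.m≤m*n k 5) (ℕ.≤-trans (ℕ.m≤n+m _ i) (ℕ.≤-trans (ℕ.m≤m*n _ 2) (ℕ.n≤1+n _))))
    signed : ∀ i {p} → HasProd (λ k → 1# - x ^ suc ((i ℕ.+ k ℕ.* 5) ℕ.* 2)) p → HasProd (λ k → 1# + (- x) ^ (suc (i ℕ.* 2) ℕ.+ k ℕ.* 10)) p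
    signed i = hp-cong (λ k → +-congˡ (trans (sym (neg-odd x (i ℕ.+ k ℕ.* 5))) (^-congʳ (- x) (≡.sym (index i k))))) refl
    p₁ = _
    p₃ = _
    p₇ = _
    p₉ = _
    P₁ : HasProd (λ k → 1# - x ^ suc ((0 ℕ.+ k ℕ.* 5) ℕ.* 2)) p₁
    P₁ = part 0
    P₃ : HasProd (λ k → 1# - x ^ suc ((1 ℕ.+ k ℕ.* 5) ℕ.* 2)) p₃
    P₃ = part 1
    P₅ : HasProd (λ k → 1# - x ^ suc ((2 ℕ.+ k ℕ.* 5) ℕ.* 2)) o₅
    P₅ = hp-cong (λ k → +-congˡ (-‿cong (trans (^-assocʳ x 5 (suc (k ℕ.* 2))) (^-congʳ x (index₅ k))))) refl (proj₁ (proj₂ O₅))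
      where
      index₅ : ∀ k → 5 ℕ.* suc (k ℕ.* 2) ≡ suc ((2 ℕ.+ k ℕ.* 5) ℕ.* 2)
      index₅ = ℕ-Solver.solve-∀
    P₇ : HasProd (λ k → 1# - x ^ suc ((3 ℕ.+ k ℕ.* 5) ℕ.* 2)) p₇
    P₇ = part 3
    P₉ : HasProd (λ k → 1# - x ^ suc ((4 ℕ.+ k ℕ.* 5) ℕ.* 2)) p₉
    P₉ = part 4
    E₁₀′ : HasProd (λ k → 1# - (- x) ^ (suc k ℕ.* 10)) e₁₀
    E₁₀′ = hp-cong (λ k → +-congˡ (-‿cong (begin
      ((x ^ 5) ^ 2) ^ suc k ≈⟨ ^-congˡ (suc k) (^-assocʳ x 5 2) ⟩
      (x ^ 10) ^ suc k ≈⟨ ^-congˡ (suc k) (neg-even x 5) ⟨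
      ((- x) ^ 10) ^ suc k ≈⟨ ^^-block (- x) 10 (suc k) ⟩
      (- x) ^ (suc k ℕ.* 10) ∎))) refl E₁₀
    f₁ = hp-* (hp-* (signed 4 P₉) (signed 0 P₁)) E₁₀′
    f₂ = hp-* (hp-* (signed 3 P₇) (signed 1 P₃)) E₁₀′
    one : HasProd (λ _ → 1#) 1#
    one = hasProd 0 (λ _ _ → refl) refl
    whole : ((((1# * p₁) * p₃) * o₅) * p₇) * p₉ ≈ o
    whole = hp-unique (hp-* (hp-* (hp-* (hp-* (hp-* one P₁) P₃) P₅) P₇) P₉) (hp-block 5 odd)

-- Splitting sums of two squares and of two triangular numbers along 2 + i.

module ℤS = Data.Integer.Solver.+-*-Solver

module LatticeIdentities (R : CommutativeRing 0ℓ 0ℓ) (ι : ℤ⟶ R) where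
  open NilpotentRing R ι
  open ThetaIdentities R ι

  -- Once a coset is parametrised by (k, b), the remaining changes of variables are affine and
  -- triangular with diagonal entries ±1. Such entries are their own inverses, so the inverse map is
  -- explicit.
  hs-shear : ∀ (σ τ ρ μ ν : ℤ) → σ ℤ.* σ ≡ + 1 → ρ ℤ.* ρ ≡ + 1 → {F : ℤ × ℤ → Carrier} {s : Carrier} →
    HasSum (λ (p , q) → F (σ ℤ.* p ℤ.+ τ , ρ ℤ.* q ℤ.+ μ ℤ.* p ℤ.+ ν)) s → HasSum F s
  hs-shear σ τ ρ μ ν σσ ρρ = hs-reindex
    (λ (p , q) → σ ℤ.* p ℤ.+ τ , ρ ℤ.* q ℤ.+ μ ℤ.* p ℤ.+ ν)
    (λ (k , b) → σ ℤ.* (k ℤ.- τ) , ρ ℤ.* (b ℤ.- μ ℤ.* (σ ℤ.* (k ℤ.- τ)) ℤ.- ν))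
    (λ (k , b) → ≡.cong₂ _,_
      (≡.trans (l₁ σ k τ) (≡.trans (≡.cong (λ z → z ℤ.* (k ℤ.- τ) ℤ.+ τ) σσ) (l₂ k τ)))
      (≡.trans (l₃ ρ b (μ ℤ.* (σ ℤ.* (k ℤ.- τ))) ν) (≡.trans (≡.cong (λ z → z ℤ.* (b ℤ.- μ ℤ.* (σ ℤ.* (k ℤ.- τ)) ℤ.- ν) ℤ.+ μ ℤ.* (σ ℤ.* (k ℤ.- τ)) ℤ.+ ν) ρρ) (l₄ b (μ ℤ.* (σ ℤ.* (k ℤ.- τ))) ν))))
    (λ (p , q) → let back = ≡.trans (l₅ σ p τ) (≡.trans (≡.cong (ℤ._* p) σσ) (ℤ.*-identityˡ p)) in ≡.cong₂ _,_
      back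
      (≡.trans (≡.cong (λ z → ρ ℤ.* (ρ ℤ.* q ℤ.+ μ ℤ.* p ℤ.+ ν ℤ.- μ ℤ.* z ℤ.- ν)) back)
        (≡.trans (l₆ ρ q (μ ℤ.* p) ν) (≡.trans (≡.cong (ℤ._* q) ρρ) (ℤ.*-identityˡ q)))))
    where
    l₁ : ∀ σ k τ → σ ℤ.* (σ ℤ.* (k ℤ.- τ)) ℤ.+ τ ≡ σ ℤ.* σ ℤ.* (k ℤ.- τ) ℤ.+ τ
    l₁ = ℤ-Solver.solve-∀
    l₂ : ∀ k τ → + 1 ℤ.* (k ℤ.- τ) ℤ.+ τ ≡ k
    l₂ = ℤ-Solver.solve-∀
    l₃ : ∀ ρ b m ν → ρ ℤ.* (ρ ℤ.* (b ℤ.- m ℤ.- ν)) ℤ.+ m ℤ.+ ν ≡ ρ ℤ.* ρ ℤ.* (b ℤ.- m ℤ.- ν) ℤ.+ m ℤ.+ ν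
    l₃ = ℤ-Solver.solve-∀
    l₄ : ∀ b m ν → + 1 ℤ.* (b ℤ.- m ℤ.- ν) ℤ.+ m ℤ.+ ν ≡ b
    l₄ = ℤ-Solver.solve-∀
    l₅ : ∀ σ p τ → σ ℤ.* (σ ℤ.* p ℤ.+ τ ℤ.- τ) ≡ σ ℤ.* σ ℤ.* p
    l₅ = ℤ-Solver.solve-∀
    l₆ : ∀ ρ q m ν → ρ ℤ.* (ρ ℤ.* q ℤ.+ m ℤ.+ ν ℤ.- m ℤ.- ν) ≡ ρ ℤ.* ρ ℤ.* q
    l₆ = ℤ-Solver.solve-∀

  -- On the coset a ≡ r + 2b (mod 5), which is the image of multiplication by a unit times 2 ± i, the form Q a + Q b
  -- becomes diagonal again in the coordinates p and q.
  module CosetsModFive (x : Carrier) (E : ℤ → ℕ) (Q : ℤ → ℤ) (2*E : ∀ n → + 2 ℤ.* + E n ≡ Q n) where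
    slice : (r : Fin 5) (σ τ ρ μ ν : ℤ) → σ ℤ.* σ ≡ + 1 → ρ ℤ.* ρ ≡ + 1 →
      ∀ {s} (m : ℤ → ℤ → ℕ) (M : ℤ → ℤ → ℤ) → (∀ p q → + 2 ℤ.* + m p q ≡ M p q) → HasSum (λ (p , q) → x ^ m p q) s →
      (∀ p q → M p q ≡ Q (+ toℕ r ℤ.+ + 5 ℤ.* (σ ℤ.* p ℤ.+ τ) ℤ.+ + 2 ℤ.* (ρ ℤ.* q ℤ.+ μ ℤ.* p ℤ.+ ν)) ℤ.+ Q (ρ ℤ.* q ℤ.+ μ ℤ.* p ℤ.+ ν)) →
      HasSum (λ (k , b) → x ^ E (+ toℕ r ℤ.+ + 5 ℤ.* k ℤ.+ + 2 ℤ.* b) * x ^ E b) s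
    slice r σ τ ρ μ ν σσ ρρ m M 2*m h M≡ = hs-shear σ τ ρ μ ν σσ ρρ (hs-cong (λ (p , q) → trans
      (^-congʳ x (halve-≡ {m p q} {E (row p q) ℕ.+ E (column p q)} (2*m p q) (2*-+ {E (row p q)} {E (column p q)} (2*E (row p q)) (2*E (column p q))) (M≡ p q)))
      (^-homo-* x (E (row p q)) (E (column p q)))) refl h)
      where
      column row : ℤ → ℤ → ℤ
      column p q = ρ ℤ.* q ℤ.+ μ ℤ.* p ℤ.+ ν
      row p q = + toℕ r ℤ.+ + 5 ℤ.* (σ ℤ.* p ℤ.+ τ) ℤ.+ + 2 ℤ.* column p q

  pattern -1ᶻ = -[1+ 0 ]
  pattern -2ᶻ = -[1+ 1 ]

  Q : ℕ → ℕ → ℤ → ℤ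
  Q a b n = + a ℤ.* (n ℤ.* (n ℤ.+ + 1)) ℤ.+ + b ℤ.* (n ℤ.* (n ℤ.- + 1))

  Qᵖ : ∀ {n} → ℕ → ℕ → ℤS.Polynomial n → ℤS.Polynomial n
  Qᵖ a b n = ℤS.con (+ a) ℤS.:* (n ℤS.:* (n ℤS.:+ ℤS.con (+ 1))) ℤS.:+ ℤS.con (+ b) ℤS.:* (n ℤS.:* (n ℤS.:- ℤS.con (+ 1)))

  cosetᵖ : ∀ {n} → ℕ → ℕ → ℕ → (σ τ ρ μ ν : ℤ) → ℤS.Polynomial n → ℤS.Polynomial n → ℤS.Polynomial n
  cosetᵖ a b r σ τ ρ μ ν p q = Qᵖ a b (ℤS.con (+ r) ℤS.:+ ℤS.con (+ 5) ℤS.:* (ℤS.con σ ℤS.:* p ℤS.:+ ℤS.con τ) ℤS.:+ ℤS.con (+ 2) ℤS.:* column) ℤS.:+ Qᵖ a b column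
    where column = ℤS.con ρ ℤS.:* q ℤS.:+ ℤS.con μ ℤS.:* p ℤS.:+ ℤS.con ν

  theta-× : ∀ {y a b c d u v} → HasSum (λ n → y ^ e a b n) u → HasSum (λ n → y ^ e c d n) v →
    HasSum (λ (p , q) → y ^ (e a b p ℕ.+ e c d q)) (u * v)
  theta-× {y} {a} {b} {c} {d} h h′ = hs-cong (λ (p , q) → sym (^-homo-* y (e a b p) (e c d q))) refl (hs-× ℤ._≟_ h h′)

  theta-×-scaled : ∀ {y a b v} → HasSum (λ n → (y ^ 5) ^ e a b n) v → ∀ m →
    HasSum (λ (p , q) → y ^ (m ℕ.+ 5 ℕ.* (e a b p ℕ.+ e a b q))) (y ^ m * (v * v))
  theta-×-scaled {y} {a} {b} h m = hs-cong (λ (p , q) → trans (*-congˡ (^-assocʳ y 5 (e a b p ℕ.+ e a b q))) (sym (^-homo-* y m (5 ℕ.* (e a b p ℕ.+ e a b q))))) refl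
    (hs-*ˡ (y ^ m) (theta-× {y ^ 5} {a} {b} {a} {b} h h))

  2*e+e : ∀ a b c d p q → + 2 ℤ.* + (e a b p ℕ.+ e c d q) ≡ Q a b p ℤ.+ Q c d q
  2*e+e a b c d p q = 2*-+ {e a b p} {e c d q} (2*e a b p) (2*e c d q)

  2*5[e+e] : ∀ m a b p q → + 2 ℤ.* + (m ℕ.+ 5 ℕ.* (e a b p ℕ.+ e a b q)) ≡ + 2 ℤ.* + m ℤ.+ + 5 ℤ.* (Q a b p ℤ.+ Q a b q)
  2*5[e+e] m a b p q = 2*-+ {m} {5 ℕ.* (e a b p ℕ.+ e a b q)} ≡.refl (2*-* 5 {e a b p ℕ.+ e a b q} (2*e+e a b a b p q))

  -- For z = (2a - 1) + (2b - 1)i the exponent is (|z|² - 2)/8, and z is divisible by 2 + i exactly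
  -- when a - 2b ≡ 2 (mod 5). On that coset z = (2 + i)w and |z|² = 5|w|², so the exponent is 1 more
  -- than 5 times the one of w, whence the factor x. Multiplication by i permutes the other four
  -- cosets, so they contribute equally.
  theta-tri² : ∀ {x θ₁ θ₅ u₁ u₂} → HasSum (λ n → x ^ e 0 1 n) θ₁ → HasSum (λ n → (x ^ 5) ^ e 0 1 n) θ₅ →
    HasSum (λ n → x ^ e 4 1 n) u₁ → HasSum (λ n → x ^ e 3 2 n) u₂ →
    θ₁ * θ₁ ≈ x * (θ₅ * θ₅) + ⟦ + 4 ⟧ * (u₁ * u₂)
  theta-tri² {x} {θ₁} {θ₅} {u₁} {u₂} h₁ h₅ k₁ k₂ = trans
    (hs-unique _≟²_ (hs-× ℤ._≟_ h₁ h₁) (hs-cosets 5 (+ 2) s slices))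
    (solve 4 (λ x v u₁ u₂ → u₂ :* u₁ :+ (u₁ :* u₂ :+ ((x :* con (+ 1)) :* v :+ (u₁ :* u₂ :+ (u₂ :* u₁ :+ con (+ 0))))) := x :* v :+ con (+ 4) :* (u₁ :* u₂)) refl x _ u₁ u₂)
    where
    open CosetsModFive x (e 0 1) (Q 0 1) (2*e 0 1)
    U₁₂ = theta-× {x} {4} {1} {3} {2} k₁ k₂
    U₂₁ = theta-× {x} {3} {2} {4} {1} k₂ k₁
    s : Fin 5 → Carrier
    s fzero = u₂ * u₁
    s (fsuc fzero) = u₁ * u₂
    s (fsuc (fsuc fzero)) = x ^ 1 * (θ₅ * θ₅)
    s (fsuc (fsuc (fsuc fzero))) = u₁ * u₂
    s (fsuc (fsuc (fsuc (fsuc fzero)))) = u₂ * u₁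
    slices : ∀ r → HasSum (λ (k , b) → x ^ e 0 1 (+ toℕ r ℤ.+ + 5 ℤ.* k ℤ.+ + 2 ℤ.* b) * x ^ e 0 1 b) (s r)
    slices fzero = slice fzero (+ 1) (+ 0) -1ᶻ -2ᶻ (+ 0) ≡.refl ≡.refl (λ p q → e 3 2 p ℕ.+ e 4 1 q) _ (2*e+e 3 2 4 1) U₂₁
      (ℤS.solve 2 (λ p q → Qᵖ 3 2 p ℤS.:+ Qᵖ 4 1 q ℤS.:= cosetᵖ 0 1 0 (+ 1) (+ 0) -1ᶻ -2ᶻ (+ 0) p q) ≡.refl)
    slices (fsuc fzero) = slice (# 1) (+ 1) (+ 0) (+ 1) -2ᶻ (+ 0) ≡.refl ≡.refl (λ p q → e 4 1 p ℕ.+ e 3 2 q) _ (2*e+e 4 1 3 2) U₁₂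
      (ℤS.solve 2 (λ p q → Qᵖ 4 1 p ℤS.:+ Qᵖ 3 2 q ℤS.:= cosetᵖ 0 1 1 (+ 1) (+ 0) (+ 1) -2ᶻ (+ 0) p q) ≡.refl)
    slices (fsuc (fsuc fzero)) = slice (# 2) -1ᶻ (+ 0) (+ 1) (+ 2) -1ᶻ ≡.refl ≡.refl (λ p q → 1 ℕ.+ 5 ℕ.* (e 0 1 p ℕ.+ e 0 1 q)) _ (2*5[e+e] 1 0 1) (theta-×-scaled {x} {0} {1} h₅ 1)
      (ℤS.solve 2 (λ p q → ℤS.con (+ 2) ℤS.:+ ℤS.con (+ 5) ℤS.:* (Qᵖ 0 1 p ℤS.:+ Qᵖ 0 1 q) ℤS.:= cosetᵖ 0 1 2 -1ᶻ (+ 0) (+ 1) (+ 2) -1ᶻ p q) ≡.refl)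
    slices (fsuc (fsuc (fsuc fzero))) = slice (# 3) -1ᶻ -1ᶻ -1ᶻ (+ 2) (+ 1) ≡.refl ≡.refl (λ p q → e 4 1 p ℕ.+ e 3 2 q) _ (2*e+e 4 1 3 2) U₁₂
      (ℤS.solve 2 (λ p q → Qᵖ 4 1 p ℤS.:+ Qᵖ 3 2 q ℤS.:= cosetᵖ 0 1 3 -1ᶻ -1ᶻ -1ᶻ (+ 2) (+ 1) p q) ≡.refl)
    slices (fsuc (fsuc (fsuc (fsuc fzero)))) = slice (# 4) -1ᶻ -1ᶻ (+ 1) (+ 2) (+ 1) ≡.refl ≡.refl (λ p q → e 3 2 p ℕ.+ e 4 1 q) _ (2*e+e 3 2 4 1) U₂₁
      (ℤS.solve 2 (λ p q → Qᵖ 3 2 p ℤS.:+ Qᵖ 4 1 q ℤS.:= cosetᵖ 0 1 4 -1ᶻ -1ᶻ (+ 1) (+ 2) (+ 1) p q) ≡.refl)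

  -- Squares are centred at the origin, so here the multiples of 2 + i form the coset r = 0. Each of
  -- the other four contains a unit, hence has least norm 1, and this is the factor y. The identity
  -- is applied at y = -x, which makes its last term negative.
  theta-square² : ∀ {y φ₁ φ₅ v₁ v₂} → HasSum (λ n → y ^ e 1 1 n) φ₁ → HasSum (λ n → (y ^ 5) ^ e 1 1 n) φ₅ →
    HasSum (λ n → y ^ e 9 1 n) v₁ → HasSum (λ n → y ^ e 7 3 n) v₂ →
    φ₁ * φ₁ ≈ φ₅ * φ₅ + ⟦ + 4 ⟧ * (y * (v₁ * v₂))
  theta-square² {y} {φ₁} {φ₅} {v₁} {v₂} h₁ h₅ k₁ k₂ = trans
    (hs-unique _≟²_ (hs-× ℤ._≟_ h₁ h₁) (hs-cosets 5 (+ 2) s slices))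
    (solve 4 (λ y f v₁ v₂ → con (+ 1) :* f :+ ((y :* con (+ 1)) :* (v₂ :* v₁) :+ ((y :* con (+ 1)) :* (v₁ :* v₂) :+ ((y :* con (+ 1)) :* (v₁ :* v₂) :+ ((y :* con (+ 1)) :* (v₂ :* v₁) :+ con (+ 0))))) := f :+ con (+ 4) :* (y :* (v₁ :* v₂))) refl y _ v₁ v₂)
    where
    open CosetsModFive y (e 1 1) (Q 1 1) (2*e 1 1)
    V₁₂ = hs-cong (λ (p , q) → sym (^-homo-* y 1 (e 9 1 p ℕ.+ e 7 3 q))) refl (hs-*ˡ (y ^ 1) (theta-× {y} {9} {1} {7} {3} k₁ k₂))
    V₂₁ = hs-cong (λ (p , q) → sym (^-homo-* y 1 (e 7 3 p ℕ.+ e 9 1 q))) refl (hs-*ˡ (y ^ 1) (theta-× {y} {7} {3} {9} {1} k₂ k₁))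
    2*[1+e+e] : ∀ a b c d p q → + 2 ℤ.* + (1 ℕ.+ (e a b p ℕ.+ e c d q)) ≡ + 2 ℤ.+ (Q a b p ℤ.+ Q c d q)
    2*[1+e+e] a b c d p q = 2*-+ {1} {e a b p ℕ.+ e c d q} ≡.refl (2*e+e a b c d p q)
    s : Fin 5 → Carrier
    s fzero = 1# * (φ₅ * φ₅)
    s (fsuc fzero) = y ^ 1 * (v₂ * v₁)
    s (fsuc (fsuc fzero)) = y ^ 1 * (v₁ * v₂)
    s (fsuc (fsuc (fsuc fzero))) = y ^ 1 * (v₁ * v₂)
    s (fsuc (fsuc (fsuc (fsuc fzero)))) = y ^ 1 * (v₂ * v₁)
    slices : ∀ r → HasSum (λ (k , b) → y ^ e 1 1 (+ toℕ r ℤ.+ + 5 ℤ.* k ℤ.+ + 2 ℤ.* b) * y ^ e 1 1 b) (s r)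
    slices fzero = slice fzero -1ᶻ (+ 0) (+ 1) (+ 2) (+ 0) ≡.refl ≡.refl (λ p q → 0 ℕ.+ 5 ℕ.* (e 1 1 p ℕ.+ e 1 1 q)) _ (2*5[e+e] 0 1 1) (theta-×-scaled {y} {1} {1} h₅ 0)
      (ℤS.solve 2 (λ p q → ℤS.con (+ 0) ℤS.:+ ℤS.con (+ 5) ℤS.:* (Qᵖ 1 1 p ℤS.:+ Qᵖ 1 1 q) ℤS.:= cosetᵖ 1 1 0 -1ᶻ (+ 0) (+ 1) (+ 2) (+ 0) p q) ≡.refl)
    slices (fsuc fzero) = slice (# 1) (+ 1) (+ 0) (+ 1) -2ᶻ (+ 0) ≡.refl ≡.refl (λ p q → 1 ℕ.+ (e 7 3 p ℕ.+ e 9 1 q)) _ (2*[1+e+e] 7 3 9 1) V₂₁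
      (ℤS.solve 2 (λ p q → ℤS.con (+ 2) ℤS.:+ (Qᵖ 7 3 p ℤS.:+ Qᵖ 9 1 q) ℤS.:= cosetᵖ 1 1 1 (+ 1) (+ 0) (+ 1) -2ᶻ (+ 0) p q) ≡.refl)
    slices (fsuc (fsuc fzero)) = slice (# 2) (+ 1) (+ 0) -1ᶻ -2ᶻ -1ᶻ ≡.refl ≡.refl (λ p q → 1 ℕ.+ (e 9 1 p ℕ.+ e 7 3 q)) _ (2*[1+e+e] 9 1 7 3) V₁₂
      (ℤS.solve 2 (λ p q → ℤS.con (+ 2) ℤS.:+ (Qᵖ 9 1 p ℤS.:+ Qᵖ 7 3 q) ℤS.:= cosetᵖ 1 1 2 (+ 1) (+ 0) -1ᶻ -2ᶻ -1ᶻ p q) ≡.refl)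
    slices (fsuc (fsuc (fsuc fzero))) = slice (# 3) -1ᶻ -1ᶻ (+ 1) (+ 2) (+ 1) ≡.refl ≡.refl (λ p q → 1 ℕ.+ (e 9 1 p ℕ.+ e 7 3 q)) _ (2*[1+e+e] 9 1 7 3) V₁₂
      (ℤS.solve 2 (λ p q → ℤS.con (+ 2) ℤS.:+ (Qᵖ 9 1 p ℤS.:+ Qᵖ 7 3 q) ℤS.:= cosetᵖ 1 1 3 -1ᶻ -1ᶻ (+ 1) (+ 2) (+ 1) p q) ≡.refl)
    slices (fsuc (fsuc (fsuc (fsuc fzero)))) = slice (# 4) -1ᶻ -1ᶻ -1ᶻ (+ 2) (+ 0) ≡.refl ≡.refl (λ p q → 1 ℕ.+ (e 7 3 p ℕ.+ e 9 1 q)) _ (2*[1+e+e] 7 3 9 1) V₂₁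
      (ℤS.solve 2 (λ p q → ℤS.con (+ 2) ℤS.:+ (Qᵖ 7 3 p ℤS.:+ Qᵖ 9 1 q) ℤS.:= cosetᵖ 1 1 4 -1ᶻ -1ᶻ -1ᶻ (+ 2) (+ 0) p q) ≡.refl)

-- The identity of level ten.

module LevelTen (R : CommutativeRing 0ℓ 0ℓ) (ι : ℤ⟶ R) where
  open NilpotentRing R ι
  open ThetaIdentities R ι
  open EulerProducts R ι
  open LatticeIdentities R ι

  module _ {x : Carrier} (nil : Nil x) {e₁ e₂ e₅ e₁₀ θ₁ θ₅ : Carrier}
    (E₁ : Euler x e₁) (E₂ : Euler (x ^ 2) e₂) (E₅ : Euler (x ^ 5) e₅) (E₁₀ : Euler ((x ^ 5) ^ 2) e₁₀)
    (T₁ : HasSum (λ n → x ^ e 0 1 n) θ₁) (T₅ : HasSum (λ n → (x ^ 5) ^ e 0 1 n) θ₅) where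
    private
      module Values {u₁ u₂ v₁ v₂ φ₁ φ₅ : Carrier}
        (U₁ : HasSum (λ n → x ^ e 4 1 n) u₁) (U₂ : HasSum (λ n → x ^ e 3 2 n) u₂)
        (V₁ : HasSum (λ n → (- x) ^ e 9 1 n) v₁) (V₂ : HasSum (λ n → (- x) ^ e 7 3 n) v₂)
        (Φ₁ : HasSum (λ n → (- x) ^ e 1 1 n) φ₁) (Φ₅ : HasSum (λ n → (- (x ^ 5)) ^ e 1 1 n) φ₅) where
        U = u₁ * u₂
        V = v₁ * v₂
        D = x * (θ₅ * θ₅)
        nil₅ = nil-suc 4 nil

        U-prod : U * (e₁ * e₁₀) ≈ e₂ * (e₅ * e₅ * e₅)
        U-prod = theta-41-32 nil E₁ E₂ E₅ E₁₀ U₁ U₂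
        V-prod : V * (e₂ * e₅) ≈ e₁ * (e₁₀ * e₁₀ * e₁₀)
        V-prod = theta-91-73 nil E₁ E₂ E₅ E₁₀ V₁ V₂
        θ₅-prod : θ₅ * e₅ ≈ ⟦ + 2 ⟧ * (e₁₀ * e₁₀)
        θ₅-prod = theta-tri nil₅ E₅ E₁₀ T₅
        φ₁-prod : φ₁ * e₂ ≈ e₁ * e₁
        φ₁-prod = theta-square nil E₁ E₂ Φ₁
        φ₅-prod : φ₅ * e₁₀ ≈ e₅ * e₅
        φ₅-prod = theta-square nil₅ E₅ E₁₀ Φ₅

        θ² : θ₁ * θ₁ ≈ D + ⟦ + 4 ⟧ * U
        θ² = theta-tri² T₁ T₅ U₁ U₂
        φ² : φ₁ * φ₁ ≈ φ₅ * φ₅ + ⟦ + 4 ⟧ * (- x * V)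
        φ² = theta-square² Φ₁ (hs-cong (λ n → ^-congˡ (e 1 1 n) (sym (neg-odd x 2))) refl Φ₅) V₁ V₂

        -- With φ₁ = e₁²/e₂, φ₅ = e₅²/e₁₀ and V = e₁e₁₀³/(e₂e₅), this is `φ²` multiplied by
        -- e₂²e₁₀²e₅.
        φ²-prod : e₁ * e₁ * (e₁ * e₁) * (e₁₀ * e₁₀ * e₅) ≈
          e₅ * e₅ * (e₅ * e₅) * (e₂ * e₂ * e₅) - ⟦ + 4 ⟧ * (x * (e₁ * (e₁₀ * e₁₀ * e₁₀))) * (e₂ * (e₁₀ * e₁₀))
        φ²-prod = begin
          e₁ * e₁ * (e₁ * e₁) * (e₁₀ * e₁₀ * e₅) ≈⟨ *-congʳ (*-cong φ₁-prod φ₁-prod) ⟨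
          φ₁ * e₂ * (φ₁ * e₂) * (e₁₀ * e₁₀ * e₅)
            ≈⟨ solve 4 (λ f a b c → f :* a :* (f :* a) :* (b :* b :* c) := (f :* f) :* (a :* a :* (b :* b :* c))) refl φ₁ e₂ e₁₀ e₅ ⟩
          (φ₁ * φ₁) * (e₂ * e₂ * (e₁₀ * e₁₀ * e₅)) ≈⟨ *-congʳ φ² ⟩
          (φ₅ * φ₅ + ⟦ + 4 ⟧ * (- x * V)) * (e₂ * e₂ * (e₁₀ * e₁₀ * e₅))
            ≈⟨ solve 6 (λ f v x a b c → (f :* f :+ con (+ 4) :* (:- x :* v)) :* (a :* a :* (b :* b :* c)) :=
                 (f :* b) :* (f :* b) :* (a :* a :* c) :- con (+ 4) :* (x :* (v :* (a :* c))) :* (a :* (b :* b))) refl φ₅ V x e₂ e₁₀ e₅ ⟩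
          (φ₅ * e₁₀) * (φ₅ * e₁₀) * (e₂ * e₂ * e₅) - ⟦ + 4 ⟧ * (x * (V * (e₂ * e₅))) * (e₂ * (e₁₀ * e₁₀))
            ≈⟨ +-cong (*-congʳ (*-cong φ₅-prod φ₅-prod)) (-‿cong (*-congʳ (*-congˡ (*-congˡ V-prod)))) ⟩
          e₅ * e₅ * (e₅ * e₅) * (e₂ * e₂ * e₅) - ⟦ + 4 ⟧ * (x * (e₁ * (e₁₀ * e₁₀ * e₁₀))) * (e₂ * (e₁₀ * e₁₀)) ∎

        -- Substituting U = e₂e₅³/(e₁e₁₀) and D = 4x e₁₀⁴/e₅² and clearing denominators produces the
        -- right-hand side of `φ²-prod` term by term, so the difference becomes a monomial in the
        -- Euler products.
        [U-D]-prod : (U - D) * (e₁ * e₂ * e₁₀ * (e₅ * e₅)) ≈ e₁ * e₁ * (e₁ * e₁) * (e₁₀ * e₁₀ * e₅)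
        [U-D]-prod = begin
          (U - x * (θ₅ * θ₅)) * (e₁ * e₂ * e₁₀ * (e₅ * e₅))
            ≈⟨ solve 7 (λ U x t a b c d → (U :- x :* (t :* t)) :* (a :* b :* d :* (c :* c)) :=
                 (U :* (a :* d)) :* (b :* (c :* c)) :- x :* ((t :* c) :* (t :* c)) :* (a :* b :* d)) refl U x θ₅ e₁ e₂ e₅ e₁₀ ⟩
          (U * (e₁ * e₁₀)) * (e₂ * (e₅ * e₅)) - x * ((θ₅ * e₅) * (θ₅ * e₅)) * (e₁ * e₂ * e₁₀)
            ≈⟨ +-cong (*-congʳ U-prod) (-‿cong (*-congʳ (*-congˡ (*-cong θ₅-prod θ₅-prod)))) ⟩
          (e₂ * (e₅ * e₅ * e₅)) * (e₂ * (e₅ * e₅)) - x * ((⟦ + 2 ⟧ * (e₁₀ * e₁₀)) * (⟦ + 2 ⟧ * (e₁₀ * e₁₀))) * (e₁ * e₂ * e₁₀)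
            ≈⟨ solve 5 (λ x a b c d → (b :* (c :* c :* c)) :* (b :* (c :* c)) :- x :* ((con (+ 2) :* (d :* d)) :* (con (+ 2) :* (d :* d))) :* (a :* b :* d) :=
                 c :* c :* (c :* c) :* (b :* b :* c) :- con (+ 4) :* (x :* (a :* (d :* d :* d))) :* (b :* (d :* d))) refl x e₁ e₂ e₅ e₁₀ ⟩
          e₅ * e₅ * (e₅ * e₅) * (e₂ * e₂ * e₅) - ⟦ + 4 ⟧ * (x * (e₁ * (e₁₀ * e₁₀ * e₁₀))) * (e₂ * (e₁₀ * e₁₀)) ≈⟨ φ²-prod ⟨
          e₁ * e₁ * (e₁ * e₁) * (e₁₀ * e₁₀ * e₅) ∎

        unit : Unit (e₁ * e₁₀ * (e₁ * e₂ * e₁₀ * (e₅ * e₅)))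
        unit = unit-* (unit-* u₁′ u₁₀) (unit-* (unit-* (unit-* u₁′ (Euler-unit (nil-suc 1 nil) E₂)) u₁₀) (unit-* u₅ u₅))
          where
          u₁′ = Euler-unit nil E₁
          u₅ = Euler-unit nil₅ E₅
          u₁₀ = Euler-unit (nil-suc 1 nil₅) E₁₀

        U[U-D] : U * (U - D) ≈ e₁ * e₁ * (e₅ * e₅)
        U[U-D] = unit-cancel unit (begin
          (e₁ * e₁₀ * (e₁ * e₂ * e₁₀ * (e₅ * e₅))) * (U * (U - D))
            ≈⟨ solve 4 (λ a b U W → (a :* b) :* (U :* W) := (U :* a) :* (W :* b)) refl (e₁ * e₁₀) (e₁ * e₂ * e₁₀ * (e₅ * e₅)) U (U - D) ⟩
          (U * (e₁ * e₁₀)) * ((U - D) * (e₁ * e₂ * e₁₀ * (e₅ * e₅))) ≈⟨ *-cong U-prod [U-D]-prod ⟩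
          (e₂ * (e₅ * e₅ * e₅)) * (e₁ * e₁ * (e₁ * e₁) * (e₁₀ * e₁₀ * e₅))
            ≈⟨ solve 4 (λ a b c d → (b :* (c :* c :* c)) :* (a :* a :* (a :* a) :* (d :* d :* c)) :=
                 (a :* d :* (a :* b :* d :* (c :* c))) :* (a :* a :* (c :* c))) refl e₁ e₂ e₅ e₁₀ ⟩
          (e₁ * e₁₀ * (e₁ * e₂ * e₁₀ * (e₅ * e₅))) * (e₁ * e₁ * (e₅ * e₅)) ∎)

        result : (θ₁ * θ₁) * (θ₁ * θ₁) + ⟦ + 5 ⟧ * (D * D) ≈ ⟦ + 6 ⟧ * ((θ₁ * θ₁) * D) + ⟦ + 16 ⟧ * (e₁ * e₁ * (e₅ * e₅))
        result = begin
          (θ₁ * θ₁) * (θ₁ * θ₁) + ⟦ + 5 ⟧ * (D * D) ≈⟨ +-congʳ (*-cong θ² θ²) ⟩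
          -- Since θ₁² - D = 4U and θ₁² - 5D = 4(U - D), this is (θ₁² - D)(θ₁² - 5D) = 16 U (U - D),
          -- with the mixed term 6θ₁²D moved to the right.
          (D + ⟦ + 4 ⟧ * U) * (D + ⟦ + 4 ⟧ * U) + ⟦ + 5 ⟧ * (D * D)
            ≈⟨ solve 2 (λ D U → (D :+ con (+ 4) :* U) :* (D :+ con (+ 4) :* U) :+ con (+ 5) :* (D :* D) :=
                 con (+ 6) :* ((D :+ con (+ 4) :* U) :* D) :+ con (+ 16) :* (U :* (U :- D))) refl D U ⟩
          ⟦ + 6 ⟧ * ((D + ⟦ + 4 ⟧ * U) * D) + ⟦ + 16 ⟧ * (U * (U - D)) ≈⟨ +-cong (*-congˡ (*-congʳ (sym θ²))) (*-congˡ U[U-D]) ⟩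
          ⟦ + 6 ⟧ * ((θ₁ * θ₁) * D) + ⟦ + 16 ⟧ * (e₁ * e₁ * (e₅ * e₅)) ∎

    level-ten : let D = x * (θ₅ * θ₅) in
      (θ₁ * θ₁) * (θ₁ * θ₁) + ⟦ + 5 ⟧ * (D * D) ≈ ⟦ + 6 ⟧ * ((θ₁ * θ₁) * D) + ⟦ + 16 ⟧ * (e₁ * e₁ * (e₅ * e₅))
    level-ten = Values.result (proj₂ (theta-exists x 4 1 nil)) (proj₂ (theta-exists x 3 2 nil))
      (proj₂ (theta-exists (- x) 9 1 nil⁻)) (proj₂ (theta-exists (- x) 7 3 nil⁻)) (proj₂ (theta-exists (- x) 1 1 nil⁻))
      (proj₂ (theta-exists (- (x ^ 5)) 1 1 (nil-neg (nil-suc 4 nil))))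
      where
      nil⁻ = nil-neg nil

-- Dual numbers as formal differentiation.

module DualNumbers (R : CommutativeRing 0ℓ 0ℓ) (ι : ℤ⟶ R) where
  open NilpotentRing R ι

  infix 4 _≈ᵈ_
  _≈ᵈ_ : Carrier × Carrier → Carrier × Carrier → Set
  (a , b) ≈ᵈ (c , d) = a ≈ c × b ≈ d

  R[ε] : CommutativeRing 0ℓ 0ℓ
  R[ε] = record
    { Carrier = Carrier × Carrier
    ; _≈_ = _≈ᵈ_
    ; _+_ = λ (a , b) (c , d) → a + c , b + d
    ; _*_ = λ (a , b) (c , d) → a * c , a * d + b * c
    ; -_ = λ (a , b) → - a , - b
    ; 0# = 0# , 0#
    ; 1# = 1# , 0#
    ; isCommutativeRing = record
      { isRing = record
        { +-isAbelianGroup = record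
          { isGroup = record
            { isMonoid = record
              { isSemigroup = record
                { isMagma = record
                  { isEquivalence = record
                    { refl = refl , refl
                    ; sym = λ (p , q) → sym p , sym q
                    ; trans = λ (p , q) (p′ , q′) → trans p p′ , trans q q′ }
                  ; ∙-cong = λ (p , q) (p′ , q′) → +-cong p p′ , +-cong q q′ }
                ; assoc = λ _ _ _ → +-assoc _ _ _ , +-assoc _ _ _ }
              ; identity = (λ _ → +-identityˡ _ , +-identityˡ _) , (λ _ → +-identityʳ _ , +-identityʳ _) }
            ; inverse = (λ _ → -‿inverseˡ _ , -‿inverseˡ _) , (λ _ → -‿inverseʳ _ , -‿inverseʳ _)
            ; ⁻¹-cong = λ (p , q) → -‿cong p , -‿cong q }
          ; comm = λ _ _ → +-comm _ _ , +-comm _ _ }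
        ; *-cong = λ (p , q) (p′ , q′) → *-cong p p′ , +-cong (*-cong p q′) (*-cong q p′)
        ; *-assoc = λ (a , b) (c , d) (e , f) → *-assoc _ _ _ ,
            solve 6 (λ a b c d e f → (a :* c) :* f :+ (a :* d :+ b :* c) :* e := a :* (c :* f :+ d :* e) :+ b :* (c :* e)) refl a b c d e f
        ; *-identity = (λ (a , b) → *-identityˡ _ , solve 2 (λ a b → con (+ 1) :* b :+ con (+ 0) :* a := b) refl a b)
                     , (λ (a , b) → *-identityʳ _ , solve 2 (λ a b → a :* con (+ 0) :+ b :* con (+ 1) := b) refl a b)
        ; distrib = (λ (a , b) (c , d) (e , f) → distribˡ _ _ _ ,
                      solve 6 (λ a b c d e f → a :* (d :+ f) :+ b :* (c :+ e) := (a :* d :+ b :* c) :+ (a :* f :+ b :* e)) refl a b c d e f)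
                  , (λ (a , b) (c , d) (e , f) → distribʳ _ _ _ ,
                      solve 6 (λ a b c d e f → (c :+ e) :* b :+ (d :+ f) :* a := (c :* b :+ d :* a) :+ (e :* b :+ f :* a)) refl a b c d e f) }
      ; *-comm = λ (a , b) (c , d) → *-comm _ _ , solve 4 (λ a b c d → a :* d :+ b :* c := c :* b :+ d :* a) refl a b c d } }

  ι[ε] : ℤ⟶ R[ε]
  ι[ε] = record
    { ⟦_⟧ = λ z → ⟦ z ⟧ , 0#
    ; +-homo = λ a b → +-homo a b , sym (+-identityˡ 0#)
    ; *-homo = λ a b → *-homo a b , solve 2 (λ a b → con (+ 0) := a :* con (+ 0) :+ con (+ 0) :* b) refl ⟦ a ⟧ ⟦ b ⟧
    ; -‿homo = λ a → -‿homo a , solve 0 (con (+ 0) := :- con (+ 0)) refl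
    ; 0-homo = refl , refl
    ; 1-homo = refl , refl }

  module ε = NilpotentRing R[ε] ι[ε]

  const : Carrier → Carrier × Carrier
  const a = a , 0#

  const-* : ∀ a b → const a ε.* const b ε.≈ const (a * b)
  const-* a b = refl , solve 2 (λ a b → a :* con (+ 0) :+ con (+ 0) :* b := con (+ 0)) refl a b

  const-^ : ∀ a k → const a ε.^ k ε.≈ const (a ^ k)
  const-^ a zero = ε.refl
  const-^ a (suc k) = ε.trans (ε.*-congˡ {const a} (const-^ a k)) (const-* a (a ^ k))

  const-HasProd : ∀ {F p} → HasProd F p → ε.HasProd (const ∘ F) (const p)
  const-HasProd {F} (hasProd b o v) = ε.hasProd b (λ k b≤k → o k b≤k , refl) (ε.trans (const-rng b) (v , refl))
    where
    const-rng : ∀ n → ε.rng (const ∘ F) n ε.≈ const (rng F n)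
    const-rng zero = ε.refl
    const-rng (suc n) = ε.trans (ε.*-congʳ (const-rng n)) (const-* (rng F n) (F n))

  fst-rng : ∀ F n → proj₁ (ε.rng F n) ≈ rng (proj₁ ∘ F) n
  fst-rng F zero = refl
  fst-rng F (suc n) = *-congʳ (fst-rng F n)

  fst-HasProd : ∀ {F p} → ε.HasProd F p → HasProd (proj₁ ∘ F) (proj₁ p)
  fst-HasProd {F} (ε.hasProd b o v) = hasProd b (λ k b≤k → proj₁ (o k b≤k)) (trans (sym (fst-rng F b)) (proj₁ v))

  fst-HasSum : {I : Set} {F : I → Carrier × Carrier} {s : Carrier × Carrier} → ε.HasSum F s → HasSum (proj₁ ∘ F) (proj₁ s)
  fst-HasSum = hs-hom ε.+-commutativeMonoid +-commutativeMonoid proj₁ proj₁ (λ _ _ → refl) refl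

  snd-HasSum : {I : Set} {F : I → Carrier × Carrier} {s : Carrier × Carrier} → ε.HasSum F s → HasSum (proj₂ ∘ F) (proj₂ s)
  snd-HasSum = hs-hom ε.+-commutativeMonoid +-commutativeMonoid proj₂ proj₂ (λ _ _ → refl) refl

  -- This is a(1 + sε). Its k-th power has ε-part k·s·a^k, so for s = 1 the ε-part of a power series
  -- in it is the Euler operator a·d/da applied to the series.
  twist : Carrier → Carrier → Carrier × Carrier
  twist s a = a , s * a

  ⟦suc⟧ : ∀ k → ⟦ + suc k ⟧ ≈ 1# + ⟦ + k ⟧
  ⟦suc⟧ k = +-homo (+ 1) (+ k)

  twist-^ : ∀ s a k → twist s a ε.^ k ε.≈ (a ^ k , ⟦ + k ⟧ * (s * a ^ k))
  twist-^ s a zero = refl , solve 1 (λ s → con (+ 0) := con (+ 0) :* (s :* con (+ 1))) refl s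
  twist-^ s a (suc k) = ε.trans (ε.*-congˡ {twist s a} (twist-^ s a k)) (refl , (begin
    a * (⟦ + k ⟧ * (s * a ^ k)) + s * a * a ^ k
      ≈⟨ solve 4 (λ a k s y → a :* (k :* (s :* y)) :+ s :* a :* y := (con (+ 1) :+ k) :* (s :* (a :* y))) refl a ⟦ + k ⟧ s (a ^ k) ⟩
    (1# + ⟦ + k ⟧) * (s * (a * a ^ k)) ≈⟨ *-congʳ (⟦suc⟧ k) ⟨
    ⟦ + suc k ⟧ * (s * (a * a ^ k)) ∎))

  twist-nil : ∀ s {a} → Nil a → ε.Nil (twist s a)
  twist-nil s {a} (K , e) = K , ε.trans (twist-^ s a K) (e , trans (*-congˡ (trans (*-congˡ e) (zeroʳ s))) (zeroʳ _))

  twist-*-twist⁻ : ∀ a b → twist 1# a ε.* twist (- 1#) b ε.≈ const (a * b)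
  twist-*-twist⁻ a b = refl , solve 2 (λ a b → a :* (:- con (+ 1) :* b) :+ con (+ 1) :* a :* b := con (+ 0)) refl a b

  -- Since (1 + ε)(1 - ε) = 1, the product of the two arguments stays constant, and only the factor
  -- (1 + ε)^n = 1 + nε remains. This plays the part of the free variable z of the triple product,
  -- differentiated at z = 1.
  theta-twist : ∀ a b n → ε.theta (twist 1# a) (twist (- 1#) b) n ε.≈ (theta a b n , ⟦ n ⟧ * theta a b n)
  theta-twist a b (+ k) = ε.trans
    (ε.*-cong (ε.trans (ε.^-congˡ (tri k) (twist-*-twist⁻ a b)) (const-^ (a * b) (tri k))) (twist-^ 1# a k))
    (refl , solve 3 (λ N k y → N :* (k :* (con (+ 1) :* y)) :+ con (+ 0) :* y := k :* (N :* y)) refl ((a * b) ^ tri k) ⟦ + k ⟧ (a ^ k))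
  theta-twist a b -[1+ k ] = ε.trans
    (ε.*-cong (ε.trans (ε.^-congˡ (tri (suc k)) (twist-*-twist⁻ a b)) (const-^ (a * b) (tri (suc k)))) (twist-^ (- 1#) b (suc k)))
    (refl , (begin
      N * (⟦ + suc k ⟧ * (- 1# * b ^ suc k)) + 0# * b ^ suc k
        ≈⟨ solve 3 (λ N k y → N :* (k :* (:- con (+ 1) :* y)) :+ con (+ 0) :* y := (:- k) :* (N :* y)) refl N ⟦ + suc k ⟧ (b ^ suc k) ⟩
      (- ⟦ + suc k ⟧) * (N * b ^ suc k) ≈⟨ *-congʳ (-‿homo (+ suc k)) ⟨
      ⟦ -[1+ k ] ⟧ * (N * b ^ suc k) ∎))
    where N = (a * b) ^ tri (suc k)

-- Signs, first moments of theta series and Jacobi's series for E³.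

sgn : ℕ → ℤ
sgn zero = + 1
sgn (suc k) = ℤ.- sgn k

sgn-+ : ∀ a b → sgn (a ℕ.+ b) ≡ sgn a ℤ.* sgn b
sgn-+ zero b = ≡.sym (ℤ.*-identityˡ (sgn b))
sgn-+ (suc a) b = ≡.trans (≡.cong ℤ.-_ (sgn-+ a b)) (ℤ.neg-distribˡ-* (sgn a) (sgn b))

sgn-2* : ∀ k b → sgn (b ℕ.+ 2 ℕ.* k) ≡ sgn b
sgn-2* zero b = ≡.cong sgn (ℕ.+-identityʳ b)
sgn-2* (suc k) b = ≡.trans (≡.cong sgn (lem b k)) (≡.trans (ℤ.neg-involutive _) (sgn-2* k b))
  where
  lem : ∀ b k → b ℕ.+ 2 ℕ.* suc k ≡ suc (suc (b ℕ.+ 2 ℕ.* k))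
  lem = ℕ-Solver.solve-∀

sgn-cong : ∀ {a b} z → + a ≡ + b ℤ.+ + 2 ℤ.* z → sgn a ≡ sgn b
sgn-cong {a} {b} (+ k) e = ≡.trans (≡.cong sgn (ℤ.+-injective (≡.trans e (≡.trans (≡.cong (λ z → + b ℤ.+ z) (≡.sym (ℤ.pos-* 2 k))) (≡.sym (ℤ.pos-+ b (2 ℕ.* k))))))) (sgn-2* k b)
sgn-cong {a} {b} z@(-[1+ k ]) e = ≡.sym (≡.trans (≡.cong sgn (ℤ.+-injective (≡.trans (lem (+ b) z)
  (≡.trans (≡.cong (λ y → y ℤ.+ + 2 ℤ.* (ℤ.- z)) (≡.sym e)) (≡.trans (≡.cong (λ y → + a ℤ.+ y) (≡.sym (ℤ.pos-* 2 (suc k)))) (≡.sym (ℤ.pos-+ a (2 ℕ.* suc k)))))))) (sgn-2* (suc k) a))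
  where
  lem : ∀ b z → b ≡ (b ℤ.+ + 2 ℤ.* z) ℤ.+ + 2 ℤ.* (ℤ.- z)
  lem = ℤ-Solver.solve-∀

-- The squares n² and the triangular numbers n(n-1)/2 as natural numbers, over all integers n.
sq T : ℤ → ℕ
sq = e 1 1
T = e 0 1

+sq : ∀ n → + sq n ≡ n ℤ.* n
+sq n = ℤ.*-cancelˡ-≡ (+ 2) _ _ (≡.trans (2*e 1 1 n) (lem n))
  where
  lem : ∀ n → + 1 ℤ.* (n ℤ.* (n ℤ.+ + 1)) ℤ.+ + 1 ℤ.* (n ℤ.* (n ℤ.- + 1)) ≡ + 2 ℤ.* (n ℤ.* n)
  lem = ℤ-Solver.solve-∀

module Legendre (R : CommutativeRing 0ℓ 0ℓ) (ι : ℤ⟶ R) where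
  open NilpotentRing R ι
  open ThetaIdentities R ι
  open EulerProducts R ι
  open LatticeIdentities R ι using (hs-shear)
  open DualNumbers R ι

  const-nil : ∀ {a} → Nil a → ε.Nil (const a)
  const-nil {a} (K , e) = K , ε.trans (const-^ a K) (e , refl)

  -- In the twisted triple product the ε-parts of the two conjugate linear factors cancel, so every
  -- factor is constant and the product has ε-part 0. The symmetry n ↦ -n alone would show only that
  -- twice the sum vanishes.
  first-moment-0 : ∀ {y} → Nil y → HasSum (λ n → ⟦ n ⟧ * theta y y n) 0#
  first-moment-0 {y} nil = hs-cong (λ n → proj₂ (theta-twist y y n)) refl
    (snd-HasSum (ε.JacobiTripleProduct.tripleProduct (twist 1# y) (twist (- 1#) y)
      (ε.nil-cong (ε.sym (twist-*-twist⁻ y y)) (const-nil N-nil))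
      (ε.hp-cong factor ε.refl (const-HasProd (hasProd K beyond refl)))))
    where
    N = y * y
    N-nil = nil-* y nil
    K = proj₁ N-nil
    F : ℕ → Carrier
    F k = (1# + y * N ^ k) * (1# + y * N ^ k) * (1# - N ^ suc k)
    beyond : ∀ k → K ℕ.≤ k → F k ≈ 1#
    beyond k K≤k = trans (*-cong (trans (*-cong one one) (*-identityˡ 1#)) (1-0 (nil-≤ N-nil (ℕ.m≤n⇒m≤1+n K≤k)))) (*-identityˡ 1#)
      where one = 1+0 (trans (*-congˡ (nil-≤ N-nil K≤k)) (zeroʳ y))
    N̂ = twist 1# y ε.* twist (- 1#) y
    N̂^ : ∀ k → N̂ ε.^ k ε.≈ const (N ^ k)
    N̂^ k = ε.trans (ε.^-congˡ k (twist-*-twist⁻ y y)) (const-^ N k)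
    factor : ∀ k → const (F k) ε.≈
      (ε.1# ε.+ twist 1# y ε.* N̂ ε.^ k) ε.* (ε.1# ε.+ twist (- 1#) y ε.* N̂ ε.^ k) ε.* (ε.1# ε.- N̂ ε.^ suc k)
    factor k = ε.sym (ε.trans (ε.*-cong (ε.*-cong (ε.+-congˡ {ε.1#} (ε.*-congˡ {twist 1# y} (N̂^ k))) (ε.+-congˡ {ε.1#} (ε.*-congˡ {twist (- 1#) y} (N̂^ k))))
        (ε.+-congˡ {ε.1#} (ε.-‿cong (N̂^ (suc k)))))
      (refl , solve 3 (λ y c d →
        ((con (+ 1) :+ y :* c) :* (con (+ 1) :+ y :* c)) :* (con (+ 0) :+ :- con (+ 0)) :+
        ((con (+ 1) :+ y :* c) :* (con (+ 0) :+ (y :* con (+ 0) :+ (:- con (+ 1)) :* y :* c)) :+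
          (con (+ 0) :+ (y :* con (+ 0) :+ con (+ 1) :* y :* c)) :* (con (+ 1) :+ y :* c)) :* (con (+ 1) :- d)
        := con (+ 0)) refl y (N ^ k) (N ^ suc k)))

  -- Jacobi's series from the triple product for f(-1, -Q), twisted. The factor `A 0` is 1 - (1 + ε)
  -- = -ε; each `A (suc k)` paired with `B k` loses its ε-part and becomes (1 - Q^(k+1))². The whole
  -- product is -ε e³, which gives both moments at once.
  module AlternatingMoments {Q e : Carrier} (nil : Nil Q) (E : Euler Q e) where
    private
      K = proj₁ nil
      α β : Carrier × Carrier
      α = twist 1# (- 1#)
      β = twist (- 1#) (- Q)
      αβ : α ε.* β ε.≈ const Q
      αβ = ε.trans (twist-*-twist⁻ (- 1#) (- Q)) (solve 1 (λ Q → (:- con (+ 1)) :* (:- Q) := Q) refl Q , refl)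
      A B : ℕ → Carrier × Carrier
      A k = ε.1# ε.+ α ε.* const (Q ^ k)
      B k = ε.1# ε.+ β ε.* const (Q ^ k)
      near-1 : ∀ γ k → K ℕ.≤ k → ε.1# ε.+ γ ε.* const (Q ^ k) ε.≈ ε.1#
      near-1 γ k K≤k = ε.trans (ε.+-congˡ {ε.1#} (ε.trans (ε.*-congˡ {γ} (nil-≤ nil K≤k , refl)) (ε.zeroʳ γ))) (ε.+-identityʳ ε.1#)
      PA : ε.HasProd (A ∘ suc) (ε.rng (A ∘ suc) K)
      PA = ε.hasProd K (λ k K≤k → near-1 α (suc k) (ℕ.m≤n⇒m≤1+n K≤k)) ε.refl
      PB : ε.HasProd B (ε.rng B K)
      PB = ε.hasProd K (near-1 β) ε.refl
      a b : Carrier × Carrier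
      a = ε.rng (A ∘ suc) K
      b = ε.rng B K
      ab : a ε.* b ε.≈ const (e * e)
      ab = ε.hp-unique (ε.hp-* PA PB) (ε.hp-cong (λ k → ε.sym (cancel k)) ε.refl (const-HasProd (hp-* E E)))
        where
        cancel : ∀ k → A (suc k) ε.* B k ε.≈ const ((1# - Q ^ suc k) * (1# - Q ^ suc k))
        cancel k =
          solve 2 (λ Q y → (con (+ 1) :+ (:- con (+ 1)) :* (Q :* y)) :* (con (+ 1) :+ (:- Q) :* y) :=
            (con (+ 1) :- Q :* y) :* (con (+ 1) :- Q :* y)) refl Q (Q ^ k) ,
          solve 2 (λ Q y → (con (+ 1) :+ (:- con (+ 1)) :* (Q :* y)) :* (con (+ 0) :+ ((:- Q) :* con (+ 0) :+ (:- con (+ 1)) :* (:- Q) :* y)) :+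
            (con (+ 0) :+ ((:- con (+ 1)) :* con (+ 0) :+ con (+ 1) :* (:- con (+ 1)) :* (Q :* y))) :* (con (+ 1) :+ (:- Q) :* y) := con (+ 0)) refl Q (Q ^ k)
      total : (A 0 ε.* a) ε.* b ε.* const e ε.≈ (0# , - (e * e * e))
      total = ε.trans (ε.*-congʳ {const e} (ε.trans (ε.*-assoc (A 0) a b) (ε.*-congˡ {A 0} ab)))
        ( solve 1 (λ e → (con (+ 1) :+ (:- con (+ 1)) :* con (+ 1)) :* (e :* e) :* e := con (+ 0)) refl e
        , solve 1 (λ e → ((con (+ 1) :+ (:- con (+ 1)) :* con (+ 1)) :* (e :* e)) :* con (+ 0) :+
            ((con (+ 1) :+ (:- con (+ 1)) :* con (+ 1)) :* con (+ 0) :+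
             (con (+ 0) :+ ((:- con (+ 1)) :* con (+ 0) :+ con (+ 1) :* (:- con (+ 1)) :* con (+ 1))) :* (e :* e)) :* e
            := :- (e :* e :* e)) refl e )
      moments : ε.HasSum (ε.theta α β) (0# , - (e * e * e))
      moments = ε.JacobiTripleProduct.tripleProduct α β (ε.nil-cong (ε.sym αβ) (const-nil nil))
        (ε.hp-cong factor total (ε.hp-* (ε.hp-* (ε.hp-suc {A} PA) PB) (const-HasProd E)))
        where
        N̂^ : ∀ k → const (Q ^ k) ε.≈ (α ε.* β) ε.^ k
        N̂^ k = ε.sym (ε.trans (ε.^-congˡ k αβ) (const-^ Q k))
        factor : ∀ k → A k ε.* B k ε.* const (1# - Q ^ suc k) ε.≈
          (ε.1# ε.+ α ε.* (α ε.* β) ε.^ k) ε.* (ε.1# ε.+ β ε.* (α ε.* β) ε.^ k) ε.* (ε.1# ε.- (α ε.* β) ε.^ suc k)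
        factor k = ε.*-cong (ε.*-cong (ε.+-congˡ {ε.1#} (ε.*-congˡ {α} (N̂^ k))) (ε.+-congˡ {ε.1#} (ε.*-congˡ {β} (N̂^ k))))
          (ε.trans (refl , solve 0 (con (+ 0) := con (+ 0) :+ :- con (+ 0)) refl) (ε.+-congˡ {ε.1#} (ε.-‿cong (N̂^ (suc k)))))

    zeroth : HasSum (theta (- 1#) (- Q)) 0#
    zeroth = hs-cong (λ n → proj₁ (theta-twist (- 1#) (- Q) n)) refl (fst-HasSum moments)

    first : HasSum (λ n → ⟦ n ⟧ * theta (- 1#) (- Q) n) (- (e * e * e))
    first = hs-cong (λ n → proj₂ (theta-twist (- 1#) (- Q) n)) refl (snd-HasSum moments)

  neg-^ : ∀ x k → (- x) ^ k ≈ ⟦ sgn k ⟧ * x ^ k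
  neg-^ x zero = sym (*-identityˡ 1#)
  neg-^ x (suc k) = begin
    - x * (- x) ^ k ≈⟨ *-congˡ (neg-^ x k) ⟩
    - x * (⟦ sgn k ⟧ * x ^ k) ≈⟨ solve 3 (λ x s y → :- x :* (s :* y) := (:- s) :* (x :* y)) refl x ⟦ sgn k ⟧ (x ^ k) ⟩
    (- ⟦ sgn k ⟧) * (x * x ^ k) ≈⟨ *-congʳ (-‿homo (sgn k)) ⟨
    ⟦ sgn (suc k) ⟧ * x ^ suc k ∎

  ⟦⟧-cong : ∀ {a b} → a ≡ b → ⟦ a ⟧ ≈ ⟦ b ⟧
  ⟦⟧-cong e = reflexive (≡.cong ⟦_⟧ e)

  theta-alternating : ∀ Q n → theta (- 1#) (- Q) n ≈ ⟦ sgn (sq n) ⟧ * Q ^ T n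
  theta-alternating Q n = half n
    where
    N≈ : ∀ k → (- 1# * - Q) ^ k ≈ Q ^ k
    N≈ k = ^-congˡ k (solve 1 (λ Q → (:- con (+ 1)) :* (:- Q) := Q) refl Q)
    1^ : ∀ k → 1# ^ k ≈ 1#
    1^ zero = refl
    1^ (suc k) = trans (*-identityˡ _) (1^ k)
    sgn-sq : ∀ k → sgn (2 ℕ.* tri k ℕ.+ 1 ℕ.* k) ≡ sgn k
    sgn-sq k = ≡.trans (≡.cong sgn (≡.trans (ℕ.+-comm (2 ℕ.* tri k) (1 ℕ.* k)) (≡.cong (ℕ._+ 2 ℕ.* tri k) (ℕ.*-identityˡ k)))) (sgn-2* (tri k) k)
    half : ∀ n → theta (- 1#) (- Q) n ≈ ⟦ sgn (sq n) ⟧ * Q ^ T n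
    half (+ k) = begin
      (- 1# * - Q) ^ tri k * (- 1#) ^ k ≈⟨ *-cong (N≈ (tri k)) (trans (neg-^ 1# k) (trans (*-congˡ (1^ k)) (*-identityʳ _))) ⟩
      Q ^ tri k * ⟦ sgn k ⟧ ≈⟨ *-comm _ _ ⟩
      ⟦ sgn k ⟧ * Q ^ tri k
        ≈⟨ *-cong (⟦⟧-cong (≡.sym (sgn-sq k))) (^-congʳ Q (≡.sym (≡.trans (ℕ.+-identityʳ _) (ℕ.*-identityˡ (tri k))))) ⟩
      ⟦ sgn (sq (+ k)) ⟧ * Q ^ T (+ k) ∎
    half -[1+ k ] = begin
      (- 1# * - Q) ^ tri (suc k) * (- Q) ^ suc k ≈⟨ *-cong (N≈ (tri (suc k))) (neg-^ Q (suc k)) ⟩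
      Q ^ tri (suc k) * (⟦ sgn (suc k) ⟧ * Q ^ suc k) ≈⟨ solve 3 (λ a s b → a :* (s :* b) := s :* (a :* b)) refl _ _ _ ⟩
      ⟦ sgn (suc k) ⟧ * (Q ^ tri (suc k) * Q ^ suc k)
        ≈⟨ *-cong (⟦⟧-cong (≡.sym (sgn-sq (suc k)))) (trans (sym (^-homo-* Q (tri (suc k)) (suc k)))
             (^-congʳ Q (≡.sym (≡.cong₂ ℕ._+_ (ℕ.*-identityˡ (tri (suc k))) (ℕ.*-identityˡ (suc k)))))) ⟩
      ⟦ sgn (sq -[1+ k ]) ⟧ * Q ^ T -[1+ k ] ∎

  -- sgn (sq n) is (-1)^n, because n² ≡ n (mod 2).
  jacobi-cube : ∀ {Q e} → Nil Q → Euler Q e → HasSum (λ n → ⟦ (+ 2 ℤ.* n ℤ.- + 1) ℤ.* sgn (sq n) ⟧ * Q ^ T n) (⟦ + 2 ⟧ * (- (e * e * e)))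
  jacobi-cube {Q} {e} nil E = hs-cong terms (trans (+-congˡ (trans (*-congˡ refl) (zeroʳ _))) (+-identityʳ _))
    -- Twice the first moment minus the vanishing zeroth one replaces the weight n by 2n - 1. Under
    -- n ↦ 1 - n the weight and the sign both change sign, so each term of Jacobi's series occurs
    -- twice, whence the factor 2.
    (hs-∙ ℤ._≟_ (hs-*ˡ ⟦ + 2 ⟧ (AlternatingMoments.first nil E)) (hs-*ˡ (- 1#) (AlternatingMoments.zeroth nil E)))
    where
    terms : ∀ n → ⟦ + 2 ⟧ * (⟦ n ⟧ * theta (- 1#) (- Q) n) + - 1# * theta (- 1#) (- Q) n ≈ ⟦ (+ 2 ℤ.* n ℤ.- + 1) ℤ.* sgn (sq n) ⟧ * Q ^ T n
    terms n = begin
      ⟦ + 2 ⟧ * (⟦ n ⟧ * t) + - 1# * t ≈⟨ solve 2 (λ n t → con (+ 2) :* (n :* t) :+ (:- con (+ 1)) :* t := (con (+ 2) :* n :- con (+ 1)) :* t) refl ⟦ n ⟧ t ⟩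
      (⟦ + 2 ⟧ * ⟦ n ⟧ - 1#) * t ≈⟨ *-cong (sym (trans (+-homo (+ 2 ℤ.* n) (ℤ.- + 1)) (+-cong (*-homo (+ 2) n) (-‿homo (+ 1))))) (theta-alternating Q n) ⟩
      ⟦ + 2 ℤ.* n ℤ.- + 1 ⟧ * (⟦ sgn (sq n) ⟧ * Q ^ T n) ≈⟨ *-assoc _ _ _ ⟨
      ⟦ + 2 ℤ.* n ℤ.- + 1 ⟧ * ⟦ sgn (sq n) ⟧ * Q ^ T n ≈⟨ *-congʳ (*-homo (+ 2 ℤ.* n ℤ.- + 1) (sgn (sq n))) ⟨
      ⟦ (+ 2 ℤ.* n ℤ.- + 1) ℤ.* sgn (sq n) ⟧ * Q ^ T n ∎
      where t = theta (- 1#) (- Q) n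

-- Legendre's theorem on four triangular numbers.

module FourTriangular (R : CommutativeRing 0ℓ 0ℓ) (ι : ℤ⟶ R) where
  open NilpotentRing R ι
  open ThetaIdentities R ι
  open EulerProducts R ι
  open LatticeIdentities R ι using (hs-shear)
  open DualNumbers R ι
  open Legendre R ι
  private module εTheta = ThetaIdentities R[ε] ι[ε]

  ⟦⟧-merge : ∀ a b x y → (⟦ a ⟧ * x) * (⟦ b ⟧ * y) ≈ ⟦ a ℤ.* b ⟧ * (x * y)
  ⟦⟧-merge a b x y = trans (solve 4 (λ a b x y → (a :* x) :* (b :* y) := (a :* b) :* (x :* y)) refl ⟦ a ⟧ ⟦ b ⟧ x y)
    (*-congʳ (sym (*-homo a b)))

  -- The logarithmic derivative of a quotient of products is the sum of those of its factors; here
  -- F′/F - G′/G is multiplied through by FG, so nothing has to be inverted.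
  wronskian : ∀ (F G : ℕ → Carrier × Carrier) (o : ℕ → Carrier) →
    (∀ k → proj₂ (F k) * proj₁ (G k) - proj₁ (F k) * proj₂ (G k) ≈ proj₁ (F k) * proj₁ (G k) * o k) →
    ∀ n → proj₂ (ε.rng F n) * proj₁ (ε.rng G n) - proj₁ (ε.rng F n) * proj₂ (ε.rng G n)
      ≈ proj₁ (ε.rng F n) * proj₁ (ε.rng G n) * sum< o n
  wronskian F G o w zero = solve 0 (con (+ 0) :* con (+ 1) :- con (+ 1) :* con (+ 0) := con (+ 1) :* con (+ 1) :* con (+ 0)) refl
  wronskian F G o w (suc n) = begin
    (a * d + b * c) * (a′ * c′) - a * c * (a′ * d′ + b′ * c′)
      ≈⟨ solve 8 (λ a b c d a′ b′ c′ d′ → (a :* d :+ b :* c) :* (a′ :* c′) :- a :* c :* (a′ :* d′ :+ b′ :* c′) :=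
           (b :* a′ :- a :* b′) :* (c :* c′) :+ (d :* c′ :- c :* d′) :* (a :* a′)) refl a b c d a′ b′ c′ d′ ⟩
    (b * a′ - a * b′) * (c * c′) + (d * c′ - c * d′) * (a * a′) ≈⟨ +-cong (*-congʳ (wronskian F G o w n)) (*-congʳ (w n)) ⟩
    (a * a′ * s) * (c * c′) + (c * c′ * o n) * (a * a′)
      ≈⟨ solve 6 (λ a c a′ c′ s o → (a :* a′ :* s) :* (c :* c′) :+ (c :* c′ :* o) :* (a :* a′) := a :* c :* (a′ :* c′) :* (s :+ o)) refl a c a′ c′ s (o n) ⟩
    a * c * (a′ * c′) * (s + o n) ∎
    where
    a = proj₁ (ε.rng F n)
    b = proj₂ (ε.rng F n)
    c = proj₁ (F n)
    d = proj₂ (F n)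
    a′ = proj₁ (ε.rng G n)
    b′ = proj₂ (ε.rng G n)
    c′ = proj₁ (G n)
    d′ = proj₂ (G n)
    s = sum< o n

  theta-same : ∀ y n → theta y y n ≈ y ^ sq n
  theta-same y n = half n
    where
    tri⁺-same : ∀ k → tri⁺ (y * y) y k ≈ y ^ (2 ℕ.* tri k ℕ.+ 1 ℕ.* k)
    tri⁺-same k = trans (*-cong (trans (^-congˡ (tri k) (*-congˡ (sym (*-identityʳ y)))) (^-assocʳ y 2 (tri k))) (^-congʳ y (≡.sym (ℕ.*-identityˡ k))))
      (sym (^-homo-* y (2 ℕ.* tri k) (1 ℕ.* k)))
    half : ∀ n → theta y y n ≈ y ^ sq n
    half (+ k) = tri⁺-same k
    half -[1+ k ] = tri⁺-same (suc k)

  module Fixed {q : Carrier} (nil : Nil q) where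
    private
      K = proj₁ nil

      -- The triple product factors of φ(x) = f(x, x). They are evaluated at x(1 + ε) for x = q and
      -- x = -q, so `Φ′` and `Ψ′` are sums of m² x^(m²), that is, derivatives under x·d/dx.
      G : Carrier × Carrier → ℕ → Carrier × Carrier
      G x k = (ε.1# ε.+ x ε.^ suc (k ℕ.* 2)) ε.* (ε.1# ε.+ x ε.^ suc (k ℕ.* 2)) ε.* (ε.1# ε.- x ε.^ (suc k ℕ.* 2))

      G-HasProd : ∀ {x} (n : Nil x) → ε.HasProd (G (twist 1# x)) (ε.rng (G (twist 1# x)) (proj₁ n))
      G-HasProd {x} n = ε.hasProd (proj₁ n) beyond ε.refl
        where
        x̂ = twist 1# x
        k≤ : ∀ c k → k ℕ.≤ c ℕ.+ k ℕ.* 2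
        k≤ c k = ℕ.≤-trans (ℕ.m≤m*n k 2) (ℕ.m≤n+m _ c)
        vanish : ∀ c k → proj₁ n ℕ.≤ k → x̂ ε.^ (c ℕ.+ k ℕ.* 2) ε.≈ ε.0#
        vanish c k K≤k = ε.nil-≤ (twist-nil 1# n) (ℕ.≤-trans K≤k (k≤ c k))
        one : ∀ k → proj₁ n ℕ.≤ k → ε.1# ε.+ x̂ ε.^ suc (k ℕ.* 2) ε.≈ ε.1#
        one k K≤k = ε.trans (ε.+-congˡ {ε.1#} (vanish 1 k K≤k)) (ε.+-identityʳ ε.1#)
        beyond : ∀ k → proj₁ n ℕ.≤ k → G x̂ k ε.≈ ε.1#
        beyond k K≤k = ε.trans (ε.*-cong (ε.trans (ε.*-cong (one k K≤k) (one k K≤k)) (ε.*-identityˡ ε.1#)) (ε.1-0 (vanish 2 k K≤k))) (ε.*-identityˡ ε.1#)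

      G-HasSum : ∀ {x} (n : Nil x) → ε.HasSum (λ m → twist 1# x ε.^ sq m) (ε.rng (G (twist 1# x)) (proj₁ n))
      G-HasSum {x} n = εTheta.theta-product (twist 1# x) 1 1 (ε.nil-suc 1 (twist-nil 1# n)) (G-HasProd n)

      nil⁻ = nil-neg nil
      Φ̂ = ε.rng (G (twist 1# q)) K
      Ψ̂ = ε.rng (G (twist 1# (- q))) K
      Φ Φ′ Ψ Ψ′ : Carrier
      Φ = proj₁ Φ̂
      Φ′ = proj₂ Φ̂
      Ψ = proj₁ Ψ̂
      Ψ′ = proj₂ Ψ̂

      values : ∀ {x} (n : Nil x) → HasSum (λ m → x ^ sq m) (proj₁ (ε.rng (G (twist 1# x)) (proj₁ n)))
      values {x} n = hs-cong (λ m → proj₁ (twist-^ 1# x (sq m))) refl (fst-HasSum (G-HasSum n))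

      derivatives : ∀ {x} (n : Nil x) → HasSum (λ m → ⟦ m ℤ.* m ⟧ * x ^ sq m) (proj₂ (ε.rng (G (twist 1# x)) (proj₁ n)))
      derivatives {x} n = hs-cong (λ m → trans (proj₂ (twist-^ 1# x (sq m))) (*-cong (⟦⟧-cong (+sq m)) (*-identityˡ _))) refl (snd-HasSum (G-HasSum n))

    term : ℤ × ℤ → Carrier
    term (m , n) = ⟦ (m ℤ.* m ℤ.- n ℤ.* n) ℤ.* sgn (sq n) ⟧ * q ^ (sq m ℕ.+ sq n)

    term-HasSum : HasSum term (Φ′ * Ψ - Φ * Ψ′)
    term-HasSum = hs-cong terms refl
      (hs-∙ _≟²_ (hs-× ℤ._≟_ (derivatives nil) (values nil⁻)) (hs-neg (hs-× ℤ._≟_ (values nil) (derivatives nil⁻))))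
      where
      terms : ∀ ((m , n) : ℤ × ℤ) → ⟦ m ℤ.* m ⟧ * q ^ sq m * (- q) ^ sq n - q ^ sq m * (⟦ n ℤ.* n ⟧ * (- q) ^ sq n) ≈ term (m , n)
      terms (m , n) = begin
        ⟦ m ℤ.* m ⟧ * q ^ sq m * (- q) ^ sq n - q ^ sq m * (⟦ n ℤ.* n ⟧ * (- q) ^ sq n)
          ≈⟨ solve 4 (λ a b x y → a :* x :* y :- x :* (b :* y) := (a :- b) :* x :* y) refl ⟦ m ℤ.* m ⟧ ⟦ n ℤ.* n ⟧ (q ^ sq m) ((- q) ^ sq n) ⟩
        (⟦ m ℤ.* m ⟧ - ⟦ n ℤ.* n ⟧) * q ^ sq m * (- q) ^ sq n
          ≈⟨ *-cong (*-congʳ (sym (trans (+-homo (m ℤ.* m) (ℤ.- (n ℤ.* n))) (+-congˡ (-‿homo (n ℤ.* n)))))) (neg-^ q (sq n)) ⟩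
        ⟦ m ℤ.* m ℤ.- n ℤ.* n ⟧ * q ^ sq m * (⟦ sgn (sq n) ⟧ * q ^ sq n) ≈⟨ ⟦⟧-merge (m ℤ.* m ℤ.- n ℤ.* n) (sgn (sq n)) _ _ ⟩
        ⟦ (m ℤ.* m ℤ.- n ℤ.* n) ℤ.* sgn (sq n) ⟧ * (q ^ sq m * q ^ sq n) ≈⟨ *-congˡ (^-homo-* q (sq m) (sq n)) ⟨
        term (m , n) ∎

    -- The sum over m ≡ n (mod 2) factors through a sum of an odd function; the one over m ≢ n is the square of Jacobi's series.
    cosets : ∀ {e₄} → Euler (q ^ 4) e₄ → Φ′ * Ψ - Φ * Ψ′ ≈ ⟦ + 4 ⟧ * (q * (e₄ * e₄ * e₄ * (e₄ * e₄ * e₄)))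
    cosets {e₄} E₄ = trans (hs-unique _≟²_ term-HasSum (hs-cosets 2 (+ 1) s slices))
      (solve 2 (λ q e → con (+ 4) :* (con (+ 0) :* con (+ 0)) :+ (q :* ((con (+ 2) :* (:- (e :* e :* e))) :* (con (+ 2) :* (:- (e :* e :* e)))) :+ con (+ 0)) :=
        con (+ 4) :* (q :* (e :* e :* e :* (e :* e :* e)))) refl q e₄)
      where
      W = ⟦ + 2 ⟧ * (- (e₄ * e₄ * e₄))
      s : Fin 2 → Carrier
      s fzero = ⟦ + 4 ⟧ * (0# * 0#)
      s (fsuc fzero) = q * (W * W)
      w : ℤ → ℤ
      w n = (+ 2 ℤ.* n ℤ.- + 1) ℤ.* sgn (sq n)
      even : HasSum (λ n → ⟦ n ℤ.* sgn (sq n) ⟧ * q ^ (2 ℕ.* sq n)) 0#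
      even = hs-cong terms refl (first-moment-0 (nil-neg (nil-suc 1 nil)))
        where
        terms : ∀ n → ⟦ n ⟧ * theta (- (q ^ 2)) (- (q ^ 2)) n ≈ ⟦ n ℤ.* sgn (sq n) ⟧ * q ^ (2 ℕ.* sq n)
        terms n = begin
          ⟦ n ⟧ * theta (- (q ^ 2)) (- (q ^ 2)) n ≈⟨ *-congˡ (trans (theta-same (- (q ^ 2)) n) (neg-^ (q ^ 2) (sq n))) ⟩
          ⟦ n ⟧ * (⟦ sgn (sq n) ⟧ * (q ^ 2) ^ sq n) ≈⟨ *-assoc _ _ _ ⟨
          ⟦ n ⟧ * ⟦ sgn (sq n) ⟧ * (q ^ 2) ^ sq n ≈⟨ *-cong (sym (*-homo n (sgn (sq n)))) (^-assocʳ q 2 (sq n)) ⟩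
          ⟦ n ℤ.* sgn (sq n) ⟧ * q ^ (2 ℕ.* sq n) ∎
      odd : HasSum (λ n → ⟦ w n ⟧ * q ^ (4 ℕ.* T n)) W
      odd = hs-cong (λ n → *-congˡ (^-assocʳ q 4 (T n))) refl (jacobi-cube (nil-suc 3 nil) E₄)
      sgn-sq-- : ∀ p q → sgn (sq (+ 1 ℤ.* q ℤ.+ -[1+ 0 ] ℤ.* p ℤ.+ + 0)) ≡ sgn (sq p) ℤ.* sgn (sq q)
      sgn-sq-- p q = ≡.trans (sgn-cong (ℤ.- (p ℤ.* q)) (≡.trans (+sq n) (≡.trans (lem p q)
          (≡.cong (λ z → z ℤ.+ + 2 ℤ.* (ℤ.- (p ℤ.* q))) (≡.trans (≡.cong₂ ℤ._+_ (≡.sym (+sq p)) (≡.sym (+sq q))) (≡.sym (ℤ.pos-+ (sq p) (sq q))))))))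
        (sgn-+ (sq p) (sq q))
        where
        n = + 1 ℤ.* q ℤ.+ -[1+ 0 ] ℤ.* p ℤ.+ + 0
        lem : ∀ p q → let n = + 1 ℤ.* q ℤ.+ -[1+ 0 ] ℤ.* p ℤ.+ + 0 in n ℤ.* n ≡ p ℤ.* p ℤ.+ q ℤ.* q ℤ.+ + 2 ℤ.* (ℤ.- (p ℤ.* q))
        lem p q = ℤS.solve 2 (λ p q → let n = ℤS.con (+ 1) ℤS.:* q ℤS.:+ ℤS.con -[1+ 0 ] ℤS.:* p ℤS.:+ ℤS.con (+ 0) in
          n ℤS.:* n ℤS.:= p ℤS.:* p ℤS.:+ q ℤS.:* q ℤS.:+ ℤS.con (+ 2) ℤS.:* (ℤS.:- (p ℤS.:* q))) ≡.refl p q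
      2*sq : ∀ n → + 2 ℤ.* + sq n ≡ + 2 ℤ.* (n ℤ.* n)
      2*sq n = ≡.cong (+ 2 ℤ.*_) (+sq n)
      slices : ∀ r → HasSum (λ (k , b) → term (+ toℕ r ℤ.+ + 2 ℤ.* k ℤ.+ + 1 ℤ.* b , b)) (s r)
      -- In these coordinates m = p + r and n = r - p, so m² - n² = 4pr, m² + n² = 2p² + 2r² and
      -- (-1)^n = (-1)^p (-1)^r. The double sum is 4 times the square of a vanishing first moment.
      slices fzero = hs-shear (+ 1) (+ 0) (+ 1) -[1+ 0 ] (+ 0) ≡.refl ≡.refl
        (hs-cong (λ (p , q) → terms p q) refl (hs-*ˡ ⟦ + 4 ⟧ (hs-× ℤ._≟_ even even)))
        where
        terms : ∀ p r → ⟦ + 4 ⟧ * (⟦ p ℤ.* sgn (sq p) ⟧ * q ^ (2 ℕ.* sq p) * (⟦ r ℤ.* sgn (sq r) ⟧ * q ^ (2 ℕ.* sq r))) ≈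
          term (+ 0 ℤ.+ + 2 ℤ.* (+ 1 ℤ.* p ℤ.+ + 0) ℤ.+ + 1 ℤ.* (+ 1 ℤ.* r ℤ.+ -[1+ 0 ] ℤ.* p ℤ.+ + 0) , + 1 ℤ.* r ℤ.+ -[1+ 0 ] ℤ.* p ℤ.+ + 0)
        terms p r = begin
          ⟦ + 4 ⟧ * (⟦ p ℤ.* sgn (sq p) ⟧ * q ^ (2 ℕ.* sq p) * (⟦ r ℤ.* sgn (sq r) ⟧ * q ^ (2 ℕ.* sq r)))
            ≈⟨ *-congˡ (⟦⟧-merge (p ℤ.* sgn (sq p)) (r ℤ.* sgn (sq r)) _ _) ⟩
          ⟦ + 4 ⟧ * (⟦ (p ℤ.* sgn (sq p)) ℤ.* (r ℤ.* sgn (sq r)) ⟧ * (q ^ (2 ℕ.* sq p) * q ^ (2 ℕ.* sq r)))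
            ≈⟨ trans (sym (*-assoc _ _ _)) (*-cong (sym (*-homo (+ 4) ((p ℤ.* sgn (sq p)) ℤ.* (r ℤ.* sgn (sq r))))) (sym (^-homo-* q (2 ℕ.* sq p) (2 ℕ.* sq r)))) ⟩
          ⟦ + 4 ℤ.* ((p ℤ.* sgn (sq p)) ℤ.* (r ℤ.* sgn (sq r))) ⟧ * q ^ (2 ℕ.* sq p ℕ.+ 2 ℕ.* sq r)
            ≈⟨ *-cong (⟦⟧-cong coefficient) (^-congʳ q exponent) ⟩
          term (m , n) ∎
          where
          n = + 1 ℤ.* r ℤ.+ -[1+ 0 ] ℤ.* p ℤ.+ + 0
          m = + 0 ℤ.+ + 2 ℤ.* (+ 1 ℤ.* p ℤ.+ + 0) ℤ.+ + 1 ℤ.* n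
          coefficient : + 4 ℤ.* ((p ℤ.* sgn (sq p)) ℤ.* (r ℤ.* sgn (sq r))) ≡ (m ℤ.* m ℤ.- n ℤ.* n) ℤ.* sgn (sq n)
          coefficient = ≡.trans (ℤS.solve 4 (λ p r u v →
              let n = ℤS.con (+ 1) ℤS.:* r ℤS.:+ ℤS.con -[1+ 0 ] ℤS.:* p ℤS.:+ ℤS.con (+ 0)
                  m = ℤS.con (+ 0) ℤS.:+ ℤS.con (+ 2) ℤS.:* (ℤS.con (+ 1) ℤS.:* p ℤS.:+ ℤS.con (+ 0)) ℤS.:+ ℤS.con (+ 1) ℤS.:* n in
              ℤS.con (+ 4) ℤS.:* ((p ℤS.:* u) ℤS.:* (r ℤS.:* v)) ℤS.:= (m ℤS.:* m ℤS.:- n ℤS.:* n) ℤS.:* (u ℤS.:* v)) ≡.refl p r (sgn (sq p)) (sgn (sq r)))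
            (≡.cong ((m ℤ.* m ℤ.- n ℤ.* n) ℤ.*_) (≡.sym (sgn-sq-- p r)))
          exponent : 2 ℕ.* sq p ℕ.+ 2 ℕ.* sq r ≡ sq m ℕ.+ sq n
          exponent = halve-≡ {2 ℕ.* sq p ℕ.+ 2 ℕ.* sq r} {sq m ℕ.+ sq n}
            (2*-+ {2 ℕ.* sq p} {2 ℕ.* sq r} (2*-* 2 {sq p} (2*sq p)) (2*-* 2 {sq r} (2*sq r))) (2*-+ {sq m} {sq n} (2*sq m) (2*sq n))
            (ℤS.solve 2 (λ p r →
              let n = ℤS.con (+ 1) ℤS.:* r ℤS.:+ ℤS.con -[1+ 0 ] ℤS.:* p ℤS.:+ ℤS.con (+ 0)
                  m = ℤS.con (+ 0) ℤS.:+ ℤS.con (+ 2) ℤS.:* (ℤS.con (+ 1) ℤS.:* p ℤS.:+ ℤS.con (+ 0)) ℤS.:+ ℤS.con (+ 1) ℤS.:* n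
                  two = ℤS.con (+ 2) in
              two ℤS.:* (two ℤS.:* (p ℤS.:* p)) ℤS.:+ two ℤS.:* (two ℤS.:* (r ℤS.:* r)) ℤS.:= two ℤS.:* (m ℤS.:* m) ℤS.:+ two ℤS.:* (n ℤS.:* n)) ≡.refl p r)
      -- Here m = p + r - 1 and n = r - p, so m² - n² = (2p - 1)(2r - 1) and m² + n² = 1 + 4T(p) +
      -- 4T(r).
      slices (fsuc fzero) = hs-shear (+ 1) -[1+ 0 ] (+ 1) -[1+ 0 ] (+ 0) ≡.refl ≡.refl
        (hs-cong (λ (p , q) → terms p q) refl (hs-*ˡ q (hs-× ℤ._≟_ odd odd)))
        where
        terms : ∀ p r → q * (⟦ w p ⟧ * q ^ (4 ℕ.* T p) * (⟦ w r ⟧ * q ^ (4 ℕ.* T r))) ≈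
          term (+ 1 ℤ.+ + 2 ℤ.* (+ 1 ℤ.* p ℤ.+ -[1+ 0 ]) ℤ.+ + 1 ℤ.* (+ 1 ℤ.* r ℤ.+ -[1+ 0 ] ℤ.* p ℤ.+ + 0) , + 1 ℤ.* r ℤ.+ -[1+ 0 ] ℤ.* p ℤ.+ + 0)
        terms p r = begin
          q * (⟦ w p ⟧ * q ^ (4 ℕ.* T p) * (⟦ w r ⟧ * q ^ (4 ℕ.* T r))) ≈⟨ *-congˡ (⟦⟧-merge (w p) (w r) _ _) ⟩
          q * (⟦ w p ℤ.* w r ⟧ * (q ^ (4 ℕ.* T p) * q ^ (4 ℕ.* T r)))
            ≈⟨ solve 3 (λ q c x → q :* (c :* x) := c :* (q :* x)) refl q _ _ ⟩
          ⟦ w p ℤ.* w r ⟧ * (q * (q ^ (4 ℕ.* T p) * q ^ (4 ℕ.* T r))) ≈⟨ *-congˡ (*-congˡ (^-homo-* q (4 ℕ.* T p) (4 ℕ.* T r))) ⟨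
          ⟦ w p ℤ.* w r ⟧ * q ^ suc (4 ℕ.* T p ℕ.+ 4 ℕ.* T r) ≈⟨ *-cong (⟦⟧-cong coefficient) (^-congʳ q exponent) ⟩
          term (m , n) ∎
          where
          n = + 1 ℤ.* r ℤ.+ -[1+ 0 ] ℤ.* p ℤ.+ + 0
          m = + 1 ℤ.+ + 2 ℤ.* (+ 1 ℤ.* p ℤ.+ -[1+ 0 ]) ℤ.+ + 1 ℤ.* n
          coefficient : w p ℤ.* w r ≡ (m ℤ.* m ℤ.- n ℤ.* n) ℤ.* sgn (sq n)
          coefficient = ≡.trans (ℤS.solve 4 (λ p r u v →
              let n = ℤS.con (+ 1) ℤS.:* r ℤS.:+ ℤS.con -[1+ 0 ] ℤS.:* p ℤS.:+ ℤS.con (+ 0)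
                  m = ℤS.con (+ 1) ℤS.:+ ℤS.con (+ 2) ℤS.:* (ℤS.con (+ 1) ℤS.:* p ℤS.:+ ℤS.con -[1+ 0 ]) ℤS.:+ ℤS.con (+ 1) ℤS.:* n in
              ((ℤS.con (+ 2) ℤS.:* p ℤS.:- ℤS.con (+ 1)) ℤS.:* u) ℤS.:* ((ℤS.con (+ 2) ℤS.:* r ℤS.:- ℤS.con (+ 1)) ℤS.:* v)
                ℤS.:= (m ℤS.:* m ℤS.:- n ℤS.:* n) ℤS.:* (u ℤS.:* v)) ≡.refl p r (sgn (sq p)) (sgn (sq r)))
            (≡.cong ((m ℤ.* m ℤ.- n ℤ.* n) ℤ.*_) (≡.sym (sgn-sq-- p r)))
          exponent : suc (4 ℕ.* T p ℕ.+ 4 ℕ.* T r) ≡ sq m ℕ.+ sq n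
          exponent = halve-≡ {suc (4 ℕ.* T p ℕ.+ 4 ℕ.* T r)} {sq m ℕ.+ sq n}
            (2*-+ {1} {4 ℕ.* T p ℕ.+ 4 ℕ.* T r} ≡.refl (2*-+ {4 ℕ.* T p} {4 ℕ.* T r} (2*-* 4 {T p} (2*e 0 1 p)) (2*-* 4 {T r} (2*e 0 1 r)))) (2*-+ {sq m} {sq n} (2*sq m) (2*sq n))
            (ℤS.solve 2 (λ p r →
              let n = ℤS.con (+ 1) ℤS.:* r ℤS.:+ ℤS.con -[1+ 0 ] ℤS.:* p ℤS.:+ ℤS.con (+ 0)
                  m = ℤS.con (+ 1) ℤS.:+ ℤS.con (+ 2) ℤS.:* (ℤS.con (+ 1) ℤS.:* p ℤS.:+ ℤS.con -[1+ 0 ]) ℤS.:+ ℤS.con (+ 1) ℤS.:* n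
                  two = ℤS.con (+ 2)
                  four = ℤS.con (+ 4) in
              two ℤS.:+ (four ℤS.:* Qᵀ p ℤS.:+ four ℤS.:* Qᵀ r) ℤS.:= two ℤS.:* (m ℤS.:* m) ℤS.:+ two ℤS.:* (n ℤS.:* n)) ≡.refl p r)
            where
            Qᵀ : ∀ {n} → ℤS.Polynomial n → ℤS.Polynomial n
            Qᵀ n = ℤS.con (+ 0) ℤS.:* (n ℤS.:* (n ℤS.:+ ℤS.con (+ 1))) ℤS.:+ ℤS.con (+ 1) ℤS.:* (n ℤS.:* (n ℤS.:- ℤS.con (+ 1)))

    -- Factorisations into two odd numbers weighted by the first: collecting equal exponents yields
    -- σ(m)q^m over odd m.
    odd-divisor-term : ℕ × ℕ → Carrier
    odd-divisor-term (k , j) = ⟦ + suc (k ℕ.* 2) ⟧ * q ^ (suc (k ℕ.* 2) ℕ.* suc (j ℕ.* 2))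

    private
      o : ℕ → Carrier
      o k = let y = q ^ suc (k ℕ.* 2) in ⟦ + suc (k ℕ.* 2) ⟧ * (y * geo (y * y) K)

      power-0 : ∀ {n} → K ℕ.≤ n → q ^ n ≈ 0#
      power-0 = nil-≤ nil

      y²^ : ∀ i j → (q ^ i * q ^ i) ^ j ≈ q ^ (i ℕ.* (j ℕ.* 2))
      y²^ i j = begin
        (q ^ i * q ^ i) ^ j ≈⟨ ^-congˡ j (*-congˡ (*-identityʳ (q ^ i))) ⟨
        ((q ^ i) ^ 2) ^ j ≈⟨ ^^-block (q ^ i) 2 j ⟩
        (q ^ i) ^ (j ℕ.* 2) ≈⟨ ^-assocʳ q i (j ℕ.* 2) ⟩
        q ^ (i ℕ.* (j ℕ.* 2)) ∎

      y²^-0 : ∀ k j → K ℕ.≤ j → (q ^ suc (k ℕ.* 2) * q ^ suc (k ℕ.* 2)) ^ j ≈ 0#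
      y²^-0 k j K≤j = trans (y²^ (suc (k ℕ.* 2)) j)
        (power-0 (ℕ.≤-trans K≤j (ℕ.≤-trans (ℕ.m≤m*n j 2) (ℕ.m≤n*m (j ℕ.* 2) (suc (k ℕ.* 2))))))

      inner : ∀ k → HasSum (λ j → odd-divisor-term (k , j)) (o k)
      inner k = hs-*ˡ ⟦ + suc (k ℕ.* 2) ⟧ (hs-cong terms refl (hs-*ˡ (q ^ suc (k ℕ.* 2))
        (hasSum (upTo K) (Unique.upTo⁺ K) (λ j j∉ → y²^-0 k j (ℕ.≮⇒≥ (λ j<K → j∉ (∈-upTo⁺ j<K)))) (sym (sum<-Σl _ K)))))
        where
        i = suc (k ℕ.* 2)
        terms : ∀ j → q ^ i * (q ^ i * q ^ i) ^ j ≈ q ^ (i ℕ.* suc (j ℕ.* 2))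
        terms j = begin
          q ^ i * (q ^ i * q ^ i) ^ j ≈⟨ *-congˡ (y²^ i j) ⟩
          q ^ i * q ^ (i ℕ.* (j ℕ.* 2)) ≈⟨ ^-homo-* q i (i ℕ.* (j ℕ.* 2)) ⟨
          q ^ (i ℕ.+ i ℕ.* (j ℕ.* 2)) ≈⟨ ^-congʳ q (≡.sym (ℕ.*-suc i (j ℕ.* 2))) ⟩
          q ^ (i ℕ.* suc (j ℕ.* 2)) ∎

    odd-divisor-sum : Carrier
    odd-divisor-sum = Σl o (upTo K)

    odd-divisor-HasSum : HasSum odd-divisor-term odd-divisor-sum
    odd-divisor-HasSum = hs-Σ ℕ._≟_ odd-divisor-term o (upTo K) (Unique.upTo⁺ K)
      (λ k k∉ j → trans (*-congˡ (power-0 (ℕ.≤-trans (ℕ.≮⇒≥ (λ k<K → k∉ (∈-upTo⁺ k<K)))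
        (ℕ.≤-trans (ℕ.m≤m*n k 2) (ℕ.≤-trans (ℕ.n≤1+n _) (ℕ.m≤m*n (suc (k ℕ.* 2)) (suc (j ℕ.* 2)))))))) (zeroʳ _)) inner

    -- With y = q^c for odd c, the quotient φ(q)/φ(-q) is the product of ((1 + y)/(1 - y))². The
    -- logarithmic derivative of one factor is 4cy/(1 - y²) = 4c(y + y³ + y⁵ + ...), a sum over odd
    -- multiples of c.
    lambert : Φ′ * Ψ - Φ * Ψ′ ≈ Φ * Ψ * (⟦ + 4 ⟧ * odd-divisor-sum)
    lambert = trans (wronskian (G (twist 1# q)) (G (twist 1# (- q))) (λ k → ⟦ + 4 ⟧ * o k) factor K)
      (*-congˡ (trans (sum<-Σl _ K) (Σl-*ˡ ⟦ + 4 ⟧ o (upTo K))))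
      where
      -- The value at (1 + y)²(1 - z) with z common to both sides, so that only the logarithmic derivative of (1 + y)/(1 - y) survives.
      G′ : Carrier → Carrier → Carrier → Carrier → Carrier × Carrier
      G′ c c′ y z = (ε.1# ε.+ (y , c * (1# * y))) ε.* (ε.1# ε.+ (y , c * (1# * y))) ε.* (ε.1# ε.- (z , c′ * (1# * z)))
      G≈ : ∀ x k {y z} → x ^ suc (k ℕ.* 2) ≈ y → x ^ (suc k ℕ.* 2) ≈ z → G (twist 1# x) k ε.≈ G′ ⟦ + suc (k ℕ.* 2) ⟧ ⟦ + (suc k ℕ.* 2) ⟧ y z
      G≈ x k {y} {z} e₁ e₂ = ε.*-cong (ε.*-cong one one) (ε.+-congˡ {ε.1#} (ε.-‿cong (power (suc k ℕ.* 2) e₂)))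
        where
        power : ∀ n {y} → x ^ n ≈ y → twist 1# x ε.^ n ε.≈ (y , ⟦ + n ⟧ * (1# * y))
        power n e = ε.trans (twist-^ 1# x n) (e , *-congˡ (*-congˡ e))
        one = ε.+-congˡ {ε.1#} (power (suc (k ℕ.* 2)) e₁)
      factor : ∀ k → proj₂ (G (twist 1# q) k) * proj₁ (G (twist 1# (- q)) k) - proj₁ (G (twist 1# q) k) * proj₂ (G (twist 1# (- q)) k)
        ≈ proj₁ (G (twist 1# q) k) * proj₁ (G (twist 1# (- q)) k) * (⟦ + 4 ⟧ * o k)
      factor k = begin
        proj₂ (G (twist 1# q) k) * proj₁ (G (twist 1# (- q)) k) - proj₁ (G (twist 1# q) k) * proj₂ (G (twist 1# (- q)) k)
          ≈⟨ +-cong (*-cong (proj₂ g⁺) (proj₁ g⁻)) (-‿cong (*-cong (proj₁ g⁺) (proj₂ g⁻))) ⟩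
        proj₂ (G′ c c′ y z) * proj₁ (G′ c c′ (- y) z) - proj₁ (G′ c c′ y z) * proj₂ (G′ c c′ (- y) z)
          ≈⟨ solve 4 (λ c c′ y z →
               let one = con (+ 1)
                   f = one :+ y
                   f′ = con (+ 0) :+ c :* (one :* y)
                   g = one :+ :- y
                   g′ = con (+ 0) :+ c :* (one :* (:- y))
                   h = one :- z
                   h′ = con (+ 0) :+ :- (c′ :* (one :* z)) in
               ((f :* f) :* h′ :+ (f :* f′ :+ f′ :* f) :* h) :* (g :* g :* h) :- (f :* f :* h) :* ((g :* g) :* h′ :+ (g :* g′ :+ g′ :* g) :* h)
               := con (+ 4) :* c :* y :* (one :- y :* y) :* (h :* h)) refl c c′ y z ⟩
        ⟦ + 4 ⟧ * c * y * (1# - y * y) * ((1# - z) * (1# - z)) ≈⟨ *-identityʳ _ ⟨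
        ⟦ + 4 ⟧ * c * y * (1# - y * y) * ((1# - z) * (1# - z)) * 1# ≈⟨ *-congˡ (trans (geo-* (y * y) K) (1-0 (y²^-0 k K ℕ.≤-refl))) ⟨
        ⟦ + 4 ⟧ * c * y * (1# - y * y) * ((1# - z) * (1# - z)) * ((1# - y * y) * geo (y * y) K)
          ≈⟨ solve 4 (λ c y z g → let one = con (+ 1) in
               con (+ 4) :* c :* y :* (one :- y :* y) :* ((one :- z) :* (one :- z)) :* ((one :- y :* y) :* g) :=
               ((one :+ y) :* (one :+ y) :* (one :- z)) :* ((one :+ :- y) :* (one :+ :- y) :* (one :- z)) :* (con (+ 4) :* (c :* (y :* g))))
               refl c y z (geo (y * y) K) ⟩
        proj₁ (G′ c c′ y z) * proj₁ (G′ c c′ (- y) z) * (⟦ + 4 ⟧ * o k) ≈⟨ *-congʳ (*-cong (proj₁ g⁺) (proj₁ g⁻)) ⟨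
        proj₁ (G (twist 1# q) k) * proj₁ (G (twist 1# (- q)) k) * (⟦ + 4 ⟧ * o k) ∎
        where
        c = ⟦ + suc (k ℕ.* 2) ⟧
        c′ = ⟦ + (suc k ℕ.* 2) ⟧
        y = q ^ suc (k ℕ.* 2)
        z = q ^ (suc k ℕ.* 2)
        g⁺ = G≈ q k refl refl
        g⁻ = G≈ (- q) k (neg-odd q k) (neg-even q (suc k))

    -- This is φ(q)φ(-q) = φ(-q²)²: the factors with odd exponent combine by (1 + y)(1 - y) = 1 - y²
    -- into those at q², and the remaining ones are the factors of E₂, twice.
    Φ*Ψ : ∀ {e₂ e₄} → Euler (q ^ 2) e₂ → Euler ((q ^ 2) ^ 2) e₄ → Φ * Ψ * (e₄ * e₄) ≈ e₂ * e₂ * (e₂ * e₂)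
    Φ*Ψ {e₂} {e₄} E₂ E₄ = begin
      Φ * Ψ * (e₄ * e₄) ≈⟨ *-congʳ (hp-unique (hp-* (fst-HasProd (G-HasProd nil)) (fst-HasProd (G-HasProd nil⁻)))
                              (hp-cong factor refl (hp-* (hp-* odd E₂) (hp-* odd E₂)))) ⟩
      o₂ * e₂ * (o₂ * e₂) * (e₄ * e₄) ≈⟨ solve 3 (λ o a b → o :* a :* (o :* a) :* (b :* b) := (o :* b) :* (o :* b) :* (a :* a)) refl o₂ e₂ e₄ ⟩
      o₂ * e₄ * (o₂ * e₄) * (e₂ * e₂) ≈⟨ *-congʳ (*-cong o₂*e₄ o₂*e₄) ⟩
      e₂ * e₂ * (e₂ * e₂) ∎
      where
      P = odd-part (nil-suc 1 nil) E₂ E₄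
      o₂ = proj₁ P
      odd = proj₁ (proj₂ P)
      o₂*e₄ = proj₂ (proj₂ P)
      factor : ∀ k → (1# - (q ^ 2) ^ suc (k ℕ.* 2)) * (1# - (q ^ 2) ^ suc k) * ((1# - (q ^ 2) ^ suc (k ℕ.* 2)) * (1# - (q ^ 2) ^ suc k)) ≈
        proj₁ (G (twist 1# q) k) * proj₁ (G (twist 1# (- q)) k)
      factor k = begin
        (1# - (q ^ 2) ^ suc (k ℕ.* 2)) * (1# - (q ^ 2) ^ suc k) * ((1# - (q ^ 2) ^ suc (k ℕ.* 2)) * (1# - (q ^ 2) ^ suc k))
          ≈⟨ *-cong pair pair ⟩
        (1# - y * y) * (1# - z) * ((1# - y * y) * (1# - z))
          ≈⟨ solve 2 (λ y z → let one = con (+ 1) in (one :- y :* y) :* (one :- z) :* ((one :- y :* y) :* (one :- z)) :=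
               (one :+ y) :* (one :+ y) :* (one :- z) :* ((one :+ :- y) :* (one :+ :- y) :* (one :- z))) refl y z ⟩
        (1# + y) * (1# + y) * (1# - z) * ((1# + - y) * (1# + - y) * (1# - z))
          ≈⟨ *-cong (*-cong (*-cong (+-congˡ y⁺) (+-congˡ y⁺)) (+-congˡ (-‿cong z⁺))) (*-cong (*-cong (+-congˡ y⁻) (+-congˡ y⁻)) (+-congˡ (-‿cong z⁻))) ⟨
        proj₁ (G (twist 1# q) k) * proj₁ (G (twist 1# (- q)) k) ∎
        where
        y = q ^ suc (k ℕ.* 2)
        z = q ^ (suc k ℕ.* 2)
        y⁺ = proj₁ (twist-^ 1# q (suc (k ℕ.* 2)))
        z⁺ = proj₁ (twist-^ 1# q (suc k ℕ.* 2))
        y⁻ = trans (proj₁ (twist-^ 1# (- q) (suc (k ℕ.* 2)))) (neg-odd q k)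
        z⁻ = trans (proj₁ (twist-^ 1# (- q) (suc k ℕ.* 2))) (neg-even q (suc k))
        Y : (q ^ 2) ^ suc (k ℕ.* 2) ≈ y * y
        Y = trans (^-assocʳ q 2 (suc (k ℕ.* 2))) (trans (^-congʳ q (≡.cong (λ a → suc (k ℕ.* 2) ℕ.+ a) (ℕ.+-identityʳ (suc (k ℕ.* 2))))) (^-homo-* q (suc (k ℕ.* 2)) (suc (k ℕ.* 2))))
        pair : (1# - (q ^ 2) ^ suc (k ℕ.* 2)) * (1# - (q ^ 2) ^ suc k) ≈ (1# - y * y) * (1# - z)
        pair = *-cong (+-congˡ (-‿cong Y)) (+-congˡ (-‿cong (^^-block q 2 (suc k))))

    -- Comparing `cosets` with `lambert` gives 4qE₄⁶ = 4S·E₂⁴/E₄², hence 4S = 4qE₄⁸/E₂⁴ = 4qψ(q²)⁴.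
    -- As θ = 2ψ(q²), a further factor 16 appears, and the 4 is kept because it need not be
    -- cancellable in the ring.
    four-triangular : ∀ {e₂ e₄ θ} → Euler (q ^ 2) e₂ → Euler ((q ^ 2) ^ 2) e₄ → HasSum (λ n → (q ^ 2) ^ e 0 1 n) θ →
      ⟦ + 4 ⟧ * (q * ((θ * θ) * (θ * θ))) ≈ ⟦ + 64 ⟧ * odd-divisor-sum
    four-triangular {e₂} {e₄} {θ} E₂ E₄ Θ = unit-cancel unit (begin
      (e₂ * e₂ * (e₂ * e₂)) * (⟦ + 4 ⟧ * (q * ((θ * θ) * (θ * θ))))
        ≈⟨ solve 3 (λ a q t → (a :* a :* (a :* a)) :* (con (+ 4) :* (q :* ((t :* t) :* (t :* t)))) :=
             con (+ 4) :* (q :* (((t :* a) :* (t :* a)) :* ((t :* a) :* (t :* a))))) refl e₂ q θ ⟩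
      ⟦ + 4 ⟧ * (q * (((θ * e₂) * (θ * e₂)) * ((θ * e₂) * (θ * e₂))))
        ≈⟨ *-congˡ (*-congˡ (*-cong (*-cong θ-prod θ-prod) (*-cong θ-prod θ-prod))) ⟩
      ⟦ + 4 ⟧ * (q * (((⟦ + 2 ⟧ * (e₄ * e₄)) * (⟦ + 2 ⟧ * (e₄ * e₄))) * ((⟦ + 2 ⟧ * (e₄ * e₄)) * (⟦ + 2 ⟧ * (e₄ * e₄)))))
        ≈⟨ solve 2 (λ b q → let t = con (+ 2) :* (b :* b) in con (+ 4) :* (q :* ((t :* t) :* (t :* t))) :=
             con (+ 16) :* ((con (+ 4) :* (q :* (b :* b :* b :* (b :* b :* b)))) :* (b :* b))) refl e₄ q ⟩
      ⟦ + 16 ⟧ * ((⟦ + 4 ⟧ * (q * (e₄ * e₄ * e₄ * (e₄ * e₄ * e₄)))) * (e₄ * e₄))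
        ≈⟨ *-congˡ (*-congʳ (trans (sym (cosets (Euler-cong (^-assocʳ q 2 2) E₄))) lambert)) ⟩
      ⟦ + 16 ⟧ * ((Φ * Ψ * (⟦ + 4 ⟧ * S)) * (e₄ * e₄))
        ≈⟨ solve 3 (λ f s b → con (+ 16) :* ((f :* (con (+ 4) :* s)) :* (b :* b)) := (f :* (b :* b)) :* (con (+ 64) :* s)) refl (Φ * Ψ) S e₄ ⟩
      (Φ * Ψ * (e₄ * e₄)) * (⟦ + 64 ⟧ * S) ≈⟨ *-congʳ (Φ*Ψ E₂ E₄) ⟩
      (e₂ * e₂ * (e₂ * e₂)) * (⟦ + 64 ⟧ * S) ∎)
      where
      S = odd-divisor-sum
      θ-prod : θ * e₂ ≈ ⟦ + 2 ⟧ * (e₄ * e₄)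
      θ-prod = theta-tri (nil-suc 1 nil) E₂ E₄ Θ
      unit : Unit (e₂ * e₂ * (e₂ * e₂))
      unit = unit-* (unit-* u u) (unit-* u u)
        where u = Euler-unit (nil-suc 1 nil) E₂

-- The combined identity in t, with q = t².

inner-exponent : ℤ × ℤ × ℤ × ℤ → ℕ
inner-exponent (x , y , z , w) = 2 ℕ.* T x ℕ.+ (2 ℕ.* T y ℕ.+ (10 ℕ.* T z ℕ.+ 10 ℕ.* T w))

module CombinedIdentity (R : CommutativeRing 0ℓ 0ℓ) (ι : ℤ⟶ R) where
  open NilpotentRing R ι
  open ThetaIdentities R ι
  open EulerProducts R ι
  open LevelTen R ι
  open FourTriangular R ι

  -- The level-ten identity at x = t² is multiplied by 4t. Then 4tθ₁⁴ is Legendre's series at t, and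
  -- 5·4t·(t²θ₅²)² = 5·4t⁵θ₅⁴ is five times the one at t⁵, whence 320 = 5·64. The mixed term
  -- acquires t·t² = t³.
  combined : ∀ {t} (nil : Nil t) {e₁ e₅ θ₁ θ₅} → Euler (t ^ 2) e₁ → Euler ((t ^ 2) ^ 5) e₅ →
    HasSum (λ n → (t ^ 2) ^ e 0 1 n) θ₁ → HasSum (λ n → ((t ^ 2) ^ 5) ^ e 0 1 n) θ₅ →
    ⟦ + 64 ⟧ * Fixed.odd-divisor-sum nil + ⟦ + 320 ⟧ * Fixed.odd-divisor-sum (nil-suc 4 nil)
      ≈ ⟦ + 24 ⟧ * (t ^ 3 * ((θ₁ * θ₁) * (θ₅ * θ₅))) + ⟦ + 64 ⟧ * (t * (e₁ * e₁ * (e₅ * e₅)))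
  combined {t} nil {e₁} {e₅} {θ₁} {θ₅} E₁ E₅ Θ₁ Θ₅ = begin
    ⟦ + 64 ⟧ * S₁ + ⟦ + 320 ⟧ * S₅ ≈⟨ solve 2 (λ a b → con (+ 64) :* a :+ con (+ 320) :* b := con (+ 64) :* a :+ con (+ 5) :* (con (+ 64) :* b)) refl S₁ S₅ ⟩
    ⟦ + 64 ⟧ * S₁ + ⟦ + 5 ⟧ * (⟦ + 64 ⟧ * S₅) ≈⟨ +-cong (Fixed.four-triangular nil E₁ E₂ Θ₁) (*-congˡ (Fixed.four-triangular (nil-suc 4 nil) E₅′ E₁₀′ Θ₅′)) ⟨
    ⟦ + 4 ⟧ * (t * ((θ₁ * θ₁) * (θ₁ * θ₁))) + ⟦ + 5 ⟧ * (⟦ + 4 ⟧ * (t ^ 5 * ((θ₅ * θ₅) * (θ₅ * θ₅))))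
      ≈⟨ solve 3 (λ t a b → con (+ 4) :* (t :* (a :* a)) :+ con (+ 5) :* (con (+ 4) :* (t :^ 5 :* (b :* b))) :=
           con (+ 4) :* (t :* (a :* a :+ con (+ 5) :* ((t :^ 2 :* b) :* (t :^ 2 :* b))))) refl t (θ₁ * θ₁) (θ₅ * θ₅) ⟩
    ⟦ + 4 ⟧ * (t * ((θ₁ * θ₁) * (θ₁ * θ₁) + ⟦ + 5 ⟧ * ((t ^ 2 * (θ₅ * θ₅)) * (t ^ 2 * (θ₅ * θ₅)))))
      ≈⟨ *-congˡ (*-congˡ (level-ten (nil-suc 1 nil) E₁ E₂ E₅ E₁₀ Θ₁ Θ₅)) ⟩
    ⟦ + 4 ⟧ * (t * (⟦ + 6 ⟧ * ((θ₁ * θ₁) * (t ^ 2 * (θ₅ * θ₅))) + ⟦ + 16 ⟧ * (e₁ * e₁ * (e₅ * e₅))))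
      ≈⟨ solve 4 (λ t a b e → con (+ 4) :* (t :* (con (+ 6) :* (a :* (t :^ 2 :* b)) :+ con (+ 16) :* e)) :=
           con (+ 24) :* (t :^ 3 :* (a :* b)) :+ con (+ 64) :* (t :* e)) refl t (θ₁ * θ₁) (θ₅ * θ₅) (e₁ * e₁ * (e₅ * e₅)) ⟩
    ⟦ + 24 ⟧ * (t ^ 3 * ((θ₁ * θ₁) * (θ₅ * θ₅))) + ⟦ + 64 ⟧ * (t * (e₁ * e₁ * (e₅ * e₅))) ∎
    where
    S₁ = Fixed.odd-divisor-sum nil
    S₅ = Fixed.odd-divisor-sum (nil-suc 4 nil)
    E₂ = proj₂ (euler (nil-suc 1 (nil-suc 1 nil)))
    E₁₀ = proj₂ (euler (nil-suc 1 (nil-suc 4 (nil-suc 1 nil))))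
    t¹⁰ : (t ^ 2) ^ 5 ≈ (t ^ 5) ^ 2
    t¹⁰ = trans (^-assocʳ t 2 5) (sym (^-assocʳ t 5 2))
    E₅′ = Euler-cong t¹⁰ E₅
    E₁₀′ = Euler-cong (^-congˡ 2 t¹⁰) E₁₀
    Θ₅′ : HasSum (λ n → ((t ^ 5) ^ 2) ^ e 0 1 n) θ₅
    Θ₅′ = hs-cong (λ n → ^-congˡ (e 0 1 n) t¹⁰) refl Θ₅

  module Expansions {t : Carrier} (nil : Nil t) where
    private
      nil₂ = nil-suc 1 nil
      nil₁₀ = nil-suc 4 nil₂
      E₁ = proj₂ (euler nil₂)
      E₅ = proj₂ (euler nil₁₀)
      Θ₁ = proj₂ (theta-exists (t ^ 2) 0 1 nil₂)
      Θ₅ = proj₂ (theta-exists ((t ^ 2) ^ 5) 0 1 nil₁₀)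
      e₁ = proj₁ (euler nil₂)
      e₅ = proj₁ (euler nil₁₀)
      θ₁ = proj₁ (theta-exists (t ^ 2) 0 1 nil₂)
      θ₅ = proj₁ (theta-exists ((t ^ 2) ^ 5) 0 1 nil₁₀)

    S₁ S₅ reps eulers : Carrier
    S₁ = Fixed.odd-divisor-sum nil
    S₅ = Fixed.odd-divisor-sum (nil-suc 4 nil)
    reps = t ^ 3 * ((θ₁ * θ₁) * (θ₅ * θ₅))
    eulers = e₁ * e₁ * (e₅ * e₅)

    identity : ⟦ + 64 ⟧ * S₁ + ⟦ + 320 ⟧ * S₅ ≈ ⟦ + 24 ⟧ * reps + ⟦ + 64 ⟧ * (t * eulers)
    identity = combined nil E₁ E₅ Θ₁ Θ₅

    odd-divisor-power : ℕ → ℕ × ℕ → Carrier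
    odd-divisor-power a (k , j) = ⟦ + suc (k ℕ.* 2) ⟧ * t ^ (a ℕ.* (suc (k ℕ.* 2) ℕ.* suc (j ℕ.* 2)))

    S₁-HasSum : HasSum (odd-divisor-power 1) S₁
    S₁-HasSum = hs-cong (λ (k , j) → *-congˡ (^-congʳ t (≡.sym (ℕ.*-identityˡ (suc (k ℕ.* 2) ℕ.* suc (j ℕ.* 2)))))) refl (Fixed.odd-divisor-HasSum nil)

    S₅-HasSum : HasSum (odd-divisor-power 5) S₅
    S₅-HasSum = hs-cong (λ (k , j) → *-congˡ (^-assocʳ t 5 (suc (k ℕ.* 2) ℕ.* suc (j ℕ.* 2)))) refl (Fixed.odd-divisor-HasSum (nil-suc 4 nil))

    x₅^ : ∀ n → ((t ^ 2) ^ 5) ^ n ≈ t ^ (10 ℕ.* n)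
    x₅^ n = trans (^-congˡ n (^-assocʳ t 2 5)) (^-assocʳ t 10 n)

    reps-HasSum : HasSum (λ v → t ^ (3 ℕ.+ inner-exponent v)) reps
    reps-HasSum = hs-cong terms (*-congˡ (sym (*-assoc θ₁ θ₁ (θ₅ * θ₅))))
      (hs-*ˡ (t ^ 3) (hs-× ℤ._≟_ Θ₁ (hs-× ℤ._≟_ Θ₁ (hs-× ℤ._≟_ Θ₅ Θ₅))))
      where
      terms : ∀ ((x , y , z , w) : ℤ × ℤ × ℤ × ℤ) →
        t ^ 3 * ((t ^ 2) ^ T x * ((t ^ 2) ^ T y * (((t ^ 2) ^ 5) ^ T z * ((t ^ 2) ^ 5) ^ T w))) ≈ t ^ (3 ℕ.+ inner-exponent (x , y , z , w))
      terms (x , y , z , w) = begin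
        t ^ 3 * ((t ^ 2) ^ T x * ((t ^ 2) ^ T y * (((t ^ 2) ^ 5) ^ T z * ((t ^ 2) ^ 5) ^ T w)))
          ≈⟨ *-congˡ (*-cong (^-assocʳ t 2 (T x)) (*-cong (^-assocʳ t 2 (T y)) (*-cong (x₅^ (T z)) (x₅^ (T w))))) ⟩
        t ^ 3 * (t ^ a * (t ^ b * (t ^ d * t ^ f)))
          ≈⟨ *-congˡ (trans (*-congˡ (trans (*-congˡ (sym (^-homo-* t d f))) (sym (^-homo-* t b (d ℕ.+ f))))) (sym (^-homo-* t a (b ℕ.+ (d ℕ.+ f))))) ⟩
        t ^ 3 * t ^ inner-exponent (x , y , z , w) ≈⟨ ^-homo-* t 3 (inner-exponent (x , y , z , w)) ⟨
        t ^ (3 ℕ.+ inner-exponent (x , y , z , w)) ∎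
        where
        a = 2 ℕ.* T x
        b = 2 ℕ.* T y
        d = 10 ℕ.* T z
        f = 10 ℕ.* T w

    eulers-factor : ℕ → Carrier
    eulers-factor j = let f = λ n → 1# - t ^ n in f (2 ℕ.* suc j) * (f (2 ℕ.* suc j) * (f (10 ℕ.* suc j) * f (10 ℕ.* suc j)))

    -- Truncation is exact as soon as t^(n+1) = 0, since every omitted factor is 1 minus a power of
    -- t of exponent at least n + 1. The factors are nested as in `prodUpTo`, so that the two can be
    -- matched factor by factor.
    eulers-rng : ∀ n → proj₁ nil ℕ.≤ suc n → eulers ≈ rng eulers-factor n
    eulers-rng n K≤ = trans (*-assoc e₁ e₁ (e₅ * e₅)) (hp-unique (hp-cong factor≈ refl (hp-* E₁ (hp-* E₁ (hp-* E₅ E₅)))) (hasProd n beyond refl))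
      where
      factor≈ : ∀ j → (1# - (t ^ 2) ^ suc j) * ((1# - (t ^ 2) ^ suc j) * ((1# - ((t ^ 2) ^ 5) ^ suc j) * (1# - ((t ^ 2) ^ 5) ^ suc j))) ≈ eulers-factor j
      factor≈ j = *-cong x₁ (*-cong x₁ (*-cong x₅ x₅))
        where
        x₁ = +-congˡ (-‿cong (^-assocʳ t 2 (suc j)))
        x₅ = +-congˡ (-‿cong (x₅^ (suc j)))
      beyond : ∀ j → n ℕ.≤ j → eulers-factor j ≈ 1#
      beyond j n≤j = trans (*-cong (one 2) (trans (*-cong (one 2) (trans (*-cong (one 10) (one 10)) (*-identityˡ 1#))) (*-identityˡ 1#))) (*-identityˡ 1#)
        where
        one : ∀ b .{{_ : ℕ.NonZero b}} → 1# - t ^ (b ℕ.* suc j) ≈ 1#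
        one b = 1-0 (nil-≤ nil (ℕ.≤-trans K≤ (ℕ.≤-trans (ℕ.s≤s n≤j) (ℕ.m≤n*m (suc j) b))))

-- Cauchy products and truncated power series over ℤ.

conv : (ℕ → ℤ) → (ℕ → ℤ) → ℕ → ℤ
conv f g zero = f 0 ℤ.* g 0
conv f g (suc n) = f 0 ℤ.* g (suc n) ℤ.+ conv (f ∘ suc) g n

conv-cong : ∀ n {f f′ g g′} → (∀ i → i ℕ.≤ n → f i ≡ f′ i) → (∀ i → i ℕ.≤ n → g i ≡ g′ i) → conv f g n ≡ conv f′ g′ n
conv-cong zero p q = ≡.cong₂ ℤ._*_ (p 0 ℕ.z≤n) (q 0 ℕ.z≤n)
conv-cong (suc n) p q = ≡.cong₂ ℤ._+_ (≡.cong₂ ℤ._*_ (p 0 ℕ.z≤n) (q (suc n) ℕ.≤-refl))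
  (conv-cong n (λ i i≤n → p (suc i) (ℕ.s≤s i≤n)) (λ i i≤n → q i (ℕ.m≤n⇒m≤1+n i≤n)))

conv-+ : ∀ n f f′ g → conv (λ i → f i ℤ.+ f′ i) g n ≡ conv f g n ℤ.+ conv f′ g n
conv-+ zero f f′ g = ℤ.*-distribʳ-+ (g 0) (f 0) (f′ 0)
conv-+ (suc n) f f′ g = ≡.trans (≡.cong (λ z → (f 0 ℤ.+ f′ 0) ℤ.* g (suc n) ℤ.+ z) (conv-+ n (f ∘ suc) (f′ ∘ suc) g))
  (lem (f 0) (f′ 0) (g (suc n)) (conv (f ∘ suc) g n) (conv (f′ ∘ suc) g n))
  where
  lem : ∀ a b c x y → (a ℤ.+ b) ℤ.* c ℤ.+ (x ℤ.+ y) ≡ (a ℤ.* c ℤ.+ x) ℤ.+ (b ℤ.* c ℤ.+ y)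
  lem = ℤ-Solver.solve-∀

conv-* : ∀ n a f g → conv (λ i → a ℤ.* f i) g n ≡ a ℤ.* conv f g n
conv-* zero a f g = ℤ.*-assoc a (f 0) (g 0)
conv-* (suc n) a f g = ≡.trans (≡.cong (λ z → a ℤ.* f 0 ℤ.* g (suc n) ℤ.+ z) (conv-* n a (f ∘ suc) g)) (lem a (f 0) (g (suc n)) _)
  where
  lem : ∀ a b c x → a ℤ.* b ℤ.* c ℤ.+ a ℤ.* x ≡ a ℤ.* (b ℤ.* c ℤ.+ x)
  lem = ℤ-Solver.solve-∀

conv-0 : ∀ n g → conv (λ _ → + 0) g n ≡ + 0
conv-0 zero g = ≡.refl
conv-0 (suc n) g = ≡.trans (ℤ.+-identityˡ _) (conv-0 n g)

conv-last : ∀ n f g → conv f g (suc n) ≡ f (suc n) ℤ.* g 0 ℤ.+ conv f (g ∘ suc) n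
conv-last zero f g = ℤ.+-comm (f 0 ℤ.* g 1) (f 1 ℤ.* g 0)
conv-last (suc n) f g = ≡.trans (≡.cong (λ z → f 0 ℤ.* g (suc (suc n)) ℤ.+ z) (conv-last n (f ∘ suc) g)) (lem (f 0 ℤ.* g (suc (suc n))) (f (suc (suc n)) ℤ.* g 0) (conv (f ∘ suc) (g ∘ suc) n))
  where
  lem : ∀ a b c → a ℤ.+ (b ℤ.+ c) ≡ b ℤ.+ (a ℤ.+ c)
  lem = ℤ-Solver.solve-∀

conv-comm : ∀ n f g → conv f g n ≡ conv g f n
conv-comm zero f g = ℤ.*-comm (f 0) (g 0)
conv-comm (suc n) f g = ≡.trans (≡.cong₂ ℤ._+_ (ℤ.*-comm (f 0) (g (suc n))) (conv-comm n (f ∘ suc) g)) (≡.sym (conv-last n g f))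

conv-assoc : ∀ n f g h → conv (conv f g) h n ≡ conv f (conv g h) n
conv-assoc zero f g h = ℤ.*-assoc (f 0) (g 0) (h 0)
conv-assoc (suc n) f g h = begin
  f 0 ℤ.* g 0 ℤ.* h (suc n) ℤ.+ conv (λ i → f 0 ℤ.* g (suc i) ℤ.+ conv (f ∘ suc) g i) h n
    ≡⟨ ≡.cong (λ z → f 0 ℤ.* g 0 ℤ.* h (suc n) ℤ.+ z) (≡.trans (conv-+ n (λ i → f 0 ℤ.* g (suc i)) (conv (f ∘ suc) g) h)
         (≡.cong₂ ℤ._+_ (conv-* n (f 0) (g ∘ suc) h) (conv-assoc n (f ∘ suc) g h))) ⟩
  f 0 ℤ.* g 0 ℤ.* h (suc n) ℤ.+ (f 0 ℤ.* conv (g ∘ suc) h n ℤ.+ conv (f ∘ suc) (conv g h) n) ≡⟨ lem (f 0) (g 0) (h (suc n)) _ _ ⟩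
  f 0 ℤ.* (g 0 ℤ.* h (suc n) ℤ.+ conv (g ∘ suc) h n) ℤ.+ conv (f ∘ suc) (conv g h) n ∎
  where
  open ≡.≡-Reasoning
  lem : ∀ a b c x y → a ℤ.* b ℤ.* c ℤ.+ (a ℤ.* x ℤ.+ y) ≡ a ℤ.* (b ℤ.* c ℤ.+ x) ℤ.+ y
  lem = ℤ-Solver.solve-∀

constant : ℤ → ℕ → ℤ
constant a zero = a
constant a (suc _) = + 0

conv-constant : ∀ n a g → conv (constant a) g n ≡ a ℤ.* g n
conv-constant zero a g = ≡.refl
conv-constant (suc n) a g = ≡.trans (≡.cong (λ z → a ℤ.* g (suc n) ℤ.+ z) (conv-0 n g)) (ℤ.+-identityʳ _)

δ : ℕ → ℕ → ℤ
δ zero zero = + 1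
δ zero (suc _) = + 0
δ (suc _) zero = + 0
δ (suc k) (suc i) = δ k i

δ-≡ : ∀ k → δ k k ≡ + 1
δ-≡ zero = ≡.refl
δ-≡ (suc k) = δ-≡ k

δ-≢ : ∀ k i → ¬ k ≡ i → δ k i ≡ + 0
δ-≢ zero zero k≢i = ⊥-elim (k≢i ≡.refl)
δ-≢ zero (suc i) k≢i = ≡.refl
δ-≢ (suc k) zero k≢i = ≡.refl
δ-≢ (suc k) (suc i) k≢i = δ-≢ k i (λ e → k≢i (≡.cong suc e))

module PowerSeries (P : ℕ) where
  -- ℤ[t]/(t^P)
  infix 4 _≈ₚ_
  _≈ₚ_ : (ℕ → ℤ) → (ℕ → ℤ) → Set
  f ≈ₚ g = ∀ i → i ℕ.< P → f i ≡ g i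

  private
    pointwise : ∀ {f g : ℕ → ℤ} → (∀ i → f i ≡ g i) → f ≈ₚ g
    pointwise e i _ = e i
    below : ∀ {f g : ℕ → ℤ} {i} → f ≈ₚ g → i ℕ.< P → ∀ j → j ℕ.≤ i → f j ≡ g j
    below f≈g i<P j j≤i = f≈g j (ℕ.≤-<-trans j≤i i<P)
    one : ∀ f i → conv (constant (+ 1)) f i ≡ f i
    one f i = ≡.trans (conv-constant i (+ 1) f) (ℤ.*-identityˡ (f i))
    distribʳ : ∀ f g h i → conv (λ j → g j ℤ.+ h j) f i ≡ conv g f i ℤ.+ conv h f i
    distribʳ f g h i = conv-+ i g h f

  ℤ[t] : CommutativeRing 0ℓ 0ℓ
  ℤ[t] = record
    { Carrier = ℕ → ℤ
    ; _≈_ = _≈ₚ_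
    ; _+_ = λ f g i → f i ℤ.+ g i
    ; _*_ = conv
    ; -_ = λ f i → ℤ.- f i
    ; 0# = constant (+ 0)
    ; 1# = constant (+ 1)
    ; isCommutativeRing = record
      { isRing = record
        { +-isAbelianGroup = record
          { isGroup = record
            { isMonoid = record
              { isSemigroup = record
                { isMagma = record
                  { isEquivalence = record
                    { refl = λ _ _ → ≡.refl
                    ; sym = λ p i i<P → ≡.sym (p i i<P)
                    ; trans = λ p q i i<P → ≡.trans (p i i<P) (q i i<P) }
                  ; ∙-cong = λ p q i i<P → ≡.cong₂ ℤ._+_ (p i i<P) (q i i<P) }
                ; assoc = λ f g h → pointwise (λ i → ℤ.+-assoc (f i) (g i) (h i)) }
              ; identity = (λ f → pointwise (λ { zero → ℤ.+-identityˡ _ ; (suc i) → ℤ.+-identityˡ _ }))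
                         , (λ f → pointwise (λ { zero → ℤ.+-identityʳ _ ; (suc i) → ℤ.+-identityʳ _ })) }
            ; inverse = (λ f → pointwise (λ { zero → ℤ.+-inverseˡ (f 0) ; (suc i) → ℤ.+-inverseˡ (f (suc i)) }))
                      , (λ f → pointwise (λ { zero → ℤ.+-inverseʳ (f 0) ; (suc i) → ℤ.+-inverseʳ (f (suc i)) }))
            ; ⁻¹-cong = λ p i i<P → ≡.cong ℤ.-_ (p i i<P) }
          ; comm = λ f g → pointwise (λ i → ℤ.+-comm (f i) (g i)) }
        ; *-cong = λ p q i i<P → conv-cong i (below p i<P) (below q i<P)
        ; *-assoc = λ f g h → pointwise (λ i → conv-assoc i f g h)
        ; *-identity = (λ f → pointwise (one f)) , (λ f → pointwise (λ i → ≡.trans (conv-comm i f _) (one f i)))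
        ; distrib = (λ f g h → pointwise (λ i → ≡.trans (conv-comm i f _) (≡.trans (distribʳ f g h i) (≡.cong₂ ℤ._+_ (conv-comm i g f) (conv-comm i h f)))))
                  , (λ f g h → pointwise (distribʳ f g h)) }
      ; *-comm = λ f g → pointwise (λ i → conv-comm i f g) } }

  embedding : ℤ⟶ ℤ[t]
  embedding = record
    { ⟦_⟧ = constant
    ; +-homo = λ a b → pointwise (λ { zero → ≡.refl ; (suc i) → ≡.refl })
    ; *-homo = λ a b → pointwise (λ i → ≡.sym (≡.trans (conv-constant i a (constant b)) (scaled a b i)))
    ; -‿homo = λ a → pointwise (λ { zero → ≡.refl ; (suc i) → ≡.refl })
    ; 0-homo = λ _ _ → ≡.refl
    ; 1-homo = λ _ _ → ≡.refl }
    where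
    scaled : ∀ a b i → a ℤ.* constant b i ≡ constant (a ℤ.* b) i
    scaled a b zero = ≡.refl
    scaled a b (suc i) = ℤ.*-zeroʳ a

  open NilpotentRing ℤ[t] embedding

  t : ℕ → ℤ
  t 1 = + 1
  t _ = + 0

  t*-suc : ∀ f i → conv t f (suc i) ≡ f i
  t*-suc f i = ≡.trans (ℤ.+-identityˡ _) (≡.trans (conv-cong i tail (λ _ _ → ≡.refl)) (≡.trans (conv-constant i (+ 1) f) (ℤ.*-identityˡ (f i))))
    where
    tail : ∀ j → j ℕ.≤ i → t (suc j) ≡ constant (+ 1) j
    tail zero _ = ≡.refl
    tail (suc j) _ = ≡.refl

  t^-coefficient : ∀ k i → (t ^ k) i ≡ δ k i
  t^-coefficient zero zero = ≡.refl
  t^-coefficient zero (suc i) = ≡.refl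
  t^-coefficient (suc k) zero = ≡.refl
  t^-coefficient (suc k) (suc i) = ≡.trans (t*-suc (t ^ k) i) (t^-coefficient k i)

  t-nil : Nil t
  t-nil = P , λ i i<P → ≡.trans (t^-coefficient P i) (≡.trans (δ-≢ P i (λ e → ℕ.<⇒≢ i<P (≡.sym e))) (constant-0 i))
    where
    constant-0 : ∀ i → + 0 ≡ constant (+ 0) i
    constant-0 zero = ≡.refl
    constant-0 (suc i) = ≡.refl

  ⟦⟧*-coefficient : ∀ a f i → i ℕ.< P → (⟦ a ⟧ * f) i ≡ a ℤ.* f i
  ⟦⟧*-coefficient a f i i<P = ≡.trans (conv-cong i (λ j j≤i → ⟦⟧≈ι a j (ℕ.≤-<-trans j≤i i<P)) (λ _ _ → ≡.refl)) (conv-constant i a f)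

  -- Coefficients below the truncation order respect the equality of the ring and are additive. This
  -- is the passage from ring identities to sums of integers, where constants can be cancelled.
  coefficient-HasSum : ∀ {m} → m ℕ.< P → {I : Set} {F : I → ℕ → ℤ} {s : ℕ → ℤ} → HasSum F s →
    FinSum.HasSum ℤ.+-0-commutativeMonoid (λ i → F i m) (s m)
  coefficient-HasSum {m} m<P = hs-hom +-commutativeMonoid ℤ.+-0-commutativeMonoid (λ f → f m) (λ p → p m m<P) (λ _ _ → ≡.refl) (const-0 m)
    where
    const-0 : ∀ m → constant (+ 0) m ≡ + 0
    const-0 zero = ≡.refl
    const-0 (suc m) = ≡.refl

open import Defs

-- Divisor sums.

module ΣZ = FinSum ℤ.+-0-commutativeMonoid

-- Extended by zero to all of ℕ, so that σ becomes a finitely supported sum and can be compared with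
-- others through `hs-unique`.
divisor-term : ℕ → ℕ → ℤ
divisor-term M d with d ∣? M
... | yes _ = + d
... | no _ = + 0

divisor-yes : ∀ {M d} → d ∣ M → divisor-term M d ≡ + d
divisor-yes {M} {d} d∣M with d ∣? M
... | yes _ = ≡.refl
... | no d∤M = ⊥-elim (d∤M d∣M)

divisor-no : ∀ {M d} → ¬ d ∣ M → divisor-term M d ≡ + 0
divisor-no {M} {d} d∤M with d ∣? M
... | yes d∣M = ⊥-elim (d∤M d∣M)
... | no _ = ≡.refl

divisors : ℕ → List ℕ
divisors M = filter (_∣? M) (map suc (upTo M))

∈-divisors : ∀ {M d} → .{{ℕ.NonZero M}} → d ∣ M → d ∈ divisors M
∈-divisors {M@(suc _)} {zero} d∣M = ⊥-elim (ℕ.1+n≢0 (0∣⇒≡0 d∣M))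
∈-divisors {M} {suc d} d∣M = ∈-filter⁺ (_∣? M) (∈-map⁺ suc (∈-upTo⁺ (∣⇒≤ d∣M))) d∣M

σ-HasSum : ∀ M → .{{ℕ.NonZero M}} → ΣZ.HasSum (divisor-term M) (+ σ M)
σ-HasSum M = ΣZ.hasSum (divisors M) (Unique.filter⁺ (_∣? M) (Unique.map⁺ ℕ.suc-injective (Unique.upTo⁺ M)))
  (λ d d∉ → divisor-no (λ d∣M → d∉ (∈-divisors d∣M)))
  (value (divisors M) (λ d∈ → proj₂ (∈-filter⁻ (_∣? M) {xs = map suc (upTo M)} d∈)))
  where
  value : ∀ L → (∀ {d} → d ∈ L → d ∣ M) → ΣZ.Σl (divisor-term M) L ≡ + sum L
  value [] _ = ≡.refl
  value (d ∷ L) L∣M = ≡.trans (≡.cong₂ ℤ._+_ (divisor-yes (L∣M (here ≡.refl))) (value L (λ d∈ → L∣M (there d∈)))) (≡.sym (ℤ.pos-+ d (sum L)))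

prime-5 : Prime 5
prime-5 = from-yes (prime? 5)

∤-cancel : ∀ {d n} → ¬ 5 ∣ d → d ∣ 5 ℕ.* n → d ∣ n
∤-cancel {d} {n} 5∤d (divides c 5n≡cd) with euclidsLemma c d prime-5 (divides n (≡.trans (≡.sym 5n≡cd) (ℕ.*-comm 5 n)))
... | inj₂ 5∣d = ⊥-elim (5∤d 5∣d)
... | inj₁ (divides c′ ≡.refl) = divides c′ (ℕ.*-cancelˡ-≡ n (c′ ℕ.* d) 5 (≡.trans 5n≡cd (lem c′ d)))
  where
  lem : ∀ c d → c ℕ.* 5 ℕ.* d ≡ 5 ℕ.* (c ℕ.* d)
  lem = ℕ-Solver.solve-∀

-- The divisors that are multiples of 5 are 5 times the divisors of 5^β n; the others are coprime to
-- 5 and so divide n.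
σ-5* : ∀ β n → .{{ℕ.NonZero n}} → ¬ 5 ∣ n → + σ (5 ℕ.^ suc β ℕ.* n) ≡ + 5 ℤ.* + σ (5 ℕ.^ β ℕ.* n) ℤ.+ + σ n
σ-5* β n 5∤n = ΣZ.hs-unique ℕ._≟_ (σ-HasSum (5 ℕ.^ suc β ℕ.* n)) (ΣZ.hs-cong split ≡.refl (ΣZ.hs-∙ ℕ._≟_ multiples (σ-HasSum n)))
  where
  M = 5 ℕ.^ β ℕ.* n
  instance
    M≢0 : ℕ.NonZero M
    M≢0 = ℕ.m*n≢0 (5 ℕ.^ β) n {{ℕ.m^n≢0 5 β}}
    5M≢0 : ℕ.NonZero (5 ℕ.^ suc β ℕ.* n)
    5M≢0 = ℕ.m*n≢0 (5 ℕ.^ suc β) n {{ℕ.m^n≢0 5 (suc β)}}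
  5M≡ : 5 ℕ.^ suc β ℕ.* n ≡ 5 ℕ.* M
  5M≡ = ℕ.*-assoc 5 (5 ℕ.^ β) n
  A : ℕ → ℤ
  A d with 5 ∣? d
  ... | yes _ = divisor-term (5 ℕ.^ suc β ℕ.* n) d
  ... | no _ = + 0
  A-5* : ∀ d → A (5 ℕ.* d) ≡ + 5 ℤ.* divisor-term M d
  A-5* d with 5 ∣? (5 ℕ.* d)
  ... | no ∤ = ⊥-elim (∤ (m∣m*n d))
  ... | yes _ with d ∣? M
  ...   | yes d∣M = ≡.trans (divisor-yes (≡.subst (5 ℕ.* d ∣_) (≡.sym 5M≡) (*-monoʳ-∣ 5 d∣M))) (ℤ.pos-* 5 d)
  ...   | no d∤M = divisor-no (λ ∣ → d∤M (*-cancelˡ-∣ 5 (≡.subst (5 ℕ.* d ∣_) 5M≡ ∣)))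
  multiples : ΣZ.HasSum A (+ 5 ℤ.* + σ M)
  multiples = ΣZ.hasSum (map (5 ℕ.*_) L) (Unique.map⁺ (λ {i} {j} → ℕ.*-cancelˡ-≡ i j 5) (ΣZ.HasSum.unique h)) outside
    (≡.trans (ΣZ.Σl-map A (5 ℕ.*_) L) (≡.trans (ΣZ.Σl-cong L (λ d _ → A-5* d)) (≡.trans (scale-Σl L) (≡.cong (+ 5 ℤ.*_) (ΣZ.HasSum.value h)))))
    where
    h = σ-HasSum M
    L = ΣZ.HasSum.list h
    scale-Σl : ∀ L → ΣZ.Σl (λ d → + 5 ℤ.* divisor-term M d) L ≡ + 5 ℤ.* ΣZ.Σl (divisor-term M) L
    scale-Σl [] = ≡.refl
    scale-Σl (d ∷ L) = ≡.trans (≡.cong (λ z → + 5 ℤ.* divisor-term M d ℤ.+ z) (scale-Σl L)) (≡.sym (ℤ.*-distribˡ-+ (+ 5) (divisor-term M d) (ΣZ.Σl (divisor-term M) L)))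
    outside : ∀ d → d ∉ map (5 ℕ.*_) L → A d ≡ + 0
    outside d d∉ with 5 ∣? d in eq
    ... | no _ = ≡.refl
    ... | yes (divides d′ ≡.refl) = divisor-no (λ d∣ → d∉ (≡.subst (_∈ map (5 ℕ.*_) L) (ℕ.*-comm 5 d′)
          (∈-map⁺ (5 ℕ.*_) (∈-divisors {M} {d′} (*-cancelˡ-∣ 5 (≡.subst₂ _∣_ (ℕ.*-comm d′ 5) 5M≡ d∣))))))
  coprime-part : ∀ β {d} → ¬ 5 ∣ d → d ∣ 5 ℕ.^ β ℕ.* n → d ∣ n
  coprime-part zero {d} _ d∣ = ≡.subst (d ∣_) (ℕ.*-identityˡ n) d∣
  coprime-part (suc β) {d} 5∤d d∣ = coprime-part β 5∤d (∤-cancel 5∤d (≡.subst (d ∣_) (ℕ.*-assoc 5 (5 ℕ.^ β) n) d∣))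
  split : ∀ d → A d ℤ.+ divisor-term n d ≡ divisor-term (5 ℕ.^ suc β ℕ.* n) d
  split d with 5 ∣? d
  ... | yes 5∣d = ≡.trans (≡.cong (λ z → divisor-term (5 ℕ.^ suc β ℕ.* n) d ℤ.+ z) (divisor-no (λ d∣n → 5∤n (∣-trans 5∣d d∣n)))) (ℤ.+-identityʳ _)
  ... | no 5∤d with d ∣? n
  ...   | yes d∣n = ≡.trans (ℤ.+-identityˡ _) (≡.sym (divisor-yes (∣-trans d∣n (n∣m*n (5 ℕ.^ suc β)))))
  ...   | no d∤n = ≡.sym (divisor-no (λ d∣ → d∤n (coprime-part (suc β) 5∤d d∣)))

-- Multiplicativity with σ(5^β) = (5^(β+1) - 1)/4, kept free of division. The induction follows
-- σ(5^(β+1)) = 5σ(5^β) + 1.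
4σ : ∀ β n → .{{ℕ.NonZero n}} → ¬ 5 ∣ n → + 4 ℤ.* + σ (5 ℕ.^ β ℕ.* n) ≡ (+ (5 ℕ.^ suc β) ℤ.- + 1) ℤ.* + σ n
4σ zero n 5∤n = ≡.cong (λ m → + 4 ℤ.* + σ m) (ℕ.*-identityˡ n)
4σ (suc β) n 5∤n = begin
  + 4 ℤ.* + σ (5 ℕ.^ suc β ℕ.* n) ≡⟨ ≡.cong (+ 4 ℤ.*_) (σ-5* β n 5∤n) ⟩
  + 4 ℤ.* (+ 5 ℤ.* + σ (5 ℕ.^ β ℕ.* n) ℤ.+ + σ n) ≡⟨ lem₁ (+ σ (5 ℕ.^ β ℕ.* n)) (+ σ n) ⟩
  + 5 ℤ.* (+ 4 ℤ.* + σ (5 ℕ.^ β ℕ.* n)) ℤ.+ + 4 ℤ.* + σ n ≡⟨ ≡.cong (λ z → + 5 ℤ.* z ℤ.+ + 4 ℤ.* + σ n) (4σ β n 5∤n) ⟩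
  + 5 ℤ.* ((+ (5 ℕ.^ suc β) ℤ.- + 1) ℤ.* + σ n) ℤ.+ + 4 ℤ.* + σ n ≡⟨ lem₂ (+ (5 ℕ.^ suc β)) (+ σ n) ⟩
  (+ 5 ℤ.* + (5 ℕ.^ suc β) ℤ.- + 1) ℤ.* + σ n ≡⟨ ≡.cong (λ z → (z ℤ.- + 1) ℤ.* + σ n) (ℤ.pos-* 5 (5 ℕ.^ suc β)) ⟨
  (+ (5 ℕ.^ suc (suc β)) ℤ.- + 1) ℤ.* + σ n ∎
  where
  open ≡.≡-Reasoning
  lem₁ : ∀ a b → + 4 ℤ.* (+ 5 ℤ.* a ℤ.+ b) ≡ + 5 ℤ.* (+ 4 ℤ.* a) ℤ.+ + 4 ℤ.* b
  lem₁ = ℤ-Solver.solve-∀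
  lem₂ : ∀ p b → + 5 ℤ.* ((p ℤ.- + 1) ℤ.* b) ℤ.+ + 4 ℤ.* b ≡ (+ 5 ℤ.* p ℤ.- + 1) ℤ.* b
  lem₂ = ℤ-Solver.solve-∀

odd-factor : ∀ {h d} → d ∣ suc (h ℕ.* 2) → Σ ℕ λ k → d ≡ suc (k ℕ.* 2)
odd-factor {h} {d} d∣ with d ℕ.% 2 in eq | ℕ.m≡m%n+[m/n]*n d 2 | ℕ.m%n<n d 2
... | zero | d≡ | _ = ⊥-elim (2∤ (∣-trans (divides (d ℕ./ 2) d≡) d∣))
  where
  2∤ : ¬ 2 ∣ suc (h ℕ.* 2)
  2∤ 2∣ with ∣1⇒≡1 (∣m+n∣m⇒∣n (≡.subst (2 ∣_) (ℕ.+-comm 1 (h ℕ.* 2)) 2∣) (n∣m*n h))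
  ... | ()
... | suc zero | d≡ | _ = d ℕ./ 2 , d≡
... | suc (suc _) | _ | ℕ.s≤s (ℕ.s≤s ())

odd-pair-term : ℕ → ℕ → ℕ × ℕ → ℤ
odd-pair-term a m (k , j) = + suc (k ℕ.* 2) ℤ.* δ (a ℕ.* (suc (k ℕ.* 2) ℕ.* suc (j ℕ.* 2))) m

odd-pair-0 : ∀ a m {k j} → ¬ a ℕ.* (suc (k ℕ.* 2) ℕ.* suc (j ℕ.* 2)) ≡ m → odd-pair-term a m (k , j) ≡ + 0
odd-pair-0 a m {k} {j} ≢m = ≡.trans (≡.cong (+ suc (k ℕ.* 2) ℤ.*_) (δ-≢ _ m ≢m)) (ℤ.*-zeroʳ (+ suc (k ℕ.* 2)))

-- An odd number has only odd divisors, with odd cofactors. In row k at most one j contributes, and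
-- the row sum is the divisor 2k + 1 or 0.
odd-pairs-σ : ∀ a .{{_ : ℕ.NonZero a}} h → ΣZ.HasSum (odd-pair-term a (a ℕ.* suc (h ℕ.* 2))) (+ σ (suc (h ℕ.* 2)))
odd-pairs-σ a h = ΣZ.hs-cong (λ _ → ≡.refl) (ΣZ.hs-unique ℕ._≟_ odd-divisors (σ-HasSum M))
  (ΣZ.hs-Σ ℕ._≟_ (odd-pair-term a (a ℕ.* M)) (λ k → divisor-term M (odd k)) (upTo M) (Unique.upTo⁺ M)
    (λ k k∉ j → ≢0 {k} {j} (λ e → k∉ (∈-upTo⁺ (divisor< {k} (≡.subst (odd k ∣_) e (m∣m*n (odd j)))))))
    inner)
  where
  M = suc (h ℕ.* 2)
  odd : ℕ → ℕ
  odd k = suc (k ℕ.* 2)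
  ≢0 : ∀ {k j} → ¬ odd k ℕ.* odd j ≡ M → odd-pair-term a (a ℕ.* M) (k , j) ≡ + 0
  ≢0 {k} {j} ≢M = odd-pair-0 a (a ℕ.* M) {k} {j} (λ e → ≢M (ℕ.*-cancelˡ-≡ (odd k ℕ.* odd j) M a e))
  odd-injective : ∀ {i j} → odd i ≡ odd j → i ≡ j
  odd-injective {i} {j} e = ℕ.*-cancelʳ-≡ i j 2 (ℕ.suc-injective e)
  divisor< : ∀ {k} → odd k ∣ M → k ℕ.< M
  divisor< {k} d = ℕ.≤-trans (ℕ.s≤s (ℕ.m≤m*n k 2)) (∣⇒≤ d)
  odd-divisors : ΣZ.HasSum (divisor-term M) (ΣZ.Σl (λ k → divisor-term M (odd k)) (upTo M))
  odd-divisors = ΣZ.hasSum (map odd (upTo M)) (Unique.map⁺ odd-injective (Unique.upTo⁺ M)) outside (ΣZ.Σl-map (divisor-term M) odd (upTo M))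
    where
    outside : ∀ d → d ∉ map odd (upTo M) → divisor-term M d ≡ + 0
    outside d d∉ = divisor-no (λ d∣M → contra d∣M (odd-factor {h} d∣M))
      where
      contra : d ∣ M → Σ ℕ (λ k → d ≡ odd k) → ⊥
      contra d∣M (k , ≡.refl) = d∉ (∈-map⁺ odd (∈-upTo⁺ (divisor< {k} d∣M)))
  inner : ∀ k → ΣZ.HasSum (λ j → odd-pair-term a (a ℕ.* M) (k , j)) (divisor-term M (odd k))
  inner k with odd k ∣? M
  ... | no d∤M = ΣZ.hasSum [] [] (λ j _ → ≢0 {k} {j} (λ e → d∤M (divides (odd j) (≡.trans (≡.sym e) (ℕ.*-comm (odd k) (odd j)))))) ≡.refl
  ... | yes (divides c M≡) with odd-factor {h} {c} (divides (odd k) (≡.trans M≡ (ℕ.*-comm c (odd k))))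
  ...   | (j , ≡.refl) = ΣZ.hasSum (j ∷ []) ([] ∷ []) outside
      (≡.trans (ℤ.+-identityʳ _) (≡.trans (≡.cong (+ odd k ℤ.*_) (≡.trans (≡.cong (λ z → δ (a ℕ.* z) (a ℕ.* M)) kj≡M) (δ-≡ (a ℕ.* M)))) (ℤ.*-identityʳ (+ odd k))))
    where
    kj≡M : odd k ℕ.* odd j ≡ M
    kj≡M = ≡.trans (ℕ.*-comm (odd k) (odd j)) (≡.sym M≡)
    outside : ∀ j′ → j′ ∉ j ∷ [] → odd-pair-term a (a ℕ.* M) (k , j′) ≡ + 0
    outside j′ j′∉ = ≢0 {k} {j′} (λ e → j′∉ (here (odd-injective (ℕ.*-cancelˡ-≡ (odd j′) (odd j) (odd k) (≡.trans e (≡.sym kj≡M))))))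

odd-pairs-empty : ∀ {a m} → ¬ a ∣ m → ΣZ.HasSum (odd-pair-term a m) (+ 0)
odd-pairs-empty {a} {m} a∤m = ΣZ.hasSum [] []
  (λ (k , j) _ → odd-pair-0 a m {k} {j} (λ e → a∤m (≡.subst (a ∣_) e (m∣m*n (suc (k ℕ.* 2) ℕ.* suc (j ℕ.* 2)))))) ≡.refl

-- Counting by indicator sums, and coefficients of the polynomials that define c.

-- A point with `P` has value 1, hence cannot lie outside the list of the sum. Filtering that list
-- by `P` therefore enumerates all such points, and its length is the sum of the indicator.
count : {I : Set} → DecidableEquality I → {P : I → Set} → (∀ i → Dec (P i)) → {G : I → ℤ} {s : ℤ} →
  (∀ i → P i → G i ≡ + 1) → (∀ i → ¬ P i → G i ≡ + 0) → ΣZ.HasSum G s →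
  Σ (List I) λ L → Unique L × (∀ i → (i ∈ L) ⇔ P i) × + length L ≡ s
count _≟_ {P} P? {G} {s} G1 G0 (ΣZ.hasSum L u out v) = filter P? L , Unique.filter⁺ P? u ,
  (λ i → mk⇔ (λ i∈ → proj₂ (∈-filter⁻ P? {xs = L} i∈)) (member i)) , ≡.trans (size L) v
  where
  open DecMembership _≟_ using (_∈?_)
  member : ∀ i → P i → i ∈ filter P? L
  member i p with i ∈? L
  ... | yes i∈ = ∈-filter⁺ P? i∈ p
  ... | no i∉ = ⊥-elim (1≢0 (≡.trans (≡.sym (G1 i p)) (out i i∉)))
    where
    1≢0 : ¬ + 1 ≡ + 0
    1≢0 ()
  size : ∀ L → + length (filter P? L) ≡ ΣZ.Σl G L
  size [] = ≡.refl
  size (i ∷ L) with P? i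
  ... | yes p = ≡.trans (ℤ.pos-+ 1 (length (filter P? L))) (≡.cong₂ ℤ._+_ (≡.sym (G1 i p)) (size L))
  ... | no ¬p = ≡.trans (size L) (≡.trans (≡.sym (ℤ.+-identityˡ _)) (≡.cong (ℤ._+ ΣZ.Σl G L) (≡.sym (G0 i ¬p))))

coeff-⊕ : ∀ p q i → coeff (p ⊕ q) i ≡ coeff p i ℤ.+ coeff q i
coeff-⊕ [] q i = ≡.sym (ℤ.+-identityˡ _)
coeff-⊕ (a ∷ p) [] i = ≡.sym (ℤ.+-identityʳ _)
coeff-⊕ (a ∷ p) (b ∷ q) zero = ≡.refl
coeff-⊕ (a ∷ p) (b ∷ q) (suc i) = coeff-⊕ p q i

coeff-scale : ∀ a p i → coeff (scale a p) i ≡ a ℤ.* coeff p i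
coeff-scale a [] i = ≡.sym (ℤ.*-zeroʳ a)
coeff-scale a (b ∷ p) zero = ≡.refl
coeff-scale a (b ∷ p) (suc i) = coeff-scale a p i

coeff-⊗ : ∀ p q i → coeff (p ⊗ q) i ≡ conv (coeff p) (coeff q) i
coeff-⊗ [] q i = ≡.sym (conv-0 i (coeff q))
coeff-⊗ (a ∷ p) q i = ≡.trans (coeff-⊕ (scale a q) (+ 0 ∷ (p ⊗ q)) i) (≡.trans (≡.cong (ℤ._+ coeff (+ 0 ∷ (p ⊗ q)) i) (coeff-scale a q i)) (step i))
  where
  step : ∀ i → a ℤ.* coeff q i ℤ.+ coeff (+ 0 ∷ (p ⊗ q)) i ≡ conv (coeff (a ∷ p)) (coeff q) i
  step zero = ℤ.+-identityʳ _
  step (suc i) = ≡.cong (λ z → a ℤ.* coeff q (suc i) ℤ.+ z) (coeff-⊗ p q i)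

coeff-oneMinusQ^ : ∀ m i → coeff (oneMinusQ^ (suc m)) i ≡ constant (+ 1) i ℤ.- δ (suc m) i
coeff-oneMinusQ^ m i = ≡.trans (coeff-⊕ (+ 1 ∷ replicate m (+ 0)) (replicate (suc m) (+ 0) ++ (ℤ.- + 1 ∷ [])) i) (≡.cong₂ ℤ._+_ (one i) (monomial (suc m) i))
  where
  zeros : ∀ m i → coeff (replicate m (+ 0)) i ≡ + 0
  zeros zero i = ≡.refl
  zeros (suc m) zero = ≡.refl
  zeros (suc m) (suc i) = zeros m i
  one : ∀ i → coeff (+ 1 ∷ replicate m (+ 0)) i ≡ constant (+ 1) i
  one zero = ≡.refl
  one (suc i) = zeros m i
  monomial : ∀ m i → coeff (replicate m (+ 0) ++ (ℤ.- + 1 ∷ [])) i ≡ ℤ.- δ m i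
  monomial zero zero = ≡.refl
  monomial zero (suc i) = ≡.refl
  monomial (suc m) zero = ≡.refl
  monomial (suc m) (suc i) = monomial m i

twiceQuad-exponent : ∀ v → twiceQuad 1 1 5 5 v ≡ + inner-exponent v
twiceQuad-exponent (x , y , z , w) = ≡.sym (begin
  + (2 ℕ.* T x ℕ.+ (2 ℕ.* T y ℕ.+ (10 ℕ.* T z ℕ.+ 10 ℕ.* T w)))
    ≡⟨ ≡.trans (ℤ.pos-+ (2 ℕ.* T x) _) (≡.cong₂ ℤ._+_ (double x) (≡.trans (ℤ.pos-+ (2 ℕ.* T y) _)
         (≡.cong₂ ℤ._+_ (double y) (≡.trans (ℤ.pos-+ (10 ℕ.* T z) _) (≡.cong₂ ℤ._+_ (tenfold z) (tenfold w)))))) ⟩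
  t x ℤ.+ (t y ℤ.+ (+ 5 ℤ.* t z ℤ.+ + 5 ℤ.* t w)) ≡⟨ lem (t x) (t y) (t z) (t w) ⟩
  twiceQuad 1 1 5 5 (x , y , z , w) ∎)
  where
  open ≡.≡-Reasoning
  t : ℤ → ℤ
  t n = n ℤ.* (n ℤ.- + 1)
  double : ∀ n → + (2 ℕ.* T n) ≡ t n
  double n = ≡.trans (ℤ.pos-* 2 (T n)) (≡.trans (2*e 0 1 n) (≡.trans (ℤ.+-identityˡ _) (ℤ.*-identityˡ (t n))))
  tenfold : ∀ n → + (10 ℕ.* T n) ≡ + 5 ℤ.* t n
  tenfold n = ≡.trans (≡.cong +_ (ℕ.*-assoc 5 2 (T n))) (≡.trans (ℤ.pos-* 5 (2 ℕ.* T n)) (≡.cong (+ 5 ℤ.*_) (double n)))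
  lem : ∀ a b c d → a ℤ.+ (b ℤ.+ (+ 5 ℤ.* c ℤ.+ + 5 ℤ.* d)) ≡ + 1 ℤ.* a ℤ.+ + 1 ℤ.* b ℤ.+ + 5 ℤ.* c ℤ.+ + 5 ℤ.* d
  lem = ℤ-Solver.solve-∀

-- Comparing coefficients, and the theorem.

-- The truncation order is m + 1 = k + 2, the smallest at which the coefficient of t^m survives.
module Coefficients (k : ℕ) where
  open PowerSeries (suc (suc k))
  private
    module R = NilpotentRing ℤ[t] embedding
    module X = CombinedIdentity.Expansions ℤ[t] embedding t-nil

  m = suc k

  m<P : m ℕ.< suc (suc k)
  m<P = ℕ.≤-refl

  S₁ S₅ : ℤ
  S₁ = X.S₁ m
  S₅ = X.S₅ m

  ⊗≈ : ∀ p q {F G} → coeff p R.≈ F → coeff q R.≈ G → coeff (p ⊗ q) R.≈ conv F G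
  ⊗≈ p q {F} {G} e e′ i i<P = ≡.trans (coeff-⊗ p q i) (R.*-cong {coeff p} {F} {coeff q} {G} e e′ i i<P)

  oneMinusQ^≈ : ∀ n → coeff (oneMinusQ^ (suc n)) R.≈ (R.1# R.- t R.^ suc n)
  oneMinusQ^≈ n i _ = ≡.trans (coeff-oneMinusQ^ n i) (≡.cong (λ z → constant (+ 1) i ℤ.- z) (≡.sym (t^-coefficient (suc n) i)))

  prodUpTo-rng : ∀ n → coeff (prodUpTo n) R.≈ R.rng X.eulers-factor n
  prodUpTo-rng zero zero _ = ≡.refl
  prodUpTo-rng zero (suc i) _ = ≡.refl
  prodUpTo-rng (suc n) = ⊗≈ (prodUpTo n) (f₂ ⊗ (f₂ ⊗ (f₁₀ ⊗ f₁₀))) (prodUpTo-rng n)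
    (⊗≈ f₂ (f₂ ⊗ (f₁₀ ⊗ f₁₀)) (oneMinusQ^≈ n₂) (⊗≈ f₂ (f₁₀ ⊗ f₁₀) (oneMinusQ^≈ n₂) (⊗≈ f₁₀ f₁₀ (oneMinusQ^≈ n₁₀) (oneMinusQ^≈ n₁₀))))
    where
    -- `2 * suc n` and `10 * suc n` compute to the successors of these numbers, the form required by
    -- `oneMinusQ^≈`.
    n₂ = n ℕ.+ 1 ℕ.* suc n
    n₁₀ = n ℕ.+ 9 ℕ.* suc n
    f₂ = oneMinusQ^ (suc n₂)
    f₁₀ = oneMinusQ^ (suc n₁₀)

  -- The factor t is the leading q in the definition of c; it shifts the index from m to k, where
  -- the product up to k + 1 is already exact.
  c-coefficient : conv t X.eulers m ≡ c m
  c-coefficient = ≡.trans (t*-suc X.eulers k)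
    (≡.trans (X.eulers-rng (suc k) ℕ.≤-refl k (ℕ.n≤1+n _)) (≡.sym (prodUpTo-rng (suc k) k (ℕ.n≤1+n _))))

  odd-pair-HasSum : ∀ a {s} → R.HasSum (X.odd-divisor-power a) s → ΣZ.HasSum (odd-pair-term a m) (s m)
  odd-pair-HasSum a h = ΣZ.hs-cong terms ≡.refl (coefficient-HasSum m<P h)
    where
    terms : ∀ p → X.odd-divisor-power a p m ≡ odd-pair-term a m p
    terms (i , j) = ≡.trans (⟦⟧*-coefficient (+ suc (i ℕ.* 2)) (t R.^ n) m m<P) (≡.cong (+ suc (i ℕ.* 2) ℤ.*_) (t^-coefficient n m))
      where n = a ℕ.* (suc (i ℕ.* 2) ℕ.* suc (j ℕ.* 2))

  S₁-HasSum : ΣZ.HasSum (odd-pair-term 1 m) S₁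
  S₁-HasSum = odd-pair-HasSum 1 X.S₁-HasSum

  S₅-HasSum : ΣZ.HasSum (odd-pair-term 5 m) S₅
  S₅-HasSum = odd-pair-HasSum 5 X.S₅-HasSum

  reps : ℤ
  reps = X.reps m

  reps-HasSum : ΣZ.HasSum (λ v → δ (3 ℕ.+ inner-exponent v) m) reps
  reps-HasSum = ΣZ.hs-cong (λ v → t^-coefficient (3 ℕ.+ inner-exponent v) m) ≡.refl (coefficient-HasSum m<P X.reps-HasSum)

  coefficient-identity : + 64 ℤ.* S₁ ℤ.+ + 320 ℤ.* S₅ ≡ + 24 ℤ.* reps ℤ.+ + 64 ℤ.* c m
  coefficient-identity = ≡.trans (≡.sym (≡.cong₂ ℤ._+_ (⟦⟧*-coefficient (+ 64) X.S₁ m m<P) (⟦⟧*-coefficient (+ 320) X.S₅ m m<P)))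
    (≡.trans (X.identity m m<P)
      (≡.cong₂ ℤ._+_ (⟦⟧*-coefficient (+ 24) X.reps m m<P) (≡.trans (⟦⟧*-coefficient (+ 64) (conv t X.eulers) m m<P) (≡.cong (+ 64 ℤ.*_) c-coefficient))))

δ-count : ∀ n {r} → ΣZ.HasSum (λ v → δ (3 ℕ.+ inner-exponent v) (3 ℕ.+ 2 ℕ.* n)) r →
  Σ (List (ℤ × ℤ × ℤ × ℤ)) λ L → Unique L × (∀ v → (v ∈ L) ⇔ IsRep 1 1 5 5 n v) × + length L ≡ r
δ-count n = count (×.≡-dec ℤ._≟_ (×.≡-dec ℤ._≟_ (×.≡-dec ℤ._≟_ ℤ._≟_))) {IsRep 1 1 5 5 n} (λ v → twiceQuad 1 1 5 5 v ℤ.≟ + (2 ℕ.* n))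
  (λ v r → ≡.trans (≡.cong (δ (3 ℕ.+ inner-exponent v)) (≡.sym (exponent≡ v r))) (δ-≡ (3 ℕ.+ inner-exponent v)))
  (λ v ¬r → δ-≢ (3 ℕ.+ inner-exponent v) (3 ℕ.+ 2 ℕ.* n)
    (λ e → ¬r (≡.trans (twiceQuad-exponent v) (≡.cong +_ (ℕ.+-cancelˡ-≡ 3 (inner-exponent v) (2 ℕ.* n) e)))))
  where
  exponent≡ : ∀ v → IsRep 1 1 5 5 n v → 3 ℕ.+ inner-exponent v ≡ 3 ℕ.+ 2 ℕ.* n
  exponent≡ v r = ≡.cong (3 ℕ.+_) (ℤ.+-injective (≡.trans (≡.sym (twiceQuad-exponent v)) r))

module DivisorPart (n β n₁ : ℕ) (m≡ : 2 ℕ.* n ℕ.+ 3 ≡ 5 ℕ.^ β ℕ.* n₁) (5∤n₁ : ¬ 5 ∣ n₁) {S₁ S₅ : ℤ}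
  (S₁-HasSum : ΣZ.HasSum (odd-pair-term 1 (3 ℕ.+ 2 ℕ.* n)) S₁) (S₅-HasSum : ΣZ.HasSum (odd-pair-term 5 (3 ℕ.+ 2 ℕ.* n)) S₅) where
  private m = 3 ℕ.+ 2 ℕ.* n

  private
    m-odd : m ≡ suc (suc n ℕ.* 2)
    m-odd = ≡.cong (λ z → 3 ℕ.+ z) (ℕ.*-comm 2 n)

    m≡5^ : m ≡ 5 ℕ.^ β ℕ.* n₁
    m≡5^ = ≡.trans (ℕ.+-comm 3 (2 ℕ.* n)) m≡

    instance
      n₁≢0 : ℕ.NonZero n₁
      n₁≢0 = ℕ.≢-nonZero (λ { ≡.refl → ℕ.1+n≢0 (≡.trans m≡5^ (ℕ.*-zeroʳ (5 ℕ.^ β))) })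

    S₁≡ : S₁ ≡ + σ m
    S₁≡ = ΣZ.hs-unique (×.≡-dec ℕ._≟_ ℕ._≟_) S₁-HasSum
      (≡.subst (λ m → ΣZ.HasSum (odd-pair-term 1 m) (+ σ m)) (≡.sym m-odd)
        (≡.subst (λ z → ΣZ.HasSum (odd-pair-term 1 z) (+ σ (suc (suc n ℕ.* 2)))) (ℕ.*-identityˡ (suc (suc n ℕ.* 2))) (odd-pairs-σ 1 (suc n))))

    S₅≡0 : ¬ 5 ∣ m → S₅ ≡ + 0
    S₅≡0 5∤m = ΣZ.hs-unique (×.≡-dec ℕ._≟_ ℕ._≟_) S₅-HasSum (odd-pairs-empty 5∤m)

    S₅≡ : ∀ {M} → m ≡ 5 ℕ.* M → S₅ ≡ + σ M
    S₅≡ {M} m≡5M with odd-factor {suc n} {M} (≡.subst (M ∣_) m-odd (divides 5 m≡5M))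
    ... | (h , ≡.refl) = ΣZ.hs-unique (×.≡-dec ℕ._≟_ ℕ._≟_) S₅-HasSum
          (≡.subst (λ z → ΣZ.HasSum (odd-pair-term 5 z) (+ σ M)) (≡.sym m≡5M) (odd-pairs-σ 5 h))

  -- Split by whether 5 divides m. If β = 0, the sum `S₅` is empty and only 64σ(n₁) is left.
  -- Otherwise `S₅` is σ(m/5), and `4σ` with p = 5^β gives 16(5p - 1) + 80(p - 1) = 32(5p - 3) as
  -- the factor of σ(n₁).
  value : + 64 ℤ.* S₁ ℤ.+ + 320 ℤ.* S₅ ≡ + 8 ℤ.* (+ 4 ℤ.* (+ (5 ℕ.^ suc β) ℤ.- + 3) ℤ.* + σ n₁)
  value = go β ≡.refl
    where
    open ≡.≡-Reasoning
    go : ∀ γ → β ≡ γ → + 64 ℤ.* S₁ ℤ.+ + 320 ℤ.* S₅ ≡ + 8 ℤ.* (+ 4 ℤ.* (+ (5 ℕ.^ suc γ) ℤ.- + 3) ℤ.* + σ n₁)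
    go zero ≡.refl = begin
      + 64 ℤ.* S₁ ℤ.+ + 320 ℤ.* S₅
        ≡⟨ ≡.cong₂ (λ x y → + 64 ℤ.* x ℤ.+ + 320 ℤ.* y) (≡.trans S₁≡ (≡.cong (λ z → + σ z) m≡n₁)) (S₅≡0 (λ 5∣m → 5∤n₁ (≡.subst (5 ∣_) m≡n₁ 5∣m))) ⟩
      + 64 ℤ.* + σ n₁ ℤ.+ + 0 ≡⟨ lem (+ σ n₁) ⟩
      -- The 2 is 5^1 - 3, to which the goal computes.
      + 8 ℤ.* (+ 4 ℤ.* + 2 ℤ.* + σ n₁) ∎
      where
      m≡n₁ : m ≡ n₁
      m≡n₁ = ≡.trans m≡5^ (ℕ.*-identityˡ n₁)
      lem : ∀ s → + 64 ℤ.* s ℤ.+ + 0 ≡ + 8 ℤ.* (+ 4 ℤ.* + 2 ℤ.* s)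
      lem = ℤ-Solver.solve-∀
    go (suc γ) ≡.refl = begin
      + 64 ℤ.* S₁ ℤ.+ + 320 ℤ.* S₅
        ≡⟨ ≡.cong₂ (λ x y → + 64 ℤ.* x ℤ.+ + 320 ℤ.* y) (≡.trans S₁≡ (≡.cong (λ z → + σ z) m≡5^)) (S₅≡ {5 ℕ.^ γ ℕ.* n₁} (≡.trans m≡5^ (ℕ.*-assoc 5 (5 ℕ.^ γ) n₁))) ⟩
      + 64 ℤ.* + σ (5 ℕ.^ suc γ ℕ.* n₁) ℤ.+ + 320 ℤ.* + σ (5 ℕ.^ γ ℕ.* n₁) ≡⟨ lem₁ (+ σ (5 ℕ.^ suc γ ℕ.* n₁)) (+ σ (5 ℕ.^ γ ℕ.* n₁)) ⟩
      + 16 ℤ.* (+ 4 ℤ.* + σ (5 ℕ.^ suc γ ℕ.* n₁)) ℤ.+ + 80 ℤ.* (+ 4 ℤ.* + σ (5 ℕ.^ γ ℕ.* n₁))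
        ≡⟨ ≡.cong₂ (λ x y → + 16 ℤ.* x ℤ.+ + 80 ℤ.* y) (4σ (suc γ) n₁ 5∤n₁) (4σ γ n₁ 5∤n₁) ⟩
      + 16 ℤ.* ((+ (5 ℕ.^ suc (suc γ)) ℤ.- + 1) ℤ.* s) ℤ.+ + 80 ℤ.* ((p ℤ.- + 1) ℤ.* s)
        ≡⟨ ≡.cong (λ z → + 16 ℤ.* ((z ℤ.- + 1) ℤ.* s) ℤ.+ + 80 ℤ.* ((p ℤ.- + 1) ℤ.* s)) (ℤ.pos-* 5 (5 ℕ.^ suc γ)) ⟩
      + 16 ℤ.* ((+ 5 ℤ.* p ℤ.- + 1) ℤ.* s) ℤ.+ + 80 ℤ.* ((p ℤ.- + 1) ℤ.* s) ≡⟨ lem₂ p s ⟩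
      + 8 ℤ.* (+ 4 ℤ.* (+ 5 ℤ.* p ℤ.- + 3) ℤ.* s) ≡⟨ ≡.cong (λ z → + 8 ℤ.* (+ 4 ℤ.* (z ℤ.- + 3) ℤ.* s)) (ℤ.pos-* 5 (5 ℕ.^ suc γ)) ⟨
      + 8 ℤ.* (+ 4 ℤ.* (+ (5 ℕ.^ suc (suc γ)) ℤ.- + 3) ℤ.* s) ∎
      where
      s = + σ n₁
      p = + (5 ℕ.^ suc γ)
      lem₁ : ∀ a b → + 64 ℤ.* a ℤ.+ + 320 ℤ.* b ≡ + 16 ℤ.* (+ 4 ℤ.* a) ℤ.+ + 80 ℤ.* (+ 4 ℤ.* b)
      lem₁ = ℤ-Solver.solve-∀
      lem₂ : ∀ p s → + 16 ℤ.* ((+ 5 ℤ.* p ℤ.- + 1) ℤ.* s) ℤ.+ + 80 ℤ.* ((p ℤ.- + 1) ℤ.* s) ≡ + 8 ℤ.* (+ 4 ℤ.* (+ 5 ℤ.* p ℤ.- + 3) ℤ.* s)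
      lem₂ = ℤ-Solver.solve-∀

open import Data.Nat using (_^_)

theorem4p2 : (n : ℕ) → 1 ℕ.≤ n → (β n₁ : ℕ) → 2 ℕ.* n ℕ.+ 3 ≡ 5 ^ β ℕ.* n₁ → ¬ (5 ∣ n₁) →
    Σ (List (ℤ × ℤ × ℤ × ℤ)) λ L →
    Unique L × ((v : ℤ × ℤ × ℤ × ℤ) → (v ∈ L) ⇔ IsRep 1 1 5 5 n v) ×
    (+ 3 ℤ.* + length L ≡ + 4 ℤ.* ((+ (5 ^ suc β)) ℤ.- + 3) ℤ.* + σ n₁ ℤ.- + 8 ℤ.* c (2 ℕ.* n ℕ.+ 3))
theorem4p2 n _ β n₁ m≡ 5∤n₁ = conclude S₁-HasSum S₅-HasSum (δ-count n reps-HasSum) coefficient-identity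
  where
  open Coefficients (2 ℕ.+ 2 ℕ.* n)
  C = c (3 ℕ.+ 2 ℕ.* n)
  D = + 4 ℤ.* (+ (5 ℕ.^ suc β) ℤ.- + 3) ℤ.* + σ n₁
  lem₁ : ∀ l c → + 8 ℤ.* (+ 3 ℤ.* l) ≡ (+ 24 ℤ.* l ℤ.+ + 64 ℤ.* c) ℤ.- + 64 ℤ.* c
  lem₁ = ℤ-Solver.solve-∀
  lem₂ : ∀ d c → + 8 ℤ.* d ℤ.- + 64 ℤ.* c ≡ + 8 ℤ.* (d ℤ.- + 8 ℤ.* c)
  lem₂ = ℤ-Solver.solve-∀
  -- The values `S₁`, `S₅` and `r` are variables here, so the power series whose coefficients they
  -- are need not be unfolded.
  conclude : ∀ {A : List (ℤ × ℤ × ℤ × ℤ) → Set} {B : List (ℤ × ℤ × ℤ × ℤ) → Set} {S₁ S₅ r} →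
    ΣZ.HasSum (odd-pair-term 1 (3 ℕ.+ 2 ℕ.* n)) S₁ → ΣZ.HasSum (odd-pair-term 5 (3 ℕ.+ 2 ℕ.* n)) S₅ →
    (Σ (List (ℤ × ℤ × ℤ × ℤ)) λ L → A L × B L × + length L ≡ r) →
    + 64 ℤ.* S₁ ℤ.+ + 320 ℤ.* S₅ ≡ + 24 ℤ.* r ℤ.+ + 64 ℤ.* C →
    Σ (List (ℤ × ℤ × ℤ × ℤ)) λ L → A L × B L × (+ 3 ℤ.* + length L ≡ D ℤ.- + 8 ℤ.* c (2 ℕ.* n ℕ.+ 3))
  conclude {S₁ = S₁} {S₅} h₁ h₅ (L , A , B , ≡.refl) identity = L , A , B , ℤ.*-cancelˡ-≡ (+ 8) _ _ (begin
    -- The constants 24 and 64 and the divisor side share the factor 8; removing it in ℤ leaves the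
    -- 3, the 8 and the 4 of the theorem.
    + 8 ℤ.* (+ 3 ℤ.* + length L) ≡⟨ lem₁ (+ length L) C ⟩
    (+ 24 ℤ.* + length L ℤ.+ + 64 ℤ.* C) ℤ.- + 64 ℤ.* C
      ≡⟨ ≡.cong (λ z → z ℤ.- + 64 ℤ.* C) (≡.trans (≡.sym identity) (DivisorPart.value n β n₁ m≡ 5∤n₁ h₁ h₅)) ⟩
    + 8 ℤ.* D ℤ.- + 64 ℤ.* C ≡⟨ lem₂ D C ⟩
    + 8 ℤ.* (D ℤ.- + 8 ℤ.* C) ≡⟨ ≡.cong (λ k → + 8 ℤ.* (D ℤ.- + 8 ℤ.* c k)) (ℕ.+-comm 3 (2 ℕ.* n)) ⟩
    + 8 ℤ.* (D ℤ.- + 8 ℤ.* c (2 ℕ.* n ℕ.+ 3)) ∎)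
    where open ≡.≡-Reasoning
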